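{- Let $q$ be a prime power and $n>2$ an integer. Let $b\in\mathbb{F}_{q^{2n}}^*$ and let $1\leq s\leq 2n-1$ be an integer with $\gcd(s,n)=1$ and $\mathrm{N}_{q^{2n}/q^n}(b)\neq 1$, and suppose that the $\mathbb{F}_q$-subspace $U_{b,s}=\{(x,bx^{q^s}+x^{q^{s+n}})\colon x\in\mathbb{F}_{q^{2n}}\}$ of $\mathbb{F}_{q^{2n}}\times\mathbb{F}_{q^{2n}}$ is scattered. Then the $\mathbb{F}_q$-linear MRD-code of dimension $4n$ and minimum distance $2n-1$ arising from $U_{b,s}$, namely $$\{x\mapsto a_1(bx^{q^s}+x^{q^{s+n}})+a_0x\colon a_0,a_1\in\mathbb{F}_{q^{2n}}\},$$ is not equivalent to any of the previously known $\mathbb{F}_q$-linear MRD-codes with the same parameters $(2n,2n,q;2n-1)$, that is, to any code $$\mathcal{H}_{2,t}(\mu,h)=\{x\mapsto a_0x+a_1x^{q^t}+\mu a_0^{q^h}x^{q^{2t}}\colon a_0,a_1\in\mathbb{F}_{q^{2n}}\},$$ where $t$ and $h$ are non-negative integers, $\gcd(t,2n)=1$, and $\mu\in\mathbb{F}_{q^{2n}}$ satisfies $\mathrm{N}_{q^{2nt}/q^{t}}(\mu)\neq 1$.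
   Context: $\mathrm{N}_{q^{2n}/q^n}(x)=x^{q^n+1}$ is the norm from $\mathbb{F}_{q^{2n}}$ to $\mathbb{F}_{q^n}$, and $\mathrm{N}_{q^{2nt}/q^{t}}$ is the norm from $\mathbb{F}_{q^{2nt}}$ to $\mathbb{F}_{q^t}$. An $\mathbb{F}_q$-subspace $U$ of $\mathbb{F}_{q^m}\times\mathbb{F}_{q^m}$ is scattered if $\dim_{\mathbb{F}_q}(\langle \mathbf{v}\rangle_{\mathbb{F}_{q^m}}\cap U)\leq 1$ for every nonzero $\mathbf{v}\in\mathbb{F}_{q^m}\times\mathbb{F}_{q^m}$. After fixing an $\mathbb{F}_q$-basis of $\mathbb{F}_{q^m}$ (here $m=2n$), sets of $\mathbb{F}_q$-linear maps $\mathbb{F}_{q^m}\to\mathbb{F}_{q^m}$ are identified with subsets (codes) of $\mathbb{F}_q^{m\times m}$. The rank distance is $d(A,B)=\mathrm{rk}(A-B)$ and the minimum distance $d$ of a code is the smallest distance between two distinct elements; a code $\mathcal{C}\subseteq\mathbb{F}_q^{m\times m}$ is an MRD-code if $\#\mathcal{C}=q^{m(m-d+1)}$, and an $\mathbb{F}_q$-linear code in $\mathbb{F}_q^{m\times m}$ with minimum distance $d$ has parameters $(m,m,q;d)$. Two codes $\mathcal{C},\mathcal{C}'\subseteq\mathbb{F}_q^{m\times m}$ are equivalent if and only if there exist invertible matrices $A,B\in\mathbb{F}_q^{m\times m}$ and a field automorphism $\sigma$ of $\mathbb{F}_q$ (applied entrywise) such that $\{AC^{\sigma}B\colon C\in\mathcal{C}\}=\mathcal{C}'$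 or $\{AC^{T\sigma}B\colon C\in\mathcal{C}\}=\mathcal{C}'$, where $T$ denotes transposition. -}

module Defs where

open import Level using (0ℓ)
open import Algebra.Bundles using (CommutativeRing; RawRing)
open import Algebra.Structures using (IsCommutativeRing)
open import Algebra.Module.Bundles.Raw using (RawLeftModule)
import Algebra.Module.Construct.DirectProduct as DirectProduct
import Algebra.Module.Construct.TensorUnit as TensorUnit
open import Algebra.Morphism.Structures using (module RingMorphisms)
import Algebra.Definitions.RawMonoid as RawMonoidDefs
import Algebra.Definitions.RawSemiring as RawSemiringDefs
open import Data.Bool.Base using (if_then_else_)
open import Data.Fin.Base using (Fin; toℕ)
open import Data.Fin.Properties using (_≟_)
open import Data.Nat.Base as ℕ using (ℕ; _≤_; _∸_)
open import Data.Nat.Primality using (Prime)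
open import Data.Product.Base using (_×_; _,_; ∃-syntax)
open import Data.Sum.Base using (_⊎_)
open import Data.Vec.Functional using (Vector)
open import Function.Bundles using (_↔_)
open import Function.Definitions using (Injective)
open import Relation.Binary.PropositionalEquality.Core using (_≡_; _≢_)
open import Relation.Nullary.Decidable.Core using (⌊_⌋)
open import Relation.Nullary.Negation.Core using (¬_)
open import Relation.Unary using (Pred; _∈_; _∩_; _≐_; U)

IsPrimePower : ℕ → Set
IsPrimePower q = ∃[ p ] ∃[ k ] Prime p × 1 ≤ k × q ≡ p ℕ.^ k

record Field : Set₁ where
  infix  8 -_
  infixl 7 _*_
  infixl 6 _+_
  field
    Carrier           : Set
    _+_ _*_           : Carrier → Carrier → Carrier
    -_                : Carrier → Carrier
    0# 1#             : Carrier
    isCommutativeRing : IsCommutativeRing _≡_ _+_ _*_ -_ 0# 1#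
    0≢1               : 0# ≢ 1#
    inverse           : ∀ x → x ≢ 0# → ∃[ y ] x * y ≡ 1#

  commutativeRing : CommutativeRing 0ℓ 0ℓ
  commutativeRing = record { isCommutativeRing = isCommutativeRing }

  open CommutativeRing commutativeRing public using (rawRing)
  open RawRing rawRing public using (rawSemiring)
  open RawSemiringDefs rawSemiring public using (sum; product; _^_)

HasOrder : Field → ℕ → Set
HasOrder K N = Field.Carrier K ↔ Fin N

IsFieldHomomorphism : (K L : Field) → (Field.Carrier K → Field.Carrier L) → Set
IsFieldHomomorphism K L =
  RingMorphisms.IsRingHomomorphism (Field.rawRing K) (Field.rawRing L)

IsFieldAutomorphism : (K : Field) → (Field.Carrier K → Field.Carrier K) → Set
IsFieldAutomorphism K =
  RingMorphisms.IsRingIsomorphism (Field.rawRing K) (Field.rawRing K)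

-- The norm from the field of order Q ^ d to the field of order Q, as the
-- product of the conjugates x ^ (Q ^ i), 0 ≤ i < d. For d = 2 it is x ^ (Q + 1).
-- The formula is evaluated inside any field L containing x, so it also gives
-- the norm of an element x of L when L is a subfield of the field of order Q ^ d.
norm : (L : Field) (Q d : ℕ) → Field.Carrier L → Field.Carrier L
norm L Q d x = product {d} (λ i → x ^ (Q ℕ.^ toℕ i))
  where open Field L

module LinearAlgebra (K : Field) where
  open Field K

  VectorSpace : Set₁
  VectorSpace = RawLeftModule Carrier 0ℓ 0ℓ

  module _ (V : VectorSpace) where
    open RawLeftModule V

    combination : ∀ {d} → Vector Carrier d → Vector Carrierᴹ d → Carrierᴹ
    combination c v = RawMonoidDefs.sum +ᴹ-rawMonoid (λ i → c i *ₗ v i)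

    LinearlyIndependent : ∀ {d} → Vector Carrierᴹ d → Set
    LinearlyIndependent v = ∀ c → combination c v ≈ᴹ 0ᴹ → ∀ i → c i ≡ 0#

    Span : ∀ {d} → Vector Carrierᴹ d → Pred Carrierᴹ 0ℓ
    Span v w = ∃[ c ] w ≈ᴹ combination c v

    -- As W is equal to a span, W is in particular a linear subspace.
    IsBasisOf : ∀ {d} → Pred Carrierᴹ 0ℓ → Vector Carrierᴹ d → Set
    IsBasisOf W v = LinearlyIndependent v × W ≐ Span v

    HasDimension : Pred Carrierᴹ 0ℓ → ℕ → Set
    HasDimension W d = ∃[ v ] IsBasisOf {d} W v

  power : VectorSpace → ℕ → VectorSpace
  power V n = record
    { Carrierᴹ = Vector Carrierᴹ n
    ; _≈ᴹ_     = λ v w → ∀ i → v i ≈ᴹ w i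
    ; _+ᴹ_     = λ v w i → v i +ᴹ w i
    ; _*ₗ_     = λ c v i → c *ₗ v i
    ; 0ᴹ       = λ _ → 0ᴹ
    ; -ᴹ_      = λ v i → -ᴹ v i
    } where open RawLeftModule V

  columnVectors : ℕ → VectorSpace
  columnVectors = power (TensorUnit.rawLeftModule {R = rawRing})

module RankMetric (K : Field) (m : ℕ) where
  open Field K
  open LinearAlgebra K

  matrices : VectorSpace
  matrices = power (columnVectors m) m

  open RawLeftModule matrices public
    using () renaming (Carrierᴹ to Matrix; _≈ᴹ_ to _≈_; _+ᴹ_ to _⊕_; -ᴹ_ to ⊝_)

  Code : Set₁
  Code = Pred Matrix 0ℓ

  _⊗_ : Matrix → Matrix → Matrix
  (A ⊗ B) i j = sum (λ k → A i k * B k j)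

  identity : Matrix
  identity i j = if ⌊ i ≟ j ⌋ then 1# else 0#

  transpose : Matrix → Matrix
  transpose A i j = A j i

  mapEntries : (Carrier → Carrier) → Matrix → Matrix
  mapEntries σ A i j = σ (A i j)

  Invertible : Matrix → Set
  Invertible A = ∃[ B ] (A ⊗ B) ≈ identity × (B ⊗ A) ≈ identity

  -- The rows of transpose A are the columns of A.
  ColumnSpace : Matrix → Pred (Vector Carrier m) 0ℓ
  ColumnSpace A = Span (columnVectors m) (transpose A)

  HasRank : Matrix → ℕ → Set
  HasRank A r = HasDimension (columnVectors m) (ColumnSpace A) r

  HasDistance : Matrix → Matrix → ℕ → Set
  HasDistance A B r = HasRank (A ⊕ (⊝ B)) r

  HasMinimumDistance : Code → ℕ → Set
  HasMinimumDistance C d = Attained d × (∀ r → Attained r → d ≤ r)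
    where
    Attained : ℕ → Set
    Attained r =
      ∃[ A ] ∃[ B ] A ∈ C × B ∈ C × ¬ (A ≈ B) × HasDistance A B r

  HasSize : Code → ℕ → Set
  HasSize C N = ∃[ f ] (∀ (i : Fin N) → f i ∈ C)
                     × Injective _≡_ _≈_ f
                     × (∀ {A} → A ∈ C → ∃[ i ] A ≈ f i)

  -- q is the order of K.
  IsMRD : (q : ℕ) → Code → (d : ℕ) → Set
  IsMRD q C d =
    HasMinimumDistance C d × HasSize C (q ℕ.^ (m ℕ.* (m ∸ d ℕ.+ 1)))

  image : (Matrix → Matrix) → Code → Code
  image φ C N = ∃[ M ] M ∈ C × N ≈ φ M

  Equivalent : Code → Code → Set
  Equivalent C C′ =
    ∃[ A ] ∃[ B ] ∃[ σ ]
      Invertible A × Invertible B × IsFieldAutomorphism K σ ×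
      ( image (λ M → (A ⊗ mapEntries σ M) ⊗ B) C ≐ C′
      ⊎ image (λ M → (A ⊗ mapEntries σ (transpose M)) ⊗ B) C ≐ C′ )

module Extension (K L : Field) (ι : Field.Carrier K → Field.Carrier L) where
  open Field L
  open LinearAlgebra K

  extension : VectorSpace
  extension = record
    { Carrierᴹ = Carrier
    ; _≈ᴹ_     = _≡_
    ; _+ᴹ_     = _+_
    ; _*ₗ_     = λ c x → ι c * x
    ; 0ᴹ       = 0#
    ; -ᴹ_      = -_
    }

  plane : VectorSpace
  plane = DirectProduct.rawLeftModule extension extension

  IsBasisOfExtension : ∀ {m} → Vector Carrier m → Set
  IsBasisOfExtension = IsBasisOf extension U

  -- The span of v over L, not over K.
  Line : Carrier × Carrier → Pred (Carrier × Carrier) 0ℓ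
  Line (v₁ , v₂) w = ∃[ c ] w ≡ (c * v₁ , c * v₂)

  IsScattered : Pred (Carrier × Carrier) 0ℓ → Set
  IsScattered W = ∀ v → v ≢ (0# , 0#) →
    ∃[ d ] d ≤ 1 × HasDimension plane (Line v ∩ W) d

  module _ {m : ℕ} (e : Vector Carrier m) where
    open RankMetric K m

    -- The j-th column of M holds the e-coordinates of φ (e j).
    Represents : Matrix → (Carrier → Carrier) → Set
    Represents M φ = ∀ j → φ (e j) ≡ combination extension (λ i → M i j) e

    toCode : Pred (Carrier → Carrier) 0ℓ → Code
    toCode Φ M = ∃[ φ ] φ ∈ Φ × Represents M φ

-- L is the field of order q ^ (2 * n).
module Families (L : Field) (q n : ℕ) where
  open Field L

  U⟨_,_⟩ : Carrier → ℕ → Pred (Carrier × Carrier) 0ℓ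
  U⟨ b , s ⟩ w =
    ∃[ x ] w ≡ (x , b * x ^ (q ℕ.^ s) + x ^ (q ℕ.^ (s ℕ.+ n)))

  𝒞⟨_,_⟩ : Carrier → ℕ → Pred (Carrier → Carrier) 0ℓ
  𝒞⟨ b , s ⟩ φ = ∃[ a₀ ] ∃[ a₁ ] ∀ x →
    φ x ≡ a₁ * (b * x ^ (q ℕ.^ s) + x ^ (q ℕ.^ (s ℕ.+ n))) + a₀ * x

  ℋ₂ : (t : ℕ) (μ : Carrier) (h : ℕ) → Pred (Carrier → Carrier) 0ℓ
  ℋ₂ t μ h φ = ∃[ a₀ ] ∃[ a₁ ] ∀ x →
    φ x ≡ a₀ * x + a₁ * x ^ (q ℕ.^ t)
          + μ * a₀ ^ (q ℕ.^ h) * x ^ (q ℕ.^ (2 ℕ.* t))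

{-# OPTIONS --safe #-}

-- A scattered U = {(x , f x)} meets every line in at most a K-line, so every nonzero map a₁ f + a₀
-- has kernel of dimension at most 1; the map f − f(e₀)/e₀ attains it. For the lower bound on the
-- rank r, two applications of the pigeonhole principle (K ^ (r + 2) → K ^ (r + 1)) produce two
-- independent kernel vectors.
--
-- For the inequivalence write θ x = x ^ (q ^ t) and suppose that ℋ = A 𝒞^σ B. The code 𝒞 is closed
-- under composition on the left with the multiplications by elements of L, hence ℋ is closed under
-- left composition with their images under Ψ M = A M^σ A⁻¹. Composing with θ and with 1 + μ θ² shows
-- that the left idealiser of ℋ consists of multiplications, whatever μ and h are. So Ψ induces a
-- multiplicative bijection of L, and therefore sends x ^ (q ^ u) to a multiple of itself.
-- Now g = A B lies in ℋ and so does Ψ(f) g, where g has θ-exponents in {0 , 1 , 2}, while the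
-- exponents of Ψ(f) g come in pairs that differ by n, without cancellation. Two exponents that differ
-- by n cannot both lie in {0 , t , 2 t} modulo 2 n when n > 2, so g = 0, which is absurd. If
-- ℋ = A 𝒞^(Tσ) B, the same argument applies with Ψ M = B⁻¹ M^(Tσ) B, which reverses products, and
-- with the right idealiser. By Dedekind's independence of characters the coefficients of linearized
-- polynomials of degree below q ^ (2 n) are determined by the function.
module Submission where

open import Defs
open import Algebra.Bundles using (CommutativeRing; CommutativeMonoid)
open import Algebra.Morphism.Structures using (module RingMorphisms)
open import Data.Empty using (⊥; ⊥-elim)
open import Data.Fin.Base using (Fin; zero; suc; toℕ; punchIn; inject₁; fromℕ; finToFun; funToFin; combine; splitAt; _↑ˡ_; _↑ʳ_; inject≤; fromℕ<)
open import Data.Fin.Properties using (toℕ-injective; suc-injective; 0≢1+n; punchInᵢ≢i; pigeonhole; ¬∀⟶∃¬; finToFun-funToFin; funToFin-finToFin; inject≤-injective)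
open import Data.List.Base using (List; []; _∷_; length; _++_; replicate; map)
open import Data.List.Properties using (length-++; length-replicate)
open import Data.List.Relation.Unary.All using (All; []; _∷_)
open import Data.List.Relation.Unary.All.Properties using (++⁻ʳ)
open import Data.Nat.Base using (ℕ; zero; suc; _+_; _*_; _^_; _∸_; _≤_; _<_; _!; z≤n; s≤s; NonZero; nonZero; >-nonZero; ≢-nonZero; ≢-nonZero⁻¹; >-nonZero⁻¹; nonTrivial⇒n>1)
open import Data.Nat.Combinatorics using (_C_; nCk≡n!/k![n-k]!; k![n∸k]!∣n!; nCn≡1)
open import Data.Nat.Coprimality using (gcd≡1⇒coprime; coprime-divisor)
open import Data.Nat.DivMod using (m/n*n≡m; _%_; _/_; %-distribˡ-+; %-distribˡ-*; [m+kn]%n≡m%n; [m+n]%n≡m%n; m<n⇒m%n≡m; m*n%n≡0; m%n<n; m≡m%n+[m/n]*n)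
open import Data.Nat.Divisibility using (_∣_; ∣⇒≤; ∣m⇒∣m*n; ∣-refl; divides; m%n≡0⇒n∣m; n∣m⇒m%n≡0)
open import Data.Nat.GCD using (gcd)
open import Data.Nat.Primality using (Prime; euclidsLemma; prime⇒nonTrivial; prime⇒nonZero; ¬prime[0])
open import Data.Nat.Properties using (_!*_!≢0)
open import Data.Product.Base using (_×_; _,_; ∃-syntax; proj₁; proj₂)
open import Data.Sum.Base using (_⊎_; inj₁; inj₂; [_,_]′; fromInj₁)
open import Data.Vec.Functional using (Vector; removeAt)
open import Function.Base using (_∘_; id)
open import Function.Bundles using (_↔_; module Inverse; mk↔ₛ′)
open import Function.Definitions using (Injective)
open import Level using (0ℓ)
open import Relation.Binary.Definitions using (tri<; tri≈; tri>)
open import Relation.Binary.PropositionalEquality using (_≡_; _≢_; _≗_; refl; sym; trans; cong; cong₂; subst; module ≡-Reasoning)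
open import Relation.Nullary.Decidable using (Dec; yes; no; map′; decidable-stable; _×-dec_)
open import Relation.Nullary.Negation.Core using (¬_; contradiction)
open import Relation.Unary using (Pred; _∈_; _≐_)
import Algebra.Properties.CommutativeMonoid.Sum as CommutativeMonoidSum
import Algebra.Properties.CommutativeSemiring.Binomial as Binomial
import Algebra.Properties.CommutativeSemiring.Exp as CommutativeSemiringExp
import Algebra.Properties.Ring as RingProperties
import Algebra.Properties.Semiring.Mult as SemiringMult
import Algebra.Properties.Semiring.Sum as SemiringSum
import Data.Fin.Properties as Finₚ
import Data.Nat.Coprimality as Coprimality
import Data.Nat.Properties as ℕₚ

-- The obstacle is that the entrywise action of `σ` depends on the basis `e` and has no formula on
-- maps of L, so `Ψ` cannot be computed on a Frobenius power directly. Such a power is recognised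
-- instead by an intrinsic relation: following multiplication by `ω` with x ^ (q ^ u) is the same as
-- following x ^ (q ^ u) with multiplication by ω ^ (q ^ u). A multiplicative `Ψ` preserves this
-- relation, and a map that satisfies it is determined by its value at 1. When transposition
-- reverses products, the transported relation is solved by the inverse Frobenius. The exponents s
-- and s + n turn into - s and - s - n, which still differ by n modulo 2 n, so the final count of
-- exponents is the same in both cases. That count treats the three coefficients of g one at a time.
-- Each of them, up to a nonzero factor and possibly a Frobenius power, is the whole coefficient at
-- two residues that differ by n, because all six residues are distinct. At one of the two nothing
-- in ℋ can match it, so it is zero.

-- Binomial coefficients modulo a prime

prime∤! : ∀ {p} → Prime p → ∀ k → k < p → ¬ p ∣ k !
prime∤! pr zero    k<p p∣1  = ℕₚ.<⇒≱ (prime⇒1< pr) (∣⇒≤ p∣1)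
  where
  prime⇒1< : ∀ {p} → Prime p → 1 < p
  prime⇒1< {p} pr = nonTrivial⇒n>1 p {{prime⇒nonTrivial pr}}
prime∤! pr (suc k) k<p p∣k! with euclidsLemma (suc k) (k !) pr p∣k!
... | inj₁ p∣1+k = ℕₚ.<⇒≱ k<p (∣⇒≤ p∣1+k)
... | inj₂ p∣k!′ = prime∤! pr k (ℕₚ.<-trans (ℕₚ.n<1+n k) k<p) p∣k!′

-- Multiplied by k! (p - k)! the coefficient becomes p!, which `p` divides; by Euclid's lemma `p`
-- divides one of the factors, and it cannot divide either factorial.
prime∣C : ∀ {p} → Prime p → ∀ k → 0 < k → k < p → p ∣ p C k
prime∣C {p} pr k 0<k k<p = fromInj₁ (⊥-elim ∘ p∤d) (euclidsLemma (p C k) _ pr p∣C*d)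
  where
  k≤p = ℕₚ.<⇒≤ k<p
  instance _ = k !* (p ∸ k) !≢0
  p∤d : ¬ p ∣ k ! * (p ∸ k) !
  p∤d p∣d = [ prime∤! pr k k<p , prime∤! pr (p ∸ k) (ℕₚ.∸-monoʳ-< 0<k k≤p) ]′
              (euclidsLemma (k !) ((p ∸ k) !) pr p∣d)
  p∣p! : ∀ {p} → 0 < p → p ∣ p !
  p∣p! {suc p} _ = ∣m⇒∣m*n (p !) ∣-refl
  p∣C*d : p ∣ (p C k) * (k ! * (p ∸ k) !)
  p∣C*d = subst (p ∣_)
    (sym (trans (cong (_* (k ! * (p ∸ k) !)) (nCk≡n!/k![n-k]! k≤p)) (m/n*n≡m (k![n∸k]!∣n! k≤p))))
    (p∣p! (ℕₚ.<-trans 0<k k<p))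

-- Field identities and the bound on the number of roots

module FieldProperties (F : Field) where
  open Field F renaming (_+_ to _⊞_; _*_ to _·_; _^_ to _↑_; -_ to ⊟_)
  open CommutativeRing commutativeRing public
    using (+-assoc; +-comm; +-identityˡ; +-identityʳ; -‿inverseˡ; -‿inverseʳ;
           *-assoc; *-comm; *-identityˡ; *-identityʳ; distribˡ; distribʳ; zeroˡ; zeroʳ;
           ring; semiring; commutativeSemiring; *-commutativeMonoid)
  open CommutativeSemiringExp commutativeSemiring public
    using (^-distrib-*; ^-homo-*; ^-assocʳ)
  open SemiringMult semiring public using (×1-homo-*; ×-assoc-*) renaming (_×_ to infixr 8 _×′_)
  open RingProperties ring public
    using (-‿distribˡ-*; -‿distribʳ-*; -0#≈0#; +-cancelˡ; +-cancelʳ)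
  module Σ = SemiringSum semiring
  module Π = CommutativeMonoidSum *-commutativeMonoid

  open import Algebra.Solver.Ring.NaturalCoefficients.Default commutativeSemiring using (solve; _:=_; _:+_; _:*_)

  x·yz≡y·xz : ∀ x y z → x · (y · z) ≡ y · (x · z)
  x·yz≡y·xz = solve 3 (λ x y z → x :* (y :* z) := y :* (x :* z)) refl

  interchange : ∀ w x y z → (w ⊞ x) ⊞ (y ⊞ z) ≡ (w ⊞ y) ⊞ (x ⊞ z)
  interchange = solve 4 (λ w x y z → (w :+ x) :+ (y :+ z) := (w :+ y) :+ (x :+ z)) refl

  x[y+z]w≡y·xw+z·xw : ∀ x y z w → x · (y ⊞ z) · w ≡ y · (x · w) ⊞ z · (x · w)
  x[y+z]w≡y·xw+z·xw = solve 4 (λ x y z w → x :* (y :+ z) :* w := y :* (x :* w) :+ z :* (x :* w)) refl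

  *-cancelˡ-≢0 : ∀ {x y z} → x ≢ 0# → x · y ≡ x · z → y ≡ z
  *-cancelˡ-≢0 {x} {y} {z} x≢0 eq = let x⁻¹ , inv = inverse x x≢0 in begin
    y               ≡⟨ scale x⁻¹ inv y ⟨
    x⁻¹ · (x · y)   ≡⟨ cong (x⁻¹ ·_) eq ⟩
    x⁻¹ · (x · z)   ≡⟨ scale x⁻¹ inv z ⟩
    z               ∎
    where
    open ≡-Reasoning
    scale : ∀ x⁻¹ → x · x⁻¹ ≡ 1# → ∀ w → x⁻¹ · (x · w) ≡ w
    scale x⁻¹ inv w = trans (sym (*-assoc x⁻¹ x w))
      (trans (cong (_· w) (trans (*-comm x⁻¹ x) inv)) (*-identityˡ w))

  x·y≡0⇒y≡0 : ∀ {x y} → x ≢ 0# → x · y ≡ 0# → y ≡ 0#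
  x·y≡0⇒y≡0 {x} x≢0 eq = *-cancelˡ-≢0 x≢0 (trans eq (sym (zeroʳ x)))

  x·y≡0⇒x≡0 : ∀ {x y} → y ≢ 0# → x · y ≡ 0# → x ≡ 0#
  x·y≡0⇒x≡0 {x} {y} y≢0 eq = x·y≡0⇒y≡0 y≢0 (trans (*-comm y x) eq)

  ·-≢0 : ∀ {x y} → x ≢ 0# → y ≢ 0# → x · y ≢ 0#
  ·-≢0 x≢0 y≢0 eq = y≢0 (x·y≡0⇒y≡0 x≢0 eq)

  -- Equality in a bare `Field` need not be decidable, hence the double negation. `↑-≡0⇒≡0` removes
  -- it for finite fields.
  ↑-≡0 : ∀ {x} k → x ↑ k ≡ 0# → ¬ x ≢ 0#
  ↑-≡0 zero    eq x≢0 = 0≢1 (sym eq)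
  ↑-≡0 (suc k) eq x≢0 = ↑-≡0 k (x·y≡0⇒y≡0 x≢0 eq) x≢0

  ↑-≢0 : ∀ {x} k → x ≢ 0# → x ↑ k ≢ 0#
  ↑-≢0 k x≢0 eq = ↑-≡0 k eq x≢0

  0↑ : ∀ {k} → 0 < k → 0# ↑ k ≡ 0#
  0↑ {suc k} _ = zeroˡ _

  1↑ : ∀ k → 1# ↑ k ≡ 1#
  1↑ zero    = refl
  1↑ (suc k) = trans (*-identityˡ _) (1↑ k)

  ×-↑ : ∀ p k → (p ×′ 1#) ↑ k ≡ (p ^ k) ×′ 1#
  ×-↑ p zero    = sym (+-identityʳ 1#)
  ×-↑ p (suc k) = trans (cong (_ ·_) (×-↑ p k)) (sym (×1-homo-* p (p ^ k)))

  x-y≡0⇒x≡y : ∀ {x y} → x ⊞ ⊟ y ≡ 0# → x ≡ y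
  x-y≡0⇒x≡y {x} {y} eq = +-cancelʳ (⊟ y) x y (trans eq (sym (-‿inverseʳ y)))

  a-b+b≡a : ∀ a b → a ⊞ ⊟ b ⊞ b ≡ a
  a-b+b≡a a b = trans (+-assoc a (⊟ b) b) (trans (cong (a ⊞_) (-‿inverseˡ b)) (+-identityʳ a))

  evalPoly : List Carrier → Carrier → Carrier
  evalPoly []       x = 0#
  evalPoly (a ∷ as) x = a ⊞ x · evalPoly as x

  -- Synthetic division by x − r.
  quotient : List Carrier → Carrier → List Carrier
  quotient []               r = []
  quotient (a ∷ [])         r = []
  quotient (a ∷ as@(_ ∷ _)) r = evalPoly as r ∷ quotient as r

  length-quotient : ∀ a as r → length (quotient (a ∷ as) r) ≡ length as
  length-quotient a []       r = refl
  length-quotient a (b ∷ as) r = cong suc (length-quotient b as r)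

  evalPoly-quotient : ∀ as r x →
    evalPoly as x ≡ (x ⊞ ⊟ r) · evalPoly (quotient as r) x ⊞ evalPoly as r
  evalPoly-quotient []               r x = sym (trans (+-identityʳ _) (zeroʳ _))
  evalPoly-quotient (a ∷ [])         r x =
    trans (cong (a ⊞_) (trans (zeroʳ x) (sym (zeroʳ r))))
          (sym (trans (cong (_⊞ (a ⊞ r · 0#)) (zeroʳ (x ⊞ ⊟ r))) (+-identityˡ (a ⊞ r · 0#))))
  evalPoly-quotient (a ∷ as@(_ ∷ _)) r x =
    trans (cong (λ z → a ⊞ x · z) (evalPoly-quotient as r x))
      -- The solver handles semiring identities only: `x` is written as `d ⊞ r`, after which no
      -- subtraction is left.
      (subst (λ z → a ⊞ z · (d · u ⊞ v) ≡ d · (v ⊞ z · u) ⊞ (a ⊞ r · v))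
        (a-b+b≡a x r)
        (division a d r u v))
    where
    d = x ⊞ ⊟ r
    u = evalPoly (quotient as r) x
    v = evalPoly as r
    division : ∀ a d r u v →
      a ⊞ (d ⊞ r) · (d · u ⊞ v) ≡ d · (v ⊞ (d ⊞ r) · u) ⊞ (a ⊞ r · v)
    division = solve 5 (λ a d r u v →
      a :+ (d :+ r) :* (d :* u :+ v) := d :* (v :+ (d :+ r) :* u) :+ (a :+ r :* v)) refl

  quotient≡0 : ∀ as r → evalPoly as r ≡ 0# → All (_≡ 0#) (quotient as r) → All (_≡ 0#) as
  quotient≡0 []               r eq []         = []
  quotient≡0 (a ∷ [])         r eq []         =
    trans (sym (trans (cong (a ⊞_) (zeroʳ r)) (+-identityʳ a))) eq ∷ []
  quotient≡0 (a ∷ as@(_ ∷ _)) r eq (eq′ ∷ zs) =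
    trans (sym (trans (cong (a ⊞_) (trans (cong (r ·_) eq′) (zeroʳ r))) (+-identityʳ a))) eq
    ∷ quotient≡0 as r eq′ zs

  -- There are as many roots as coefficients, that is, one more than the degree allows. Dividing by
  -- x - r₀ shortens the list by one, and the other roots remain roots of the quotient because they
  -- differ from r₀.
  rootBound : ∀ {n} as → length as ≡ n → (r : Fin n → Carrier) → Injective _≡_ _≡_ r →
    (∀ i → evalPoly as (r i) ≡ 0#) → All (_≡ 0#) as
  rootBound         []       len r inj root = []
  rootBound {suc n} (a ∷ as) len r inj root = quotient≡0 (a ∷ as) r₀ (root zero)
    (rootBound {n} q (trans (length-quotient a as r₀) (ℕₚ.suc-injective len)) (r ∘ suc)
      (suc-injective ∘ inj) λ i → x·y≡0⇒y≡0 (λ eq → 0≢1+n (sym (inj (x-y≡0⇒x≡y eq)))) (root′ i))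
    where
    open ≡-Reasoning
    r₀ = r zero
    q = quotient (a ∷ as) r₀
    root′ : ∀ i → (r (suc i) ⊞ ⊟ r₀) · evalPoly q (r (suc i)) ≡ 0#
    root′ i = begin
      (r (suc i) ⊞ ⊟ r₀) · evalPoly q (r (suc i))                         ≡⟨ +-identityʳ _ ⟨
      (r (suc i) ⊞ ⊟ r₀) · evalPoly q (r (suc i)) ⊞ 0#                    ≡⟨ cong ((r (suc i) ⊞ ⊟ r₀) · evalPoly q (r (suc i)) ⊞_) (root zero) ⟨
      (r (suc i) ⊞ ⊟ r₀) · evalPoly q (r (suc i)) ⊞ evalPoly (a ∷ as) r₀  ≡⟨ evalPoly-quotient (a ∷ as) r₀ _ ⟨
      evalPoly (a ∷ as) (r (suc i))                                       ≡⟨ root (suc i) ⟩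
      0#                                                                  ∎

module SumLemmas {M : CommutativeMonoid 0ℓ 0ℓ} where
  open CommutativeMonoid M using (Carrier; _≈_; _∙_; ε; setoid; ∙-congˡ; identityʳ)
  open CommutativeMonoidSum M

  sum-single : ∀ {n} (i : Fin n) (t : Vector Carrier n) → (∀ j → j ≢ i → t j ≈ ε) → sum t ≈ t i
  sum-single {suc n} i t t≈ε = begin
    sum t                     ≈⟨ sum-remove t ⟩
    t i ∙ sum (removeAt t i)  ≈⟨ ∙-congˡ (sum-cong-≋ (λ j → t≈ε (punchIn i j) (punchInᵢ≢i i j))) ⟩
    t i ∙ sum {n} (λ _ → ε)   ≈⟨ ∙-congˡ (sum-replicate-zero n) ⟩
    t i ∙ ε                   ≈⟨ identityʳ (t i) ⟩
    t i                       ∎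
    where open import Relation.Binary.Reasoning.Setoid setoid

-- Finite fields: Fermat's identity, characteristic, Frobenius

module FiniteField (F : Field) {N : ℕ} (order : HasOrder F N) where
  open Field F renaming (_+_ to _⊞_; _*_ to _·_; _^_ to _↑_; -_ to ⊟_)
  open FieldProperties F
  open Inverse order using (to; from; strictlyInverseˡ; strictlyInverseʳ)

  to-injective : ∀ {x y} → to x ≡ to y → x ≡ y
  to-injective {x} {y} eq = trans (sym (strictlyInverseʳ x)) (trans (cong from eq) (strictlyInverseʳ y))

  from-injective : ∀ {i j} → from i ≡ from j → i ≡ j
  from-injective {i} {j} eq = trans (sym (strictlyInverseˡ i)) (trans (cong to eq) (strictlyInverseˡ j))

  infix 4 _≟_
  _≟_ : (x y : Carrier) → Dec (x ≡ y)
  x ≟ y = map′ to-injective (cong to) (to x Finₚ.≟ to y)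

  ↑-≡0⇒≡0 : ∀ {x} k → x ↑ k ≡ 0# → x ≡ 0#
  ↑-≡0⇒≡0 k eq = decidable-stable (_ ≟ 0#) (↑-≡0 k eq)

  counterexample : {f g : Carrier → Carrier} → ¬ f ≗ g → ∃[ x ] f x ≢ g x
  counterexample {f} {g} f≗̸g with ¬∀⟶∃¬ N (λ i → f (from i) ≡ g (from i)) (λ i → f (from i) ≟ g (from i))
    (λ eq → f≗̸g λ x → subst (λ z → f z ≡ g z) (strictlyInverseʳ x) (eq (to x)))
  ... | i , fᵢ≢gᵢ = from i , fᵢ≢gᵢ

  -- A missed value `y` would extend `f` to an injection from N + 1 elements into N.
  injective⇒surjective : ∀ {f : Carrier → Carrier} → Injective _≡_ _≡_ f → ∀ y → ∃[ x ] f x ≡ y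
  injective⇒surjective {f} inj y with Finₚ.any? (λ i → f (from i) ≟ y)
  ... | yes (i , eq) = from i , eq
  ... | no ∄x = ⊥-elim (Finₚ.<⇒notInjective (ℕₚ.n<1+n N) g-injective)
    where
    g : Fin (suc N) → Fin N
    g zero    = to y
    g (suc i) = to (f (from i))
    g-injective : Injective _≡_ _≡_ g
    g-injective {zero}  {zero}  eq = refl
    g-injective {zero}  {suc j} eq = ⊥-elim (∄x (j , sym (to-injective eq)))
    g-injective {suc i} {zero}  eq = ⊥-elim (∄x (i , to-injective eq))
    g-injective {suc i} {suc j} eq = cong suc (from-injective (inj (to-injective eq)))

  module _ (g g⁻¹ : Carrier → Carrier) (inverseˡ : ∀ x → g (g⁻¹ x) ≡ x) (inverseʳ : ∀ x → g⁻¹ (g x) ≡ x) where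

    permutation : Fin N ↔ Fin N
    permutation = mk↔ₛ′ (to ∘ g ∘ from) (to ∘ g⁻¹ ∘ from)
      (λ i → trans (cong (to ∘ g) (strictlyInverseʳ _)) (trans (cong to (inverseˡ _)) (strictlyInverseˡ i)))
      (λ i → trans (cong (to ∘ g⁻¹) (strictlyInverseʳ _)) (trans (cong to (inverseʳ _)) (strictlyInverseˡ i)))

    sum-bijection : ∀ f → sum (f ∘ from) ≡ sum (f ∘ g ∘ from)
    sum-bijection f = trans (Σ.sum-permute (f ∘ from) permutation)
      (Σ.sum-cong-≋ (λ i → cong f (strictlyInverseʳ (g (from i)))))

    product-bijection : ∀ f → product (f ∘ from) ≡ product (f ∘ g ∘ from)
    product-bijection f = trans (Π.sum-permute (f ∘ from) permutation)
      (Π.sum-cong-≋ (λ i → cong f (strictlyInverseʳ (g (from i)))))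

  -- Translation by 1 permutes the field, so the sum `S` of all elements equals `S` plus N copies of
  -- 1.
  order×1≡0 : N ×′ 1# ≡ 0#
  order×1≡0 = +-cancelʳ S (N ×′ 1#) 0# (begin
    N ×′ 1# ⊞ S                     ≡⟨ cong (_⊞ S) (Σ.sum-replicate N) ⟨
    sum {N} (λ _ → 1#) ⊞ S          ≡⟨ Σ.∑-distrib-+ (λ _ → 1#) from ⟨
    sum {N} (λ i → 1# ⊞ from i)     ≡⟨ sum-bijection (1# ⊞_) (⊟ 1# ⊞_)
                                         (cancel 1# (⊟ 1#) (-‿inverseʳ 1#)) (cancel (⊟ 1#) 1# (-‿inverseˡ 1#)) id ⟨
    S                               ≡⟨ +-identityˡ S ⟨
    0# ⊞ S                          ∎)
    where
    open ≡-Reasoning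
    S = sum {N} from
    cancel : ∀ a b → a ⊞ b ≡ 0# → ∀ x → a ⊞ (b ⊞ x) ≡ x
    cancel a b eq x = trans (sym (+-assoc a b x)) (trans (cong (_⊞ x) eq) (+-identityˡ x))

  -- For `x ≢ 0#`, multiplication by `x` permutes the nonzero elements, which gives x ^ (N - 1) = 1.
  -- Products here run over all N elements, so the element 0 has to be given a factor of its own.
  fermat : ∀ x → x ↑ N ≡ x
  fermat x with x ≟ 0#
  ... | yes x≡0 = trans (cong (_↑ N) x≡0) (trans (0↑ 0<N) (sym x≡0))
    where
    0<N : 0 < N
    0<N = ℕₚ.≤-<-trans z≤n (Finₚ.toℕ<n (to 0#))
  ... | no x≢0 = begin
    x ↑ N                                                ≡⟨ Π.sum-replicate N ⟨
    product {N} (λ _ → x)                                ≡⟨ Π.sum-cong-≋ (λ i → u·u′ (from i)) ⟨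
    product {N} (λ i → u (from i) · u′ (from i))         ≡⟨ Π.∑-distrib-+ (u ∘ from) (u′ ∘ from) ⟩
    product {N} (u ∘ from) · product {N} (u′ ∘ from)     ≡⟨ cong₂ _·_ ∏u≡1 ∏u′≡x ⟩
    1# · x                                               ≡⟨ *-identityˡ x ⟩
    x                                                    ∎
    where
    open ≡-Reasoning
    x⁻¹ = proj₁ (inverse x x≢0)
    inv = proj₂ (inverse x x≢0)
    ifZero : Carrier → (a b : Carrier) → Carrier
    ifZero y a b with y ≟ 0#
    ... | yes _ = a
    ... | no  _ = b
    -- `w` puts 1 in place of 0, so `W` is the product of the nonzero elements. `u` and `u′` split N
    -- factors `x` into those at nonzero elements, whose product is 1, and the single one at 0.
    w u u′ : Carrier → Carrier
    w y = ifZero y 1# y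
    u y = ifZero y 1# x
    u′ y = ifZero y x 1#
    ifZero-no : ∀ {y} → y ≢ 0# → ∀ a b → ifZero y a b ≡ b
    ifZero-no {y} y≢0 a b with y ≟ 0#
    ... | yes y≡0 = contradiction y≡0 y≢0
    ... | no  _   = refl
    ifZero-yes : ∀ {y} → y ≡ 0# → ∀ a b → ifZero y a b ≡ a
    ifZero-yes {y} y≡0 a b with y ≟ 0#
    ... | yes _   = refl
    ... | no  y≢0 = contradiction y≡0 y≢0
    u·u′ : ∀ y → u y · u′ y ≡ x
    u·u′ y with y ≟ 0#
    ... | yes _ = *-identityˡ x
    ... | no  _ = *-identityʳ x
    w-x· : ∀ y → w (x · y) ≡ u y · w y
    w-x· y with y ≟ 0#
    ... | yes y≡0 = trans (ifZero-yes (trans (cong (x ·_) y≡0) (zeroʳ x)) 1# (x · y)) (sym (*-identityˡ 1#))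
    ... | no  y≢0 = ifZero-no (·-≢0 x≢0 y≢0) 1# (x · y)
    w≢0 : ∀ y → w y ≢ 0#
    w≢0 y with y ≟ 0#
    ... | yes _   = λ eq → 0≢1 (sym eq)
    ... | no  y≢0 = y≢0
    product≢0 : ∀ {k} (f : Fin k → Carrier) → (∀ i → f i ≢ 0#) → product f ≢ 0#
    product≢0 {zero}  f f≢0 = λ eq → 0≢1 (sym eq)
    product≢0 {suc k} f f≢0 = ·-≢0 (f≢0 zero) (product≢0 (f ∘ suc) (f≢0 ∘ suc))
    W = product {N} (w ∘ from)
    cancel : ∀ a b → a · b ≡ 1# → ∀ y → a · (b · y) ≡ y
    cancel a b eq y = trans (sym (*-assoc a b y)) (trans (cong (_· y) eq) (*-identityˡ y))
    ∏u≡1 : product {N} (u ∘ from) ≡ 1#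
    ∏u≡1 = *-cancelˡ-≢0 (product≢0 (w ∘ from) (w≢0 ∘ from)) (begin
      W · product {N} (u ∘ from)                     ≡⟨ *-comm _ _ ⟩
      product {N} (u ∘ from) · W                     ≡⟨ Π.∑-distrib-+ (u ∘ from) (w ∘ from) ⟨
      product {N} (λ i → u (from i) · w (from i))    ≡⟨ Π.sum-cong-≋ (λ i → w-x· (from i)) ⟨
      product {N} (λ i → w (x · from i))             ≡⟨ product-bijection (x ·_) (x⁻¹ ·_)
                                                          (cancel x x⁻¹ inv) (cancel x⁻¹ x (trans (*-comm x⁻¹ x) inv)) w ⟨
      W                                              ≡⟨ *-identityʳ W ⟨
      W · 1#                                         ∎)
    ∏u′≡x : product {N} (u′ ∘ from) ≡ x
    ∏u′≡x = trans
      (SumLemmas.sum-single {*-commutativeMonoid} (to 0#) (u′ ∘ from)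
        (λ j j≢ → ifZero-no (λ eq → j≢ (trans (sym (strictlyInverseˡ j)) (cong to eq))) x 1#))
      (ifZero-yes (strictlyInverseʳ 0#) x 1#)

module FreshmansDream (F : Field) where
  open Field F renaming (_+_ to _⊞_; _*_ to _·_; _^_ to _↑_; -_ to ⊟_)
  open FieldProperties F

  freshmansDream : ∀ {p} → Prime p → (∀ {k} → p ∣ k → ∀ x → k ×′ x ≡ 0#) →
    ∀ x y → (x ⊞ y) ↑ p ≡ x ↑ p ⊞ y ↑ p
  freshmansDream {zero}   pr vanish x y = ⊥-elim (¬prime[0] pr)
  freshmansDream {suc p′} pr vanish x y = begin
    (x ⊞ y) ↑ suc p′                     ≡⟨ B.theorem (suc p′) x y ⟩
    sum term                             ≡⟨ cong (term zero ⊞_) (Σ.sum-init-last (term ∘ suc)) ⟩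
    term zero ⊞ (sum {p′} (λ i → term (suc (inject₁ i))) ⊞ term (suc (fromℕ p′)))
                                         ≡⟨ cong₂ _⊞_ first (cong₂ _⊞_ middle last) ⟩
    y ↑ suc p′ ⊞ (0# ⊞ x ↑ suc p′)       ≡⟨ cong (y ↑ suc p′ ⊞_) (+-identityˡ _) ⟩
    y ↑ suc p′ ⊞ x ↑ suc p′              ≡⟨ +-comm _ _ ⟩
    x ↑ suc p′ ⊞ y ↑ suc p′              ∎
    where
    open ≡-Reasoning
    module B = Binomial commutativeSemiring
    term : Fin (suc (suc p′)) → Carrier
    term k = (suc p′ C toℕ k) ×′ (x ↑ toℕ k · y ↑ (suc p′ ∸ toℕ k))
    first : term zero ≡ y ↑ suc p′
    first = trans (+-identityʳ _) (*-identityˡ _)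
    middle : sum {p′} (λ i → term (suc (inject₁ i))) ≡ 0#
    middle = trans (Σ.sum-cong-≋ (λ i → vanish (prime∣C pr (suc (toℕ (inject₁ i))) (s≤s z≤n)
        (s≤s (subst (_< p′) (sym (Finₚ.toℕ-inject₁ i)) (Finₚ.toℕ<n i)))) _))
      (Σ.sum-replicate-zero p′)
    last : term (suc (fromℕ p′)) ≡ x ↑ suc p′
    last = begin
      term (suc (fromℕ p′))            ≡⟨ cong (λ k → (suc p′ C suc k) ×′ (x ↑ suc k · y ↑ (p′ ∸ k))) (Finₚ.toℕ-fromℕ p′) ⟩
      (suc p′ C suc p′) ×′ (x ↑ suc p′ · y ↑ (p′ ∸ p′))
                                       ≡⟨ cong₂ (λ a b → a ×′ (x ↑ suc p′ · y ↑ b)) (nCn≡1 (suc p′)) (ℕₚ.n∸n≡0 p′) ⟩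
      x ↑ suc p′ · 1# ⊞ 0#             ≡⟨ +-identityʳ _ ⟩
      x ↑ suc p′ · 1#                  ≡⟨ *-identityʳ _ ⟩
      x ↑ suc p′                       ∎

module Characteristic (F : Field) {N : ℕ} (order : HasOrder F N)
                      {p e : ℕ} (p-prime : Prime p) (N≡pᵉ : N ≡ p ^ e) where
  open Field F renaming (_+_ to _⊞_; _*_ to _·_; _^_ to _↑_; -_ to ⊟_)
  open FieldProperties F
  open FiniteField F order
  open FreshmansDream F

  -- In terms of p · 1, the identity N · 1 = 0 reads (p · 1) ^ e = 0, and a field has no nonzero
  -- nilpotents.
  p×1≡0 : p ×′ 1# ≡ 0#
  p×1≡0 = ↑-≡0⇒≡0 e (trans (×-↑ p e) (trans (cong (_×′ 1#) (sym N≡pᵉ)) order×1≡0))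

  p∣⇒×≡0 : ∀ {k} → p ∣ k → ∀ x → k ×′ x ≡ 0#
  p∣⇒×≡0 (divides c refl) x = begin
    (c * p) ×′ x               ≡⟨ cong ((c * p) ×′_) (*-identityˡ x) ⟨
    (c * p) ×′ (1# · x)        ≡⟨ ×-assoc-* (c * p) 1# x ⟨
    (c * p) ×′ 1# · x          ≡⟨ cong (_· x) (×1-homo-* c p) ⟩
    c ×′ 1# · (p ×′ 1#) · x    ≡⟨ cong (λ z → c ×′ 1# · z · x) p×1≡0 ⟩
    c ×′ 1# · 0# · x           ≡⟨ cong (_· x) (zeroʳ (c ×′ 1#)) ⟩
    0# · x                     ≡⟨ zeroˡ x ⟩
    0#                         ∎
    where open ≡-Reasoning

  freshman : ∀ x y → (x ⊞ y) ↑ p ≡ x ↑ p ⊞ y ↑ p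
  freshman = freshmansDream p-prime p∣⇒×≡0

  ↑pᵏ-+ : ∀ k x y → (x ⊞ y) ↑ (p ^ k) ≡ x ↑ (p ^ k) ⊞ y ↑ (p ^ k)
  ↑pᵏ-+ zero    x y = trans (*-identityʳ _) (sym (cong₂ _⊞_ (*-identityʳ x) (*-identityʳ y)))
  ↑pᵏ-+ (suc k) x y = begin
    (x ⊞ y) ↑ (p * p ^ k)                  ≡⟨ ^-assocʳ (x ⊞ y) p (p ^ k) ⟨
    ((x ⊞ y) ↑ p) ↑ (p ^ k)                ≡⟨ cong (_↑ (p ^ k)) (freshman x y) ⟩
    (x ↑ p ⊞ y ↑ p) ↑ (p ^ k)              ≡⟨ ↑pᵏ-+ k _ _ ⟩
    (x ↑ p) ↑ (p ^ k) ⊞ (y ↑ p) ↑ (p ^ k)  ≡⟨ cong₂ _⊞_ (^-assocʳ x p (p ^ k)) (^-assocʳ y p (p ^ k)) ⟩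
    x ↑ (p * p ^ k) ⊞ y ↑ (p * p ^ k)      ∎
    where open ≡-Reasoning

module PowerMap (F : Field) {N : ℕ} (order : HasOrder F N) where
  open Field F renaming (_+_ to _⊞_; _*_ to _·_; _^_ to _↑_; -_ to ⊟_)
  open FieldProperties F
  open FiniteField F order
  open Inverse order using (from)

  evalPoly-monomial : ∀ k x → evalPoly (replicate k 0# ++ 1# ∷ []) x ≡ x ↑ k
  evalPoly-monomial zero    x = trans (cong (1# ⊞_) (zeroʳ x)) (+-identityʳ 1#)
  evalPoly-monomial (suc k) x = trans (+-identityˡ _) (cong (x ·_) (evalPoly-monomial k x))

  -- Otherwise all N elements would be roots of X ^ Q - X, which has only Q + 1 ≤ N coefficients.
  ↑-moves : ∀ {Q} → 1 < Q → Q < N → ∃[ x ] x ↑ Q ≢ x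
  ↑-moves {suc (suc Q)} (s≤s (s≤s _)) Q<N = counterexample λ fixed →
    0≢1 (sym (last (rootBound poly refl r r-injective (λ i → root (fixed (r i))))))
    where
    -- The polynomial X ^ (Q + 2) - X, constant term first; after the pattern match `Q` is two less
    -- than the exponent.
    poly = 0# ∷ ⊟ 1# ∷ replicate Q 0# ++ 1# ∷ []
    length≡ : length poly ≡ suc (suc (suc Q))
    length≡ = cong (2 +_) (trans (length-++ (replicate Q 0#))
      (trans (cong (_+ 1) (length-replicate Q)) (ℕₚ.+-comm Q 1)))
    length≤N = subst (_≤ N) (sym length≡) Q<N
    r : Fin (length poly) → Carrier
    r i = from (inject≤ i length≤N)
    r-injective : Injective _≡_ _≡_ r
    r-injective = inject≤-injective length≤N length≤N _ _ ∘ from-injective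
    last : All (_≡ 0#) poly → 1# ≡ 0#
    last (_ ∷ _ ∷ zs) with ++⁻ʳ (replicate Q 0#) zs
    ... | 1≡0 ∷ [] = 1≡0
    root : ∀ {x} → x ↑ (2 + Q) ≡ x → evalPoly poly x ≡ 0#
    root {x} fixed = begin
      0# ⊞ x · (⊟ 1# ⊞ x · evalPoly (replicate Q 0# ++ 1# ∷ []) x)  ≡⟨ +-identityˡ _ ⟩
      x · (⊟ 1# ⊞ x · evalPoly (replicate Q 0# ++ 1# ∷ []) x)       ≡⟨ cong (λ z → x · (⊟ 1# ⊞ x · z)) (evalPoly-monomial Q x) ⟩
      x · (⊟ 1# ⊞ x · x ↑ Q)                                        ≡⟨ distribˡ x (⊟ 1#) _ ⟩
      x · ⊟ 1# ⊞ x ↑ (2 + Q)                                        ≡⟨ cong₂ _⊞_ (sym (-‿distribʳ-* x 1#)) fixed ⟩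
      ⊟ (x · 1#) ⊞ x                                                ≡⟨ cong (λ z → ⊟ z ⊞ x) (*-identityʳ x) ⟩
      ⊟ x ⊞ x                                                       ≡⟨ -‿inverseˡ x ⟩
      0#                                                            ∎
      where open ≡-Reasoning

-- Congruences modulo m

module Congruence (m : ℕ) {{m≢0 : NonZero m}} where
  infix 4 _≋_
  _≋_ : ℕ → ℕ → Set
  a ≋ b = a % m ≡ b % m

  ≋-+ : ∀ x {a b} → a ≋ b → x + a ≋ x + b
  ≋-+ x {a} {b} eq = trans (%-distribˡ-+ x a m) (trans (cong (λ z → (x % m + z) % m) eq) (sym (%-distribˡ-+ x b m)))

  ≋-* : ∀ x {a b} → a ≋ b → x * a ≋ x * b
  ≋-* x {a} {b} eq = trans (%-distribˡ-* x a m) (trans (cong (λ z → (x % m * z) % m) eq) (sym (%-distribˡ-* x b m)))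

  -- Adding `x * (m ∸ 1)`, which is - x modulo `m`, undoes the addition of `x` without leaving the
  -- natural numbers.
  +-cancelˡ-≋ : ∀ x {a b} → x + a ≋ x + b → a ≋ b
  +-cancelˡ-≋ x {a} {b} eq = trans (sym (shift a)) (trans (≋-+ (x * (m ∸ 1)) eq) (shift b))
    where
    shift : ∀ c → x * (m ∸ 1) + (x + c) ≋ c
    shift c = begin
      (x * (m ∸ 1) + (x + c)) % m    ≡⟨ cong (_% m) (ℕₚ.+-assoc (x * (m ∸ 1)) x c) ⟨
      (x * (m ∸ 1) + x + c) % m      ≡⟨ cong (λ z → (z + c) % m) (ℕₚ.+-comm (x * (m ∸ 1)) x) ⟩
      (x + x * (m ∸ 1) + c) % m      ≡⟨ cong (λ z → (z + c) % m) (ℕₚ.*-suc x (m ∸ 1)) ⟨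
      (x * (1 + (m ∸ 1)) + c) % m    ≡⟨ cong (λ z → (x * z + c) % m) (ℕₚ.m+[n∸m]≡n (>-nonZero⁻¹ m)) ⟩
      (x * m + c) % m                ≡⟨ cong (_% m) (ℕₚ.+-comm (x * m) c) ⟩
      (c + x * m) % m                ≡⟨ [m+kn]%n≡m%n c x m ⟩
      c % m                          ∎
      where open ≡-Reasoning

  ≋⇒≡ : ∀ {a b} → a < m → b < m → a ≋ b → a ≡ b
  ≋⇒≡ a<m b<m eq = trans (sym (m<n⇒m%n≡m a<m)) (trans eq (m<n⇒m%n≡m b<m))

  module _ {t : ℕ} (coprime : gcd t m ≡ 1) where

    -- With `k ≤ l` the truncated difference is a true one: `m` divides (l - k) t and is coprime to
    -- `t`.
    *t-cancel-≤ : ∀ {k l} → k ≤ l → k * t ≋ l * t → k ≋ l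
    *t-cancel-≤ {k} {l} k≤l eq = trans (cong (_% m) (sym (ℕₚ.+-identityʳ k)))
      (trans (≋-+ k (trans (sym m∣d) refl)) (cong (_% m) (ℕₚ.m+[n∸m]≡n k≤l)))
      where
      d = l ∸ k
      0≋dt : 0 ≋ d * t
      0≋dt = +-cancelˡ-≋ (k * t) (trans (cong (_% m) (ℕₚ.+-identityʳ (k * t)))
        (trans eq (cong (_% m) (trans (cong (_* t) (sym (ℕₚ.m+[n∸m]≡n k≤l))) (ℕₚ.*-distribʳ-+ t k d)))))
      m∣d : d ≋ 0
      m∣d = trans (n∣m⇒m%n≡0 d m (coprime-divisor {m} {t} {d} (Coprimality.sym (gcd≡1⇒coprime {t} {m} coprime))
        (subst (m ∣_) (ℕₚ.*-comm d t) (m%n≡0⇒n∣m (d * t) m (trans (sym 0≋dt) (m*n%n≡0 0 m)))))) (sym (m*n%n≡0 0 m))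

    *t-cancel : ∀ {k l} → k * t ≋ l * t → k ≋ l
    *t-cancel {k} {l} eq with ℕₚ.≤-total k l
    ... | inj₁ k≤l = *t-cancel-≤ k≤l eq
    ... | inj₂ l≤k = sym (*t-cancel-≤ l≤k (sym eq))

    *t-≢ : ∀ {k l} → k < m → l < m → k ≢ l → ¬ k * t ≋ l * t
    *t-≢ k<m l<m k≢l eq = k≢l (≋⇒≡ k<m l<m (*t-cancel eq))

-- Linearized polynomials and independence of characters

module LinearizedPolynomials
  (F : Field) {q m : ℕ} {{m≢0 : NonZero m}} (order : HasOrder F (q ^ m)) (prime-power : IsPrimePower q) where
  open Field F renaming (_+_ to _⊞_; _*_ to _·_; _^_ to _↑_; -_ to ⊟_)
  open FieldProperties F
  open FiniteField F order
  open PowerMap F order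

  private
    p k : ℕ
    p = proj₁ prime-power
    k = proj₁ (proj₂ prime-power)
    p-prime : Prime p
    p-prime = proj₁ (proj₂ (proj₂ prime-power))
    1≤k : 1 ≤ k
    1≤k = proj₁ (proj₂ (proj₂ (proj₂ prime-power)))
    q≡pᵏ : q ≡ p ^ k
    q≡pᵏ = proj₂ (proj₂ (proj₂ (proj₂ prime-power)))

    q^≡p^ : ∀ i → q ^ i ≡ p ^ (k * i)
    q^≡p^ i = trans (cong (_^ i) q≡pᵏ) (ℕₚ.^-*-assoc p k i)

    open Characteristic F order {p} {k * m} p-prime (q^≡p^ m) using (↑pᵏ-+)

  1<q : 1 < q
  1<q = subst (1 <_) (sym q≡pᵏ) (ℕₚ.<-≤-trans (nonTrivial⇒n>1 p {{prime⇒nonTrivial p-prime}})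
    (subst (_≤ p ^ k) (ℕₚ.*-identityʳ p) (ℕₚ.^-monoʳ-≤ p {{prime⇒nonZero p-prime}} 1≤k)))

  instance
    q≢0 : NonZero q
    q≢0 = ≢-nonZero (ℕₚ.m<n⇒n≢0 1<q)

  infixl 9 _^[_]
  _^[_] : Carrier → ℕ → Carrier
  x ^[ i ] = x ↑ (q ^ i)

  ^[]-+ : ∀ i x y → (x ⊞ y) ^[ i ] ≡ x ^[ i ] ⊞ y ^[ i ]
  ^[]-+ i x y = subst (λ Q → (x ⊞ y) ↑ Q ≡ x ↑ Q ⊞ y ↑ Q) (sym (q^≡p^ i)) (↑pᵏ-+ (k * i) x y)

  ^[]-· : ∀ i x y → (x · y) ^[ i ] ≡ x ^[ i ] · y ^[ i ]
  ^[]-· i x y = ^-distrib-* x y (q ^ i)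

  0^[] : ∀ i → 0# ^[ i ] ≡ 0#
  0^[] i = 0↑ (ℕₚ.m^n>0 q i)

  1^[] : ∀ i → 1# ^[ i ] ≡ 1#
  1^[] i = 1↑ (q ^ i)

  ^[]-≢0 : ∀ i {x} → x ≢ 0# → x ^[ i ] ≢ 0#
  ^[]-≢0 i = ↑-≢0 (q ^ i)

  ^[]-≡0⇒≡0 : ∀ i {x} → x ^[ i ] ≡ 0# → x ≡ 0#
  ^[]-≡0⇒≡0 i = ↑-≡0⇒≡0 (q ^ i)

  ^[0] : ∀ x → x ^[ 0 ] ≡ x
  ^[0] = *-identityʳ

  ^[]-^[] : ∀ i j x → x ^[ i ] ^[ j ] ≡ x ^[ i + j ]
  ^[]-^[] i j x = trans (^-assocʳ x (q ^ i) (q ^ j)) (cong (x ↑_) (sym (ℕₚ.^-distribˡ-+-* q i j)))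

  ^[*m] : ∀ c x → x ^[ c * m ] ≡ x
  ^[*m] zero    x = ^[0] x
  ^[*m] (suc c) x = trans (sym (^[]-^[] m (c * m) x)) (trans (cong (_^[ c * m ]) (fermat x)) (^[*m] c x))

  open Congruence m public using (_≋_)

  ^[]-% : ∀ i x → x ^[ i ] ≡ x ^[ i % m ]
  ^[]-% i x = begin
    x ^[ i ]                       ≡⟨ cong (x ^[_]) (m≡m%n+[m/n]*n i m) ⟩
    x ^[ i % m + i / m * m ]       ≡⟨ ^[]-^[] (i % m) (i / m * m) x ⟨
    x ^[ i % m ] ^[ i / m * m ]    ≡⟨ ^[*m] (i / m) _ ⟩
    x ^[ i % m ]                   ∎
    where open ≡-Reasoning

  -- A natural number congruent to - i modulo `m`; as the Frobenius has order dividing `m`, it is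
  -- the exponent of the inverse map.
  opposite : ℕ → ℕ
  opposite i = i * (m ∸ 1)

  i+opposite : ∀ i → i + opposite i ≡ i * m
  i+opposite i = trans (sym (ℕₚ.*-suc i (m ∸ 1))) (cong (i *_) (trans (sym (ℕₚ.+-∸-assoc 1 (>-nonZero⁻¹ m))) refl))

  ^[]-opposite : ∀ i x → x ^[ i ] ^[ opposite i ] ≡ x
  ^[]-opposite i x = trans (^[]-^[] i (opposite i) x) (trans (cong (x ^[_]) (i+opposite i)) (^[*m] i x))

  opposite-^[] : ∀ i x → x ^[ opposite i ] ^[ i ] ≡ x
  opposite-^[] i x = trans (^[]-^[] (opposite i) i x)
    (trans (cong (x ^[_]) (trans (ℕₚ.+-comm (opposite i) i) (i+opposite i))) (^[*m] i x))

  ^[]-injective : ∀ i {x y} → x ^[ i ] ≡ y ^[ i ] → x ≡ y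
  ^[]-injective i {x} {y} eq = trans (sym (^[]-opposite i x)) (trans (cong (_^[ opposite i ]) eq) (^[]-opposite i y))

  -- Cancelling the injective map `_^[ i ]` from an equality would leave x = x ^ (q ^ d) with d = j
  -- - i. Some `x` violates this because 1 < q ^ d < q ^ m.
  ^[]-distinct-< : ∀ {i j} → i < j → j < m → ∃[ x ] x ^[ i ] ≢ x ^[ j ]
  ^[]-distinct-< {i} {j} i<j j<m = let x , moved = ↑-moves {q ^ d} 1<qᵈ qᵈ<qᵐ in
    x , λ eq → moved (sym (^[]-injective i (trans eq (trans (cong (x ^[_]) (sym (ℕₚ.m∸n+n≡m (ℕₚ.<⇒≤ i<j))))
      (sym (^[]-^[] d i x))))))
    where
    d = j ∸ i
    1<qᵈ : 1 < q ^ d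
    1<qᵈ = ℕₚ.^-monoʳ-< q 1<q (ℕₚ.m<n⇒0<n∸m i<j)
    qᵈ<qᵐ : q ^ d < q ^ m
    qᵈ<qᵐ = ℕₚ.^-monoʳ-< q 1<q (ℕₚ.≤-<-trans (ℕₚ.m∸n≤m j i) j<m)

  ^[]-distinct : ∀ (i j : Fin m) → i ≢ j → ∃[ x ] x ^[ toℕ i ] ≢ x ^[ toℕ j ]
  ^[]-distinct i j i≢j with ℕₚ.<-cmp (toℕ i) (toℕ j)
  ... | tri< i<j _ _ = ^[]-distinct-< i<j (Finₚ.toℕ<n j)
  ... | tri≈ _ i≡j _ = contradiction (toℕ-injective i≡j) i≢j
  ... | tri> _ _ j<i = let x , x≢ = ^[]-distinct-< j<i (Finₚ.toℕ<n i) in x , x≢ ∘ sym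

  -- Choose `y` on which the character `u (suc i)` differs from `u zero`. Replacing x by y x and
  -- subtracting y ^[ u₀ ] times the original relation removes the first term and multiplies each
  -- other coefficient by a difference, which is nonzero at `i`. The induction hypothesis applies to
  -- the shorter relation; afterwards the value at 1 gives the first coefficient.
  dedekind : ∀ {d} (u : Fin d → ℕ) → (∀ i j → i ≢ j → ∃[ y ] y ^[ u i ] ≢ y ^[ u j ]) →
    (c : Fin d → Carrier) → (∀ x → sum (λ i → c i · x ^[ u i ]) ≡ 0#) → ∀ i → c i ≡ 0#
  dedekind {zero}  u distinct c vanish ()
  dedekind {suc d} u distinct c vanish = λ where
      zero    → c₀≡0
      (suc i) → cₛ≡0 i
    where
    open ≡-Reasoning
    u₀ = u zero
    cₛ≡0 : ∀ i → c (suc i) ≡ 0#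
    cₛ≡0 i = x·y≡0⇒x≡0 (λ eq → y≢ (x-y≡0⇒x≡y eq))
      (dedekind (u ∘ suc) (λ i j i≢j → distinct (suc i) (suc j) (i≢j ∘ suc-injective))
        (λ j → c (suc j) · (y ^[ u (suc j) ] ⊞ ⊟ y ^[ u₀ ])) vanish′ i)
      where
      y = proj₁ (distinct (suc i) zero λ ())
      y≢ = proj₂ (distinct (suc i) zero λ ())
      y₀ = y ^[ u₀ ]
      module _ (x : Carrier) where
        t : Fin (suc d) → Carrier
        t j = c j · x ^[ u j ]
        twisted : Fin d → Carrier
        twisted j = y ^[ u (suc j) ] · t (suc j)
        termwise : ∀ j → y ^[ u j ] · t j ≡ c j · (y · x) ^[ u j ]
        termwise j = trans (x·yz≡y·xz (y ^[ u j ]) (c j) (x ^[ u j ])) (cong (c j ·_) (sym (^[]-· (u j) y x)))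
        twisted≡ : sum twisted ≡ y₀ · sum (t ∘ suc)
        twisted≡ = +-cancelˡ (y₀ · t zero) _ _ (begin
          y₀ · t zero ⊞ sum twisted                    ≡⟨ Σ.sum-cong-≋ termwise ⟩
          sum (λ j → c j · (y · x) ^[ u j ])           ≡⟨ vanish (y · x) ⟩
          0#                                           ≡⟨ zeroʳ y₀ ⟨
          y₀ · 0#                                      ≡⟨ cong (y₀ ·_) (vanish x) ⟨
          y₀ · (t zero ⊞ sum (t ∘ suc))                ≡⟨ distribˡ y₀ (t zero) (sum (t ∘ suc)) ⟩
          y₀ · t zero ⊞ y₀ · sum (t ∘ suc)             ∎)
        vanish′ : sum (λ j → c (suc j) · (y ^[ u (suc j) ] ⊞ ⊟ y₀) · x ^[ u (suc j) ]) ≡ 0#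
        vanish′ = begin
          sum (λ j → c (suc j) · (y ^[ u (suc j) ] ⊞ ⊟ y₀) · x ^[ u (suc j) ])
            ≡⟨ Σ.sum-cong-≋ (λ j → x[y+z]w≡y·xw+z·xw (c (suc j)) (y ^[ u (suc j) ]) (⊟ y₀) (x ^[ u (suc j) ])) ⟩
          sum (λ j → twisted j ⊞ ⊟ y₀ · t (suc j))
            ≡⟨ Σ.∑-distrib-+ twisted (λ j → ⊟ y₀ · t (suc j)) ⟩
          sum twisted ⊞ sum (λ j → ⊟ y₀ · t (suc j))
            ≡⟨ cong₂ _⊞_ twisted≡ (sym (Σ.*-distribˡ-sum (⊟ y₀) (t ∘ suc))) ⟩
          y₀ · sum (t ∘ suc) ⊞ ⊟ y₀ · sum (t ∘ suc)
            ≡⟨ distribʳ (sum (t ∘ suc)) y₀ (⊟ y₀) ⟨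
          (y₀ ⊞ ⊟ y₀) · sum (t ∘ suc)
            ≡⟨ cong (_· sum (t ∘ suc)) (-‿inverseʳ y₀) ⟩
          0# · sum (t ∘ suc)
            ≡⟨ zeroˡ _ ⟩
          0# ∎
    c₀≡0 : c zero ≡ 0#
    c₀≡0 = begin
      c zero                                                       ≡⟨ *-identityʳ (c zero) ⟨
      c zero · 1#                                                  ≡⟨ cong (c zero ·_) (1^[] u₀) ⟨
      c zero · 1# ^[ u₀ ]                                          ≡⟨ +-identityʳ _ ⟨
      c zero · 1# ^[ u₀ ] ⊞ 0#                                     ≡⟨ cong (c zero · 1# ^[ u₀ ] ⊞_) (Σ.sum-replicate-zero d) ⟨
      c zero · 1# ^[ u₀ ] ⊞ sum {d} (λ _ → 0#)                     ≡⟨ cong (c zero · 1# ^[ u₀ ] ⊞_) (Σ.sum-cong-≋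
                                                                        (λ j → trans (cong (_· 1# ^[ u (suc j) ]) (cₛ≡0 j)) (zeroˡ _))) ⟨
      sum (λ j → c j · 1# ^[ u j ])                                ≡⟨ vanish 1# ⟩
      0#                                                           ∎

  Term = Carrier × ℕ

  ⟦_⟧ : List Term → Carrier → Carrier
  ⟦ [] ⟧           x = 0#
  ⟦ (c , i) ∷ ts ⟧ x = c · x ^[ i ] ⊞ ⟦ ts ⟧ x

  -- The total coefficient at the residue `r`. Exponents such as `u + k * t` are symbolic, so which
  -- terms count is supplied as evidence instead of being computed.
  data Coeff (r : ℕ) : List Term → Carrier → Set where
    []   : Coeff r [] 0#
    hit  : ∀ {c i ts d} → i ≋ r → Coeff r ts d → Coeff r ((c , i) ∷ ts) (c ⊞ d)
    miss : ∀ {c i ts d} → ¬ i ≋ r → Coeff r ts d → Coeff r ((c , i) ∷ ts) d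

  private
    residue : ℕ → Fin m
    residue i = fromℕ< (m%n<n i m)

    toℕ-residue : ∀ i → toℕ (residue i) ≡ i % m
    toℕ-residue i = Finₚ.toℕ-fromℕ< (m%n<n i m)

    monomial : Term → Fin m → Carrier
    monomial (c , i) r with residue i Finₚ.≟ r
    ... | yes _ = c
    ... | no  _ = 0#

    coefficients : List Term → Fin m → Carrier
    coefficients []       r = 0#
    coefficients (t ∷ ts) r = monomial t r ⊞ coefficients ts r

    monomial-hit : ∀ c {i r} → residue i ≡ r → monomial (c , i) r ≡ c
    monomial-hit c {i} {r} eq with residue i Finₚ.≟ r
    ... | yes _  = refl
    ... | no  ≢r = contradiction eq ≢r

    monomial-miss : ∀ c {i r} → residue i ≢ r → monomial (c , i) r ≡ 0#
    monomial-miss c {i} {r} ≢r with residue i Finₚ.≟ r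
    ... | yes eq = contradiction eq ≢r
    ... | no  _  = refl

    residue-cong : ∀ {i j} → i ≋ j → residue i ≡ residue j
    residue-cong {i} {j} eq = toℕ-injective (trans (toℕ-residue i) (trans eq (sym (toℕ-residue j))))

    residue-injective : ∀ {i j} → residue i ≡ residue j → i ≋ j
    residue-injective {i} {j} eq = trans (sym (toℕ-residue i)) (trans (cong toℕ eq) (toℕ-residue j))

    ⟦⟧-coefficients : ∀ ts x → ⟦ ts ⟧ x ≡ sum (λ r → coefficients ts r · x ^[ toℕ r ])
    ⟦⟧-coefficients []             x = sym (trans (Σ.sum-cong-≋ {m} (λ r → zeroˡ (x ^[ toℕ r ]))) (Σ.sum-replicate-zero m))
    ⟦⟧-coefficients ((c , i) ∷ ts) x = sym (begin
      sum (λ r → (monomial (c , i) r ⊞ coefficients ts r) · x ^[ toℕ r ])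
        ≡⟨ Σ.sum-cong-≋ {m} (λ r → distribʳ (x ^[ toℕ r ]) (monomial (c , i) r) (coefficients ts r)) ⟩
      sum (λ r → monomial (c , i) r · x ^[ toℕ r ] ⊞ coefficients ts r · x ^[ toℕ r ])
        ≡⟨ Σ.∑-distrib-+ (λ r → monomial (c , i) r · x ^[ toℕ r ]) (λ r → coefficients ts r · x ^[ toℕ r ]) ⟩
      sum (λ r → monomial (c , i) r · x ^[ toℕ r ]) ⊞ sum (λ r → coefficients ts r · x ^[ toℕ r ])
        ≡⟨ cong₂ _⊞_ single (sym (⟦⟧-coefficients ts x)) ⟩
      c · x ^[ i ] ⊞ ⟦ ts ⟧ x ∎)
      where
      open ≡-Reasoning
      single : sum (λ r → monomial (c , i) r · x ^[ toℕ r ]) ≡ c · x ^[ i ]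
      single = begin
        sum (λ r → monomial (c , i) r · x ^[ toℕ r ])
          ≡⟨ SumLemmas.sum-single {CommutativeRing.+-commutativeMonoid commutativeRing} (residue i) _
               (λ r r≢ → trans (cong (_· x ^[ toℕ r ]) (monomial-miss c (r≢ ∘ sym))) (zeroˡ _)) ⟩
        monomial (c , i) (residue i) · x ^[ toℕ (residue i) ]
          ≡⟨ cong₂ (λ a j → a · x ^[ j ]) (monomial-hit c {i} refl) (toℕ-residue i) ⟩
        c · x ^[ i % m ]
          ≡⟨ cong (c ·_) (^[]-% i x) ⟨
        c · x ^[ i ] ∎

    Coeff⇒coefficients : ∀ {r ts c} → Coeff r ts c → coefficients ts (residue r) ≡ c
    Coeff⇒coefficients [] = refl
    Coeff⇒coefficients {r} (hit {c} {i} eq h) =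
      cong₂ _⊞_ (monomial-hit c {i} (residue-cong {i} {r} eq)) (Coeff⇒coefficients h)
    Coeff⇒coefficients {r} (miss {c} {i} ≢r h) = trans
      (cong₂ _⊞_ (monomial-miss c {i} (≢r ∘ residue-injective {i} {r})) (Coeff⇒coefficients h)) (+-identityˡ _)

  -- Exponents matter only modulo `m`. Both sides are collected into one coefficient per residue,
  -- and `dedekind` applies to the differences.
  Coeff-unique : ∀ {r ts us c d} → ⟦ ts ⟧ ≗ ⟦ us ⟧ → Coeff r ts c → Coeff r us d → c ≡ d
  Coeff-unique {r} {ts} {us} ts≗us hc hd = trans (sym (Coeff⇒coefficients hc))
    (trans (x-y≡0⇒x≡y (dedekind toℕ ^[]-distinct (λ r → a r ⊞ ⊟ b r) vanish (residue r))) (Coeff⇒coefficients hd))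
    where
    open ≡-Reasoning
    a = coefficients ts
    b = coefficients us
    vanish : ∀ x → sum (λ r → (a r ⊞ ⊟ b r) · x ^[ toℕ r ]) ≡ 0#
    vanish x = +-cancelʳ (⟦ us ⟧ x) _ _ (begin
      sum (λ r → (a r ⊞ ⊟ b r) · x ^[ toℕ r ]) ⊞ ⟦ us ⟧ x
        ≡⟨ cong (sum (λ r → (a r ⊞ ⊟ b r) · x ^[ toℕ r ]) ⊞_) (⟦⟧-coefficients us x) ⟩
      sum (λ r → (a r ⊞ ⊟ b r) · x ^[ toℕ r ]) ⊞ sum (λ r → b r · x ^[ toℕ r ])
        ≡⟨ Σ.∑-distrib-+ {m} _ _ ⟨
      sum (λ r → (a r ⊞ ⊟ b r) · x ^[ toℕ r ] ⊞ b r · x ^[ toℕ r ])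
        ≡⟨ Σ.sum-cong-≋ (λ r → trans (sym (distribʳ (x ^[ toℕ r ]) (a r ⊞ ⊟ b r) (b r))) (cong (_· x ^[ toℕ r ]) (a-b+b≡a (a r) (b r)))) ⟩
      sum (λ r → a r · x ^[ toℕ r ])
        ≡⟨ ⟦⟧-coefficients ts x ⟨
      ⟦ ts ⟧ x
        ≡⟨ ts≗us x ⟩
      ⟦ us ⟧ x
        ≡⟨ +-identityˡ _ ⟨
      0# ⊞ ⟦ us ⟧ x ∎)

-- Residues that differ by n modulo 2 n

module HalfTurn {n : ℕ} (2<n : 2 < n) {{2n≢0 : NonZero (2 * n)}} {t : ℕ} (coprime : gcd t (2 * n) ≡ 1) where
  open Congruence (2 * n)

  2≤-double : ∀ {k} → k ≤ 2 → 2 * k < 2 * n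
  2≤-double k≤2 = ℕₚ.*-monoʳ-< 2 (ℕₚ.≤-<-trans k≤2 2<n)

  -- Doubling removes n: 2 k t ≡ 2 l t modulo 2 n. The unit `t` cancels, and 2 k, 2 l ≤ 4 < 2 n
  -- force k = l, which leaves n ≡ 0 modulo 2 n.
  ¬kt≋n+lt : ∀ {k l} → k ≤ 2 → l ≤ 2 → ¬ k * t ≋ n + l * t
  ¬kt≋n+lt {k} {l} k≤2 l≤2 eq = ℕₚ.<⇒≢ (ℕₚ.≤-<-trans z≤n 2<n) 0≡n
    where
    open ≡-Reasoning
    m = 2 * n
    doubled : 2 * k * t ≋ 2 * l * t
    doubled = begin
      2 * k * t % m                 ≡⟨ cong (_% m) (ℕₚ.*-assoc 2 k t) ⟩
      2 * (k * t) % m               ≡⟨ ≋-* 2 eq ⟩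
      2 * (n + l * t) % m           ≡⟨ cong (_% m) (ℕₚ.*-distribˡ-+ 2 n (l * t)) ⟩
      (m + 2 * (l * t)) % m         ≡⟨ cong (_% m) (ℕₚ.+-comm m (2 * (l * t))) ⟩
      (2 * (l * t) + m) % m         ≡⟨ [m+n]%n≡m%n (2 * (l * t)) m ⟩
      2 * (l * t) % m               ≡⟨ cong (_% m) (ℕₚ.*-assoc 2 l t) ⟨
      2 * l * t % m                 ∎
    k≡l : k ≡ l
    k≡l = ℕₚ.*-cancelˡ-≡ k l 2 (≋⇒≡ (2≤-double k≤2) (2≤-double l≤2) (*t-cancel {t} coprime {2 * k} {2 * l} doubled))
    0≡n : 0 ≡ n
    0≡n = ≋⇒≡ (ℕₚ.≤-<-trans z≤n (2≤-double k≤2)) (ℕₚ.m<m+n n (ℕₚ.≤-trans (ℕₚ.≤-<-trans z≤n 2<n) (ℕₚ.m≤m+n n 0)))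
      (+-cancelˡ-≋ (k * t) (begin
        (k * t + 0) % m    ≡⟨ cong (_% m) (ℕₚ.+-identityʳ (k * t)) ⟩
        k * t % m          ≡⟨ eq ⟩
        (n + l * t) % m    ≡⟨ cong (λ j → (n + j * t) % m) k≡l ⟨
        (n + k * t) % m    ≡⟨ cong (_% m) (ℕₚ.+-comm n (k * t)) ⟩
        (k * t + n) % m    ∎))

  ¬u+kt≋u+n+lt : ∀ u {k l} → k ≤ 2 → l ≤ 2 → ¬ u + k * t ≋ u + n + l * t
  ¬u+kt≋u+n+lt u {k} {l} k≤2 l≤2 eq = ¬kt≋n+lt k≤2 l≤2
    (+-cancelˡ-≋ u (trans eq (cong (_% (2 * n)) (ℕₚ.+-assoc u n (l * t)))))

  ¬u+kt≋u+lt : ∀ u {k l} → k ≤ 2 → l ≤ 2 → k ≢ l → ¬ u + k * t ≋ u + l * t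
  ¬u+kt≋u+lt u {k} {l} k≤2 l≤2 k≢l eq = *t-≢ {t} coprime {k} {l} (≤2⇒< k≤2) (≤2⇒< l≤2) k≢l (+-cancelˡ-≋ u eq)
    where
    ≤2⇒< : ∀ {k} → k ≤ 2 → k < 2 * n
    ≤2⇒< k≤2 = ℕₚ.<-≤-trans (ℕₚ.≤-<-trans k≤2 2<n) (ℕₚ.m≤m+n n (n + 0))

  -- The residues of u + k t and u + n + k t differ by n, so they cannot both
  -- lie in {0, t, 2 t}.
  misses : ∀ u k → (∀ {l} → l ≤ 2 → ¬ l * t ≋ u + k * t) ⊎ (∀ {l} → l ≤ 2 → ¬ l * t ≋ u + n + k * t)
  misses u k with search 2
    where
    search : ∀ j → (∃[ l ] l ≤ j × l * t ≋ u + k * t) ⊎ (∀ {l} → l ≤ j → ¬ l * t ≋ u + k * t)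
    search zero with 0 * t % (2 * n) ℕₚ.≟ (u + k * t) % (2 * n)
    ... | yes eq = inj₁ (0 , z≤n , eq)
    ... | no ¬eq = inj₂ λ where z≤n → ¬eq
    search (suc j) with search j | suc j * t % (2 * n) ℕₚ.≟ (u + k * t) % (2 * n)
    ... | inj₁ (l , l≤j , eq) | _      = inj₁ (l , ℕₚ.m≤n⇒m≤1+n l≤j , eq)
    ... | inj₂ _              | yes eq = inj₁ (suc j , ℕₚ.≤-refl , eq)
    ... | inj₂ none           | no ¬eq = inj₂ λ l≤1+j eq → [ (λ l<1+j → none (ℕₚ.≤-pred l<1+j) eq)
      , (λ where refl → ¬eq eq) ]′ (ℕₚ.m≤n⇒m<n∨m≡n l≤1+j)
  ... | inj₂ none            = inj₁ none
  ... | inj₁ (j , j≤2 , eq) = inj₂ λ l≤2 eq′ → ¬kt≋n+lt l≤2 j≤2 (trans eq′ (trans (cong (_% (2 * n))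
    (trans (cong (_+ k * t) (ℕₚ.+-comm u n)) (ℕₚ.+-assoc n u (k * t)))) (sym (≋-+ n eq))))

-- Matrices over K as K-linear maps of L

module Coordinates (K L : Field) (ι : Field.Carrier K → Field.Carrier L) (ι-hom : IsFieldHomomorphism K L ι)
  {m : ℕ} (e : Vector (Field.Carrier L) m) (basis : Extension.IsBasisOfExtension K L ι e) where

  private
    module K where
      open Field K public
      open FieldProperties K public
  open Field L renaming (_+_ to _⊞_; _*_ to _·_; _^_ to _↑_; -_ to ⊟_)
  open FieldProperties L
  open Extension K L ι
  open LinearAlgebra K
  open RankMetric K m
  open RingMorphisms.IsRingHomomorphism ι-hom public using () renaming
    (+-homo to ι-+; *-homo to ι-·; 0#-homo to ι-0; 1#-homo to ι-1; -‿homo to ι-neg)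

  comb : ∀ {d} → Vector K.Carrier d → Vector Carrier d → Carrier
  comb = combination extension

  ι-sum : ∀ {d} (c : Vector K.Carrier d) → ι (K.sum c) ≡ sum (ι ∘ c)
  ι-sum {zero}  c = ι-0
  ι-sum {suc d} c = trans (ι-+ _ _) (cong (ι (c zero) ⊞_) (ι-sum (c ∘ suc)))

  ι-↑ : ∀ c k → ι (c K.^ k) ≡ ι c ↑ k
  ι-↑ c zero    = ι-1
  ι-↑ c (suc k) = trans (ι-· _ _) (cong (ι c ·_) (ι-↑ c k))

  comb-cong : ∀ {d} {c c′ : Vector K.Carrier d} {v v′ : Vector Carrier d} → c ≗ c′ → v ≗ v′ → comb c v ≡ comb c′ v′
  comb-cong c≗c′ v≗v′ = Σ.sum-cong-≋ (λ i → cong₂ (λ a b → ι a · b) (c≗c′ i) (v≗v′ i))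

  comb-+ : ∀ {d} (c c′ : Vector K.Carrier d) v → comb (λ i → c i K.+ c′ i) v ≡ comb c v ⊞ comb c′ v
  comb-+ c c′ v = trans (Σ.sum-cong-≋ (λ i → trans (cong (_· v i) (ι-+ (c i) (c′ i))) (distribʳ (v i) (ι (c i)) (ι (c′ i)))))
    (Σ.∑-distrib-+ (λ i → ι (c i) · v i) (λ i → ι (c′ i) · v i))

  comb-+ʳ : ∀ {d} (c : Vector K.Carrier d) v v′ → comb c (λ i → v i ⊞ v′ i) ≡ comb c v ⊞ comb c v′
  comb-+ʳ c v v′ = trans (Σ.sum-cong-≋ (λ i → distribˡ (ι (c i)) (v i) (v′ i)))
    (Σ.∑-distrib-+ (λ i → ι (c i) · v i) (λ i → ι (c i) · v′ i))

  comb-· : ∀ {d} a (c : Vector K.Carrier d) v → comb (λ i → a K.* c i) v ≡ ι a · comb c v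
  comb-· a c v = trans (Σ.sum-cong-≋ (λ i → trans (cong (_· v i) (ι-· a (c i))) (*-assoc (ι a) (ι (c i)) (v i))))
    (sym (Σ.*-distribˡ-sum (ι a) (λ i → ι (c i) · v i)))

  comb-0 : ∀ {d} (v : Vector Carrier d) → comb (λ _ → K.0#) v ≡ 0#
  comb-0 {d} v = trans (Σ.sum-cong-≋ (λ i → trans (cong (_· v i) ι-0) (zeroˡ (v i)))) (Σ.sum-replicate-zero d)

  comb-⊖ : ∀ {d} (c c′ : Vector K.Carrier d) v → comb (λ i → c i K.+ K.- c′ i) v ≡ comb c v ⊞ ⊟ comb c′ v
  comb-⊖ c c′ v = +-cancelʳ (comb c′ v) _ _ (begin
    comb (λ i → c i K.+ K.- c′ i) v ⊞ comb c′ v          ≡⟨ comb-+ (λ i → c i K.+ K.- c′ i) c′ v ⟨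
    comb (λ i → c i K.+ K.- c′ i K.+ c′ i) v             ≡⟨ comb-cong {v = v} (λ i → K.a-b+b≡a (c i) (c′ i)) (λ _ → refl) ⟩
    comb c v                                             ≡⟨ a-b+b≡a (comb c v) (comb c′ v) ⟨
    comb c v ⊞ ⊟ comb c′ v ⊞ comb c′ v                   ∎)
    where open ≡-Reasoning

  comb-injective : ∀ {c c′} → comb c e ≡ comb c′ e → c ≗ c′
  comb-injective {c} {c′} eq i = K.x-y≡0⇒x≡y (proj₁ basis (λ i → c i K.+ K.- c′ i)
    (trans (comb-⊖ c c′ e) (trans (cong (_⊞ ⊟ comb c′ e) eq) (-‿inverseʳ (comb c′ e)))) i)

  coords : Carrier → Vector K.Carrier m
  coords x = proj₁ (proj₁ (proj₂ basis) {x} _)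

  comb-coords : ∀ x → comb (coords x) e ≡ x
  comb-coords x = sym (proj₂ (proj₁ (proj₂ basis) {x} _))

  δ : Fin m → Vector K.Carrier m
  δ j i = identity i j

  δ-refl : ∀ j → δ j j ≡ K.1#
  δ-refl j with j Finₚ.≟ j
  ... | yes _   = refl
  ... | no  j≢j = contradiction refl j≢j

  comb-δ : ∀ j (v : Vector Carrier m) → comb (δ j) v ≡ v j
  comb-δ j v = begin
    comb (δ j) v           ≡⟨ SumLemmas.sum-single {CommutativeRing.+-commutativeMonoid commutativeRing} j (λ i → ι (δ j i) · v i) off ⟩
    ι (δ j j) · v j        ≡⟨ cong (_· v j) (trans (cong ι (δ-refl j)) ι-1) ⟩
    1# · v j               ≡⟨ *-identityˡ (v j) ⟩
    v j                    ∎
    where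
    open ≡-Reasoning
    off : ∀ i → i ≢ j → ι (δ j i) · v i ≡ 0#
    off i i≢j with i Finₚ.≟ j
    ... | yes i≡j = contradiction i≡j i≢j
    ... | no  _   = trans (cong (_· v i) ι-0) (zeroˡ (v i))

  comb-coords-e : ∀ j (v : Vector Carrier m) → comb (coords (e j)) v ≡ v j
  comb-coords-e j v = trans (comb-cong {v = v} (comb-injective (trans (comb-coords (e j)) (sym (comb-δ j e)))) (λ _ → refl))
    (comb-δ j v)

  IsLinear : (Carrier → Carrier) → Set
  IsLinear f = (∀ x y → f (x ⊞ y) ≡ f x ⊞ f y) × (∀ c x → f (ι c · x) ≡ ι c · f x)

  linear-0 : ∀ {f} → IsLinear f → f 0# ≡ 0#
  linear-0 {f} (_ , f-·) = begin
    f 0#                  ≡⟨ cong f (zeroʳ (ι K.0#)) ⟨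
    f (ι K.0# · 0#)       ≡⟨ f-· K.0# 0# ⟩
    ι K.0# · f 0#         ≡⟨ cong (_· f 0#) ι-0 ⟩
    0# · f 0#             ≡⟨ zeroˡ (f 0#) ⟩
    0#                    ∎
    where open ≡-Reasoning

  linear-comb : ∀ {f} → IsLinear f → ∀ {d} (c : Vector K.Carrier d) v → f (comb c v) ≡ comb c (f ∘ v)
  linear-comb f-lin             {zero}  c v = linear-0 f-lin
  linear-comb f-lin@(f-+ , f-·) {suc d} c v = trans (f-+ _ _)
    (cong₂ _⊞_ (f-· (c zero) (v zero)) (linear-comb f-lin (c ∘ suc) (v ∘ suc)))

  linear-id : IsLinear id
  linear-id = (λ _ _ → refl) , (λ _ _ → refl)

  linear-cong : ∀ {f g} → f ≗ g → IsLinear g → IsLinear f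
  linear-cong f≗g (g-+ , g-·) =
    (λ x y → trans (f≗g _) (trans (g-+ x y) (sym (cong₂ _⊞_ (f≗g x) (f≗g y))))) ,
    (λ c x → trans (f≗g _) (trans (g-· c x) (cong (ι c ·_) (sym (f≗g x)))))

  linear-+ : ∀ {f g} → IsLinear f → IsLinear g → IsLinear (λ x → f x ⊞ g x)
  linear-+ {f} {g} (f-+ , f-·) (g-+ , g-·) =
    (λ x y → trans (cong₂ _⊞_ (f-+ x y) (g-+ x y)) (interchange (f x) (f y) (g x) (g y))) ,
    (λ c x → trans (cong₂ _⊞_ (f-· c x) (g-· c x)) (sym (distribˡ (ι c) (f x) (g x))))

  linear-scale : ∀ a {f} → IsLinear f → IsLinear (λ x → a · f x)
  linear-scale a {f} (f-+ , f-·) =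
    (λ x y → trans (cong (a ·_) (f-+ x y)) (distribˡ a (f x) (f y))) ,
    (λ c x → trans (cong (a ·_) (f-· c x)) (x·yz≡y·xz a (ι c) (f x)))

  -- The endomorphism of L whose matrix in the basis `e` is `M`. Most matrix identities below are
  -- checked as identities of maps and brought back by `op-injective`.
  op : Matrix → Carrier → Carrier
  op M x = comb (coords x) (λ j → comb (λ i → M i j) e)

  -- `Represents` constrains `φ` on the basis only; linearity fixes the other values. All maps in
  -- the codes are linear, so a code can be handled as a set of maps.
  represents⇒op : ∀ {M φ} → IsLinear φ → Represents e M φ → φ ≗ op M
  represents⇒op {M} {φ} φ-lin rep x = begin
    φ x                                              ≡⟨ cong φ (comb-coords x) ⟨
    φ (comb (coords x) e)                            ≡⟨ linear-comb φ-lin (coords x) e ⟩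
    comb (coords x) (φ ∘ e)                          ≡⟨ comb-cong {c = coords x} (λ _ → refl) rep ⟩
    op M x                                           ∎
    where open ≡-Reasoning

  op-e : ∀ M j → op M (e j) ≡ comb (λ i → M i j) e
  op-e M j = comb-coords-e j _

  -- `coords` merely selects witnesses of spanning. Its additivity follows from the uniqueness of
  -- coordinates.
  op-+ : ∀ M x y → op M (x ⊞ y) ≡ op M x ⊞ op M y
  op-+ M x y = trans (comb-cong {v = λ j → comb (λ i → M i j) e} (comb-injective (begin
    comb (coords (x ⊞ y)) e                          ≡⟨ comb-coords (x ⊞ y) ⟩
    x ⊞ y                                            ≡⟨ cong₂ _⊞_ (comb-coords x) (comb-coords y) ⟨
    comb (coords x) e ⊞ comb (coords y) e            ≡⟨ comb-+ (coords x) (coords y) e ⟨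
    comb (λ i → coords x i K.+ coords y i) e         ∎)) (λ _ → refl)) (comb-+ (coords x) (coords y) _)
    where open ≡-Reasoning

  op-· : ∀ M c x → op M (ι c · x) ≡ ι c · op M x
  op-· M c x = trans (comb-cong {v = λ j → comb (λ i → M i j) e} (comb-injective (begin
    comb (coords (ι c · x)) e                        ≡⟨ comb-coords (ι c · x) ⟩
    ι c · x                                          ≡⟨ cong (ι c ·_) (comb-coords x) ⟨
    ι c · comb (coords x) e                          ≡⟨ comb-· c (coords x) e ⟨
    comb (λ i → c K.* coords x i) e                  ∎)) (λ _ → refl)) (comb-· c (coords x) _)
    where open ≡-Reasoning

  op-linear : ∀ M → IsLinear (op M)
  op-linear M = op-+ M , op-· M

  op-cong : ∀ {M N} → M ≈ N → op M ≗ op N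
  op-cong M≈N x = comb-cong {c = coords x} (λ _ → refl) (λ j → comb-cong {v = e} (λ i → M≈N i j) (λ _ → refl))

  op-injective : ∀ {M N} → op M ≗ op N → M ≈ N
  op-injective {M} {N} eq i j = comb-injective (trans (sym (op-e M j)) (trans (eq (e j)) (op-e N j))) i

  op-⊕ : ∀ M N x → op (M ⊕ N) x ≡ op M x ⊞ op N x
  op-⊕ M N x = trans (comb-cong {c = coords x} (λ _ → refl) (λ j → comb-+ (λ i → M i j) (λ i → N i j) e))
    (comb-+ʳ (coords x) (λ j → comb (λ i → M i j) e) (λ j → comb (λ i → N i j) e))

  op-⊗ : ∀ A B x → op (A ⊗ B) x ≡ op A (op B x)
  op-⊗ A B x = sym (begin
    op A (op B x)
      ≡⟨ linear-comb (op-linear A) (coords x) _ ⟩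
    comb (coords x) (λ j → op A (comb (λ k → B k j) e))
      ≡⟨ comb-cong {c = coords x} (λ _ → refl) column ⟩
    op (A ⊗ B) x ∎)
    where
    open ≡-Reasoning
    column : ∀ j → op A (comb (λ k → B k j) e) ≡ comb (λ i → (A ⊗ B) i j) e
    column j = begin
      op A (comb (λ k → B k j) e)
        ≡⟨ linear-comb (op-linear A) (λ k → B k j) e ⟩
      comb (λ k → B k j) (λ k → op A (e k))
        ≡⟨ Σ.sum-cong-≋ (λ k → trans (cong (ι (B k j) ·_) (op-e A k)) (Σ.*-distribˡ-sum (ι (B k j)) (λ i → ι (A i k) · e i))) ⟩
      sum (λ k → sum (λ i → ι (B k j) · (ι (A i k) · e i)))
        ≡⟨ Σ.∑-comm (λ k i → ι (B k j) · (ι (A i k) · e i)) ⟩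
      sum (λ i → sum (λ k → ι (B k j) · (ι (A i k) · e i)))
        ≡⟨ Σ.sum-cong-≋ (λ i → Σ.sum-cong-≋ (λ k → entry i k)) ⟩
      sum (λ i → sum (λ k → ι (A i k K.* B k j) · e i))
        ≡⟨ Σ.sum-cong-≋ (λ i → Σ.*-distribʳ-sum (e i) (λ k → ι (A i k K.* B k j))) ⟨
      sum (λ i → sum (λ k → ι (A i k K.* B k j)) · e i)
        ≡⟨ Σ.sum-cong-≋ (λ i → cong (_· e i) (ι-sum (λ k → A i k K.* B k j))) ⟨
      comb (λ i → (A ⊗ B) i j) e ∎
      where
      entry : ∀ i k → ι (B k j) · (ι (A i k) · e i) ≡ ι (A i k K.* B k j) · e i
      entry i k = trans (x·yz≡y·xz (ι (B k j)) (ι (A i k)) (e i))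
        (trans (sym (*-assoc (ι (A i k)) (ι (B k j)) (e i))) (cong (_· e i) (sym (ι-· (A i k) (B k j)))))

  op-identity : ∀ x → op identity x ≡ x
  op-identity x = trans (comb-cong {c = coords x} (λ _ → refl) (λ j → comb-δ j e)) (comb-coords x)

  op-⊖ : ∀ M N x → op (M ⊕ (⊝ N)) x ≡ op M x ⊞ ⊟ op N x
  op-⊖ M N x = +-cancelʳ (op N x) _ _ (begin
    op (M ⊕ (⊝ N)) x ⊞ op N x                ≡⟨ op-⊕ (M ⊕ (⊝ N)) N x ⟨
    op ((M ⊕ (⊝ N)) ⊕ N) x                   ≡⟨ op-cong {(M ⊕ (⊝ N)) ⊕ N} {M} (λ i j → K.a-b+b≡a (M i j) (N i j)) x ⟩
    op M x                                   ≡⟨ a-b+b≡a (op M x) (op N x) ⟨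
    op M x ⊞ ⊟ op N x ⊞ op N x               ∎)
    where open ≡-Reasoning

  op-0 : ∀ x → op (λ _ _ → K.0#) x ≡ 0#
  op-0 x = trans (Σ.sum-cong-≋ (λ j → trans (cong (ι (coords x j) ·_) (comb-0 e)) (zeroʳ _))) (Σ.sum-replicate-zero m)

  op-*ₗ : ∀ c M x → op (λ i j → c K.* M i j) x ≡ ι c · op M x
  op-*ₗ c M x = trans (Σ.sum-cong-≋ (λ j → trans (cong (ι (coords x j) ·_) (comb-· c (λ i → M i j) e))
      (x·yz≡y·xz (ι (coords x j)) (ι c) (comb (λ i → M i j) e))))
    (sym (Σ.*-distribˡ-sum (ι c) (λ j → ι (coords x j) · comb (λ i → M i j) e)))

  op-combination : ∀ {d} (c : Vector K.Carrier d) (V : Vector Matrix d) x →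
    op (combination matrices c V) x ≡ comb c (λ i → op (V i) x)
  op-combination {zero}  c V x = op-0 x
  op-combination {suc d} c V x = trans (op-⊕ (λ i j → c zero K.* V zero i j) (combination matrices (c ∘ suc) (V ∘ suc)) x)
    (cong₂ _⊞_ (op-*ₗ (c zero) (V zero) x) (op-combination (c ∘ suc) (V ∘ suc) x))

  comb-combination : ∀ {d} (c : Vector K.Carrier d) (v : Vector (Vector K.Carrier m) d) →
    comb (combination (columnVectors m) c v) e ≡ comb c (λ i → comb (v i) e)
  comb-combination {zero}  c v = comb-0 e
  comb-combination {suc d} c v = trans (comb-+ (λ i → c zero K.* v zero i) (combination (columnVectors m) (c ∘ suc) (v ∘ suc)) e)
    (cong₂ _⊞_ (comb-· (c zero) (v zero) e) (comb-combination (c ∘ suc) (v ∘ suc)))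

  -- Identifies the column space of `M` with the image of `op M`, which lets ranks be read off from
  -- kernels.
  comb-columns : ∀ M c → comb (combination (columnVectors m) c (transpose M)) e ≡ op M (comb c e)
  comb-columns M c = trans (comb-combination c (transpose M)) (trans (comb-cong {c = c} (λ _ → refl) (λ j → sym (op-e M j)))
    (sym (linear-comb (op-linear M) c e)))

  matrix : (Carrier → Carrier) → Matrix
  matrix φ i j = coords (φ (e j)) i

  matrix-represents : ∀ φ → Represents e (matrix φ) φ
  matrix-represents φ j = sym (comb-coords (φ (e j)))

  op-matrix : ∀ {φ} → IsLinear φ → op (matrix φ) ≗ φ
  op-matrix {φ} φ-lin x = sym (represents⇒op φ-lin (matrix-represents φ) x)

  op-inverse : ∀ {A B} → (A ⊗ B) ≈ identity → ∀ x → op A (op B x) ≡ x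
  op-inverse {A} {B} AB≈1 x = trans (sym (op-⊗ A B x)) (trans (op-cong AB≈1 x) (op-identity x))

  transpose-⊗ : ∀ A B → transpose (A ⊗ B) ≈ (transpose B ⊗ transpose A)
  transpose-⊗ A B i j = K.Σ.sum-cong-≋ (λ k → K.*-comm (A j k) (B k i))

  transpose-identity : transpose identity ≈ identity
  transpose-identity i j with i Finₚ.≟ j | j Finₚ.≟ i
  ... | yes _   | yes _   = refl
  ... | no  _   | no  _   = refl
  ... | yes i≡j | no  j≢i = contradiction (sym i≡j) j≢i
  ... | no  i≢j | yes j≡i = contradiction (sym j≡i) i≢j

  module _ {σ : K.Carrier → K.Carrier} (σ-auto : IsFieldAutomorphism K σ) where
    open RingMorphisms.IsRingIsomorphism σ-auto using () renaming
      (+-homo to σ-+; *-homo to σ-·; 0#-homo to σ-0; 1#-homo to σ-1; injective to σ-inj)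

    mapEntries-⊗ : ∀ A B → mapEntries σ (A ⊗ B) ≈ (mapEntries σ A ⊗ mapEntries σ B)
    mapEntries-⊗ A B i j = trans (σ-sum (λ k → A i k K.* B k j)) (K.Σ.sum-cong-≋ (λ k → σ-· (A i k) (B k j)))
      where
      σ-sum : ∀ {d} (c : Vector K.Carrier d) → σ (K.sum c) ≡ K.sum (σ ∘ c)
      σ-sum {zero}  c = σ-0
      σ-sum {suc d} c = trans (σ-+ _ _) (cong (σ (c zero) K.+_) (σ-sum (c ∘ suc)))

    mapEntries-⊕ : ∀ A B → mapEntries σ (A ⊕ B) ≈ (mapEntries σ A ⊕ mapEntries σ B)
    mapEntries-⊕ A B i j = σ-+ (A i j) (B i j)

    mapEntries-identity : mapEntries σ identity ≈ identity
    mapEntries-identity i j with i Finₚ.≟ j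
    ... | yes _ = σ-1
    ... | no  _ = σ-0

    mapEntries-injective : ∀ {A B} → mapEntries σ A ≈ mapEntries σ B → A ≈ B
    mapEntries-injective eq i j = σ-inj (eq i j)

-- Counting vectors over a finite field

finToFun-injective : ∀ {a b} {i j : Fin (b ^ a)} → finToFun {b} {a} i ≗ finToFun {b} {a} j → i ≡ j
finToFun-injective {a} {b} {i} {j} eq = trans (sym (funToFin-finToFin {a} {b} i))
  (trans (funToFin-cong eq) (funToFin-finToFin {a} {b} j))
  where
  funToFin-cong : ∀ {k l} {g h : Fin k → Fin l} → g ≗ h → funToFin g ≡ funToFin h
  funToFin-cong {zero}  g≗h = refl
  funToFin-cong {suc k} g≗h = cong₂ combine (g≗h zero) (funToFin-cong (g≗h ∘ suc))

module Pigeonhole (K : Field) {q : ℕ} (order : HasOrder K q) (1<q : 1 < q) where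
  open Field K using (Carrier)
  open FiniteField K order using (to-injective; from-injective)
  open Inverse order using (to; from)

  -- This takes the place of rank and nullity: once `f` is linear in effect, the difference of the
  -- two colliding vectors is a nonzero kernel vector.
  collision : ∀ {a b} → b < a → (f : Vector Carrier a → Vector Carrier b) →
    ∃[ x ] ∃[ y ] ¬ x ≗ y × f x ≗ f y
  collision {a} {b} b<a f with pigeonhole (ℕₚ.^-monoʳ-< q 1<q b<a) (λ i → funToFin (to ∘ f (decode i)))
    where
    decode : Fin (q ^ a) → Vector Carrier a
    decode i = from ∘ finToFun i
  ... | i , j , i<j , eq = from ∘ finToFun i , from ∘ finToFun j , distinct , collide
    where
    distinct : ¬ from ∘ finToFun i ≗ from ∘ finToFun j
    distinct same = Finₚ.<⇒≢ i<j (finToFun-injective {a} {q} {i} {j} (from-injective ∘ same))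
    collide : f (from ∘ finToFun i) ≗ f (from ∘ finToFun j)
    collide k = to-injective (trans (sym (finToFun-funToFin _ k))
      (trans (cong (λ z → finToFun {q} {b} z k) eq) (finToFun-funToFin _ k)))

module Cardinality (K L : Field) (ι : Field.Carrier K → Field.Carrier L) (ι-hom : IsFieldHomomorphism K L ι)
  {m : ℕ} (e : Vector (Field.Carrier L) m) (basis : Extension.IsBasisOfExtension K L ι e)
  {q : ℕ} (K-order : HasOrder K q) where

  private
    module K where
      open Field K public
      open FieldProperties K public
      open FiniteField K K-order public
  open Field L using (Carrier; 0#) renaming (_+_ to _⊞_; -_ to ⊟_)
  open FieldProperties L
  open LinearAlgebra K
  open RankMetric K m
  open Coordinates K L ι ι-hom e basis
  open Inverse K-order using (to; from; strictlyInverseʳ)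

  dimension⇒size : ∀ {W d} → HasDimension matrices W d → HasSize W (q ^ d)
  dimension⇒size {W} {d} (V , V-independent , W⊆span , span⊆W) =
    enumerate , (λ i → span⊆W (decode i , λ _ _ → refl)) , (λ {i} {j} → enumerate-injective i j) , surjective
    where
    decode : Fin (q ^ d) → Vector K.Carrier d
    decode i = from ∘ finToFun i
    enumerate : Fin (q ^ d) → Matrix
    enumerate i = combination matrices (decode i) V
    enumerate-injective : ∀ i j → enumerate i ≈ enumerate j → i ≡ j
    enumerate-injective i j eq = finToFun-injective {d} {q} {i} {j}
      (λ l → K.from-injective (K.x-y≡0⇒x≡y (V-independent difference (op-injective {combination matrices difference V} {λ _ _ → K.0#} vanish) l)))
      where
      open ≡-Reasoning
      difference : Vector K.Carrier d
      difference l = decode i l K.+ K.- decode j l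
      vanish : ∀ x → op (combination matrices difference V) x ≡ op (λ _ _ → K.0#) x
      vanish x = begin
        op (combination matrices difference V) x
          ≡⟨ op-combination difference V x ⟩
        comb difference (λ l → op (V l) x)
          ≡⟨ comb-⊖ (decode i) (decode j) (λ l → op (V l) x) ⟩
        comb (decode i) (λ l → op (V l) x) ⊞ ⊟ comb (decode j) (λ l → op (V l) x)
          ≡⟨ cong₂ (λ a b → a ⊞ ⊟ b) (op-combination (decode i) V x) (op-combination (decode j) V x) ⟨
        op (enumerate i) x ⊞ ⊟ op (enumerate j) x
          ≡⟨ cong (λ z → z ⊞ ⊟ op (enumerate j) x) (op-cong {enumerate i} {enumerate j} eq x) ⟩
        op (enumerate j) x ⊞ ⊟ op (enumerate j) x
          ≡⟨ -‿inverseʳ _ ⟩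
        0#
          ≡⟨ op-0 x ⟨
        op (λ _ _ → K.0#) x ∎
    surjective : ∀ {A} → A ∈ W → ∃[ i ] A ≈ enumerate i
    surjective {A} A∈ with W⊆span A∈
    ... | c , A≈ = i , op-injective {A} {enumerate i} (λ x → trans (op-cong {A} {combination matrices c V} A≈ x)
        (trans (op-combination c V x) (trans (comb-cong {v = λ l → op (V l) x} c≗ (λ _ → refl))
          (sym (op-combination (decode i) V x)))))
      where
      i = funToFin (to ∘ c)
      c≗ : c ≗ decode i
      c≗ l = trans (sym (strictlyInverseʳ (c l))) (cong from (sym (finToFun-funToFin (to ∘ c) l)))

-- Codes spanned over L by the identity and one map

module TwoDimensionalCode (K L : Field) (ι : Field.Carrier K → Field.Carrier L) (ι-hom : IsFieldHomomorphism K L ι)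
  {m : ℕ} (e : Vector (Field.Carrier L) m) (basis : Extension.IsBasisOfExtension K L ι e)
  {q : ℕ} (K-order : HasOrder K q)
  (f : Field.Carrier L → Field.Carrier L)
  (f-linear : Coordinates.IsLinear K L ι ι-hom e basis f)
  where

  private
    module K where
      open Field K public
      open FieldProperties K public
  open Field L renaming (_+_ to _⊞_; _*_ to _·_; _^_ to _↑_; -_ to ⊟_)
  open FieldProperties L
  open Extension K L ι
  open LinearAlgebra K
  open RankMetric K m
  open Coordinates K L ι ι-hom e basis
  open Cardinality K L ι ι-hom e basis K-order

  word : Carrier → Carrier → Carrier → Carrier
  word a₀ a₁ x = a₁ · f x ⊞ a₀ · x

  Words : Pred (Carrier → Carrier) 0ℓ
  Words φ = ∃[ a₀ ] ∃[ a₁ ] φ ≗ word a₀ a₁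

  word-linear : ∀ a₀ a₁ → IsLinear (word a₀ a₁)
  word-linear a₀ a₁ = linear-+ (linear-scale a₁ f-linear) (linear-scale a₀ linear-id)

  ∈code⇒ : ∀ {M} → M ∈ toCode e Words → Words (op M)
  ∈code⇒ {M} (φ , (a₀ , a₁ , φ≗) , rep) =
    a₀ , a₁ , λ x → trans (sym (represents⇒op {M} (linear-cong φ≗ (word-linear a₀ a₁)) rep x)) (φ≗ x)

  ⇒∈code : ∀ {M a₀ a₁} → op M ≗ word a₀ a₁ → M ∈ toCode e Words
  ⇒∈code {M} {a₀} {a₁} eq = op M , (a₀ , a₁ , eq) , op-e M

  private
    left right : ∀ {A : Set} → Vector A (m + m) → Vector A m
    left c i = c (i ↑ˡ m)
    right c i = c (m ↑ʳ i)

    split : ∀ {l n} (t : Vector Carrier (l + n)) → sum t ≡ sum {l} (λ i → t (i ↑ˡ n)) ⊞ sum {n} (λ i → t (l ↑ʳ i))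
    split {zero}  t = sym (+-identityˡ _)
    split {suc l} t = trans (cong (t zero ⊞_) (split {l} (t ∘ suc))) (sym (+-assoc _ _ _))

    generator : Fin m ⊎ Fin m → Carrier → Carrier
    generator = [ (λ i → word (e i) 0#) , (λ i → word 0# (e i)) ]′

    -- The basis `e` of L over K times the pair (identity, `f`): the first half multiplies the
    -- identity, the second half multiplies `f`.
    generators : Vector Matrix (m + m)
    generators i = matrix (generator (splitAt m i))

    op-generators : ∀ i → op (generators i) ≗ generator (splitAt m i)
    op-generators i with splitAt m i
    ... | inj₁ j = op-matrix (word-linear (e j) 0#)
    ... | inj₂ j = op-matrix (word-linear 0# (e j))

    op-combination-generators : ∀ c → op (combination matrices c generators) ≗
      word (comb (left c) e) (comb (right c) e)
    op-combination-generators c x = begin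
      op (combination matrices c generators) x
        ≡⟨ op-combination c generators x ⟩
      comb c (λ i → op (generators i) x)
        ≡⟨ comb-cong {c = c} (λ _ → refl) (λ i → op-generators i x) ⟩
      comb c (λ i → generator (splitAt m i) x)
        ≡⟨ split {m} (λ i → ι (c i) · generator (splitAt m i) x) ⟩
      comb (left c) (λ i → generator (splitAt m (i ↑ˡ m)) x) ⊞ comb (right c) (λ i → generator (splitAt m (m ↑ʳ i)) x)
        ≡⟨ cong₂ _⊞_
             (Σ.sum-cong-≋ (λ i → trans (cong (λ z → ι (c (i ↑ˡ m)) · generator z x) (Finₚ.splitAt-↑ˡ m i m))
               (trans (cong (ι (c (i ↑ˡ m)) ·_) (trans (cong (_⊞ e i · x) (zeroˡ (f x))) (+-identityˡ (e i · x))))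
                 (sym (*-assoc (ι (c (i ↑ˡ m))) (e i) x)))))
             (Σ.sum-cong-≋ (λ i → trans (cong (λ z → ι (c (m ↑ʳ i)) · generator z x) (Finₚ.splitAt-↑ʳ m m i))
               (trans (cong (ι (c (m ↑ʳ i)) ·_) (trans (cong (e i · f x ⊞_) (zeroˡ x)) (+-identityʳ (e i · f x))))
                 (sym (*-assoc (ι (c (m ↑ʳ i))) (e i) (f x)))))) ⟩
      sum (λ i → ι (left c i) · e i · x) ⊞ sum (λ i → ι (right c i) · e i · f x)
        ≡⟨ cong₂ _⊞_ (Σ.*-distribʳ-sum x (λ i → ι (left c i) · e i)) (Σ.*-distribʳ-sum (f x) (λ i → ι (right c i) · e i)) ⟨
      comb (left c) e · x ⊞ comb (right c) e · f x
        ≡⟨ +-comm _ _ ⟩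
      word (comb (left c) e) (comb (right c) e) x ∎
      where open ≡-Reasoning

  difference∈code : ∀ {A B} → A ∈ toCode e Words → B ∈ toCode e Words → ¬ A ≈ B →
    ∃[ a₀ ] ∃[ a₁ ] op (A ⊕ (⊝ B)) ≗ word a₀ a₁ × ¬ (a₀ ≡ 0# × a₁ ≡ 0#)
  difference∈code {A} {B} A∈ B∈ A≉B with ∈code⇒ A∈ | ∈code⇒ B∈
  ... | a₀ , a₁ , A≗ | b₀ , b₁ , B≗ = a₀ ⊞ ⊟ b₀ , a₁ ⊞ ⊟ b₁ , difference ,
    λ (eq₀ , eq₁) → A≉B (op-injective {A} {B} λ x → trans (A≗ x)
      (trans (cong₂ (λ a b → word a b x) (x-y≡0⇒x≡y eq₀) (x-y≡0⇒x≡y eq₁)) (sym (B≗ x))))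
    where
    open ≡-Reasoning
    difference : op (A ⊕ (⊝ B)) ≗ word (a₀ ⊞ ⊟ b₀) (a₁ ⊞ ⊟ b₁)
    difference x = +-cancelʳ (op B x) _ _ (begin
      op (A ⊕ (⊝ B)) x ⊞ op B x                              ≡⟨ cong (_⊞ op B x) (op-⊖ A B x) ⟩
      op A x ⊞ ⊟ op B x ⊞ op B x                             ≡⟨ a-b+b≡a (op A x) (op B x) ⟩
      op A x                                                 ≡⟨ A≗ x ⟩
      word a₀ a₁ x                                           ≡⟨ cong₂ (λ a b → word a b x) (a-b+b≡a a₀ b₀) (a-b+b≡a a₁ b₁) ⟨
      word (a₀ ⊞ ⊟ b₀ ⊞ b₀) (a₁ ⊞ ⊟ b₁ ⊞ b₁) x               ≡⟨ cong₂ _⊞_ (distribʳ (f x) (a₁ ⊞ ⊟ b₁) b₁) (distribʳ x (a₀ ⊞ ⊟ b₀) b₀) ⟩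
      ((a₁ ⊞ ⊟ b₁) · f x ⊞ b₁ · f x) ⊞ ((a₀ ⊞ ⊟ b₀) · x ⊞ b₀ · x)
                                                             ≡⟨ interchange _ _ _ _ ⟩
      word (a₀ ⊞ ⊟ b₀) (a₁ ⊞ ⊟ b₁) x ⊞ word b₀ b₁ x          ≡⟨ cong (word (a₀ ⊞ ⊟ b₀) (a₁ ⊞ ⊟ b₁) x ⊞_) (B≗ x) ⟨
      word (a₀ ⊞ ⊟ b₀) (a₁ ⊞ ⊟ b₁) x ⊞ op B x                ∎)

  module _ (word-injective : ∀ {a₀ a₁} → word a₀ a₁ ≗ (λ _ → 0#) → a₀ ≡ 0# × a₁ ≡ 0#) where

    code-basis : IsBasisOf matrices (toCode e Words) generators
    code-basis = independent-generators , ⊆span , span⊆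
      where
      independent-generators : LinearlyIndependent matrices generators
      independent-generators c vanish i with word-injective (λ x → trans (sym (op-combination-generators c x))
        (trans (op-cong {combination matrices c generators} {λ _ _ → K.0#} vanish x) (op-0 x)))
      ... | A≡0 , B≡0 with splitAt m i in eq
      ...   | inj₁ j = trans (cong c (sym (Finₚ.splitAt⁻¹-↑ˡ eq))) (comb-injective {left c} {λ _ → K.0#} (trans A≡0 (sym (comb-0 e))) j)
      ...   | inj₂ j = trans (cong c (sym (Finₚ.splitAt⁻¹-↑ʳ eq))) (comb-injective {right c} {λ _ → K.0#} (trans B≡0 (sym (comb-0 e))) j)
      ⊆span : ∀ {M} → M ∈ toCode e Words → M ∈ Span matrices generators
      ⊆span {M} M∈ with ∈code⇒ M∈
      ... | a₀ , a₁ , eq = c , op-injective {M} {combination matrices c generators} (λ x → trans (eq x)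
          (trans (cong₂ (λ a b → word a b x) (a≡ a₀ leftᶜ) (a≡ a₁ rightᶜ)) (sym (op-combination-generators c x))))
        where
        c : Vector K.Carrier (m + m)
        c i = [ coords a₀ , coords a₁ ]′ (splitAt m i)
        leftᶜ : coords a₀ ≗ left c
        leftᶜ i = sym (cong [ coords a₀ , coords a₁ ]′ (Finₚ.splitAt-↑ˡ m i m))
        rightᶜ : coords a₁ ≗ right c
        rightᶜ i = sym (cong [ coords a₀ , coords a₁ ]′ (Finₚ.splitAt-↑ʳ m m i))
        a≡ : ∀ a {c} → coords a ≗ c → a ≡ comb c e
        a≡ a eq = trans (sym (comb-coords a)) (comb-cong {v = e} eq (λ _ → refl))
      span⊆ : ∀ {M} → M ∈ Span matrices generators → M ∈ toCode e Words
      span⊆ {M} (c , M≈) = ⇒∈code (λ x → trans (op-cong {M} {combination matrices c generators} M≈ x) (op-combination-generators c x))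

    code-dimension : HasDimension matrices (toCode e Words) (m + m)
    code-dimension = generators , code-basis

    code-size : HasSize (toCode e Words) (q ^ (m + m))
    code-size = dimension⇒size code-dimension

    -- `c` stands for the expression `m ∸ d + 1` of `IsMRD`, which equals 2 for d = m - 1 but is
    -- kept abstract here so that the equation can be matched.
    code-size-2m : ∀ {c} → c ≡ 2 → HasSize (toCode e Words) (q ^ (m * c))
    code-size-2m refl = subst (λ N → HasSize (toCode e Words) (q ^ N))
      (trans (cong (m +_) (sym (ℕₚ.+-identityʳ m))) (ℕₚ.*-comm 2 m)) code-size

-- Rank read off from the kernel

module RankAttained (K L : Field) (ι : Field.Carrier K → Field.Carrier L) (ι-hom : IsFieldHomomorphism K L ι)
  {m′ : ℕ} (e : Vector (Field.Carrier L) (suc m′)) (basis : Extension.IsBasisOfExtension K L ι e) where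

  private
    module K where
      open Field K public
      open FieldProperties K public
  open Field L renaming (_+_ to _⊞_; _*_ to _·_; -_ to ⊟_)
  open FieldProperties L
  open LinearAlgebra K
  open RankMetric K (suc m′)
  open Coordinates K L ι ι-hom e basis

  -- The kernel is spanned by a vector of the given basis, so no change of basis is needed: the
  -- first column is zero and the remaining ones form a basis of the column space. A dependency
  -- among them is a kernel vector with first coordinate 0, hence a multiple of `e zero` with first
  -- coordinate 0, hence 0.
  rank-attained : ∀ {M} → op M (e zero) ≡ 0# → (∀ y → op M y ≡ 0# → ∃[ c ] y ≡ ι c · e zero) → HasRank M m′
  rank-attained {M} φe₀≡0 kernel = columns , independent-columns , ⊆span , span⊆
    where
    open ≡-Reasoning
    columns : Vector (Vector K.Carrier (suc m′)) m′
    columns j i = M i (suc j)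
    cons : K.Carrier → Vector K.Carrier m′ → Vector K.Carrier (suc m′)
    cons a c zero    = a
    cons a c (suc i) = c i
    comb-columns′ : ∀ a c → comb (combination (columnVectors (suc m′)) c columns) e ≡ op M (comb (cons a c) e)
    comb-columns′ a c = begin
      comb (combination (columnVectors (suc m′)) c columns) e  ≡⟨ comb-combination c columns ⟩
      comb c (λ j → comb (columns j) e)                        ≡⟨ comb-cong {c = c} (λ _ → refl) (λ j → sym (op-e M (suc j))) ⟩
      comb c (λ j → op M (e (suc j)))                          ≡⟨ linear-comb (op-linear M) c (e ∘ suc) ⟨
      op M (comb c (e ∘ suc))                                  ≡⟨ +-identityˡ _ ⟨
      0# ⊞ op M (comb c (e ∘ suc))                             ≡⟨ cong (_⊞ op M (comb c (e ∘ suc))) (trans (op-· M a (e zero)) (trans (cong (ι a ·_) φe₀≡0) (zeroʳ (ι a)))) ⟨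
      op M (ι a · e zero) ⊞ op M (comb c (e ∘ suc))            ≡⟨ op-+ M _ _ ⟨
      op M (comb (cons a c) e)                                 ∎
    independent-columns : LinearlyIndependent (columnVectors (suc m′)) columns
    independent-columns c vanish i = comb-injective {cons K.0# c} {cons a (λ _ → K.0#)} (trans y≡ae₀ (sym (trans (cong (ι a · e zero ⊞_) (comb-0 (e ∘ suc))) (+-identityʳ _)))) (suc i)
      where
      y = comb (cons K.0# c) e
      inKernel : op M y ≡ 0#
      inKernel = trans (sym (comb-columns′ K.0# c)) (trans (comb-cong {v = e} vanish (λ _ → refl)) (comb-0 e))
      a = proj₁ (kernel y inKernel)
      y≡ae₀ : y ≡ ι a · e zero
      y≡ae₀ = proj₂ (kernel y inKernel)
    ⊆span : ∀ {w} → w ∈ ColumnSpace M → w ∈ Span (columnVectors (suc m′)) columns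
    ⊆span {w} (c , w≈) = c ∘ suc , comb-injective (begin
      comb w e                                                 ≡⟨ comb-cong {v = e} w≈ (λ _ → refl) ⟩
      comb (combination (columnVectors (suc m′)) c (transpose M)) e
                                                               ≡⟨ comb-columns M c ⟩
      op M (comb c e)                                          ≡⟨ comb-columns′ (c zero) (c ∘ suc) ⟨
      comb (combination (columnVectors (suc m′)) (c ∘ suc) columns) e ∎)
    span⊆ : ∀ {w} → w ∈ Span (columnVectors (suc m′)) columns → w ∈ ColumnSpace M
    span⊆ {w} (c , w≈) = cons K.0# c , comb-injective (begin
      comb w e                                                 ≡⟨ comb-cong {v = e} w≈ (λ _ → refl) ⟩
      comb (combination (columnVectors (suc m′)) c columns) e  ≡⟨ comb-columns′ K.0# c ⟩
      op M (comb (cons K.0# c) e)                              ≡⟨ comb-columns M (cons K.0# c) ⟨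
      comb (combination (columnVectors (suc m′)) (cons K.0# c) (transpose M)) e ∎)

module RankBound (K L : Field) (ι : Field.Carrier K → Field.Carrier L) (ι-hom : IsFieldHomomorphism K L ι)
  {m : ℕ} (e : Vector (Field.Carrier L) m) (basis : Extension.IsBasisOfExtension K L ι e)
  {q : ℕ} (K-order : HasOrder K q) (1<q : 1 < q) where

  private
    module K where
      open Field K public
      open FieldProperties K public
      open FiniteField K K-order public
  open Field L renaming (_+_ to _⊞_; _*_ to _·_; -_ to ⊟_)
  open FieldProperties L
  open LinearAlgebra K
  open RankMetric K m
  open Coordinates K L ι ι-hom e basis
  open Pigeonhole K K-order 1<q

  rank-bound : ∀ {M r} → (∀ {x y} → x ≢ 0# → op M x ≡ 0# → op M y ≡ 0# → ∃[ c ] y ≡ ι c · x) → HasRank M r → m ≤ suc r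
  rank-bound {M} {r} kernel (v , _ , ⊆span , _) = ℕₚ.≮⇒≥ λ 1+r<m →
    let
      x , x′ , x≗̸x′ , same = collision (ℕₚ.<-trans (ℕₚ.n<1+n r) 1+r<m) coefficients
      j , xⱼ≢x′ⱼ = ¬∀⟶∃¬ m (λ i → x i ≡ x′ i) (λ i → x i K.≟ x′ i) x≗̸x′
      -- The first kernel vector is nonzero at `j`. Recording coordinate `j` as well makes the
      -- second one vanish there, so it can be a multiple of the first only with factor 0. The extra
      -- coordinate is the reason why 1 + r < m is required.
      y , y′ , y≗̸y′ , same′ = collision 1+r<m (λ z → λ { zero → z j ; (suc i) → coefficients z i })
      c , y-y′≡c[x-x′] = kernel {comb (x ⊝ᵛ x′) e} {comb (y ⊝ᵛ y′) e}
        (λ eq → xⱼ≢x′ⱼ (K.x-y≡0⇒x≡y (comb-injective (trans eq (sym (comb-0 e))) j)))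
        (collision⇒kernel same) (collision⇒kernel (same′ ∘ suc))
      scaled : (y ⊝ᵛ y′) ≗ (λ i → c K.* (x ⊝ᵛ x′) i)
      scaled = comb-injective (trans y-y′≡c[x-x′] (sym (comb-· c (x ⊝ᵛ x′) e)))
      c≡0 : c ≡ K.0#
      c≡0 = K.x·y≡0⇒x≡0 (xⱼ≢x′ⱼ ∘ K.x-y≡0⇒x≡y) (trans (sym (scaled j))
        (trans (cong (K._+ K.- y′ j) (same′ zero)) (K.-‿inverseʳ (y′ j))))
    in y≗̸y′ (λ i → K.x-y≡0⇒x≡y (trans (scaled i) (trans (cong (K._* (x ⊝ᵛ x′) i) c≡0) (K.zeroˡ _))))
    where
    open ≡-Reasoning
    _⊝ᵛ_ : Vector K.Carrier m → Vector K.Carrier m → Vector K.Carrier m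
    (x ⊝ᵛ y) i = x i K.+ K.- y i
    coefficients : Vector K.Carrier m → Vector K.Carrier r
    coefficients z = proj₁ (⊆span (z , λ _ → refl))
    op-coefficients : ∀ z → op M (comb z e) ≡ comb (combination (columnVectors m) (coefficients z) v) e
    op-coefficients z = trans (sym (comb-columns M z)) (comb-cong {v = e} (proj₂ (⊆span (z , λ _ → refl))) (λ _ → refl))
    collision⇒kernel : ∀ {x x′} → coefficients x ≗ coefficients x′ → op M (comb (x ⊝ᵛ x′) e) ≡ 0#
    collision⇒kernel {x} {x′} same = begin
      op M (comb (x ⊝ᵛ x′) e)
        ≡⟨ linear-comb (op-linear M) (x ⊝ᵛ x′) e ⟩
      comb (x ⊝ᵛ x′) (op M ∘ e)
        ≡⟨ comb-⊖ x x′ (op M ∘ e) ⟩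
      comb x (op M ∘ e) ⊞ ⊟ comb x′ (op M ∘ e)
        ≡⟨ cong₂ (λ a b → a ⊞ ⊟ b) (linear-comb (op-linear M) x e) (linear-comb (op-linear M) x′ e) ⟨
      op M (comb x e) ⊞ ⊟ op M (comb x′ e)
        ≡⟨ cong (_⊞ ⊟ op M (comb x′ e)) (begin
             op M (comb x e)
               ≡⟨ op-coefficients x ⟩
             comb (combination (columnVectors m) (coefficients x) v) e
               ≡⟨ comb-combination (coefficients x) v ⟩
             comb (coefficients x) (λ i → comb (v i) e)
               ≡⟨ comb-cong {v = λ i → comb (v i) e} same (λ _ → refl) ⟩
             comb (coefficients x′) (λ i → comb (v i) e)
               ≡⟨ comb-combination (coefficients x′) v ⟨
             comb (combination (columnVectors m) (coefficients x′) v) e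
               ≡⟨ op-coefficients x′ ⟨
             op M (comb x′ e) ∎) ⟩
      op M (comb x′ e) ⊞ ⊟ op M (comb x′ e)
        ≡⟨ -‿inverseʳ _ ⟩
      0# ∎

-- The code of a scattered subspace is MRD

module ScatteredCode (K L : Field) (ι : Field.Carrier K → Field.Carrier L) (ι-hom : IsFieldHomomorphism K L ι)
  {m′ : ℕ} (i₁ : Fin m′) (e : Vector (Field.Carrier L) (suc m′)) (basis : Extension.IsBasisOfExtension K L ι e)
  {q N : ℕ} (K-order : HasOrder K q) (1<q : 1 < q) (L-order : HasOrder L N)
  (f : Field.Carrier L → Field.Carrier L)
  (f-linear : Coordinates.IsLinear K L ι ι-hom e basis f)
  (scattered : Extension.IsScattered K L ι (λ w → ∃[ x ] w ≡ (x , f x)))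
  where

  private
    module K where
      open Field K public
      open FieldProperties K public
      open FiniteField K K-order public
    m = suc m′
  open Field L renaming (_+_ to _⊞_; _*_ to _·_; _^_ to _↑_; -_ to ⊟_)
  open FieldProperties L
  open FiniteField L L-order
  open Extension K L ι
  open LinearAlgebra K
  open RankMetric K m
  open Coordinates K L ι ι-hom e basis
  open Pigeonhole K K-order 1<q
  open RankAttained K L ι ι-hom e basis
  open RankBound K L ι ι-hom e basis K-order 1<q
  open TwoDimensionalCode K L ι ι-hom e basis K-order f f-linear

  -- If `a₁` is nonzero, (x , f x) and (y , f y) both lie on the L-line through (1 , - a₀ / a₁), and
  -- scatteredness makes them proportional over K. If `a₁` is zero, the word is multiplication by a
  -- nonzero `a₀`, which kills no nonzero x.
  kernel-line : ∀ {a₀ a₁} → ¬ (a₀ ≡ 0# × a₁ ≡ 0#) → ∀ {x y} → x ≢ 0# →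
    word a₀ a₁ x ≡ 0# → word a₀ a₁ y ≡ 0# → ∃[ c ] y ≡ ι c · x
  kernel-line {a₀} {a₁} nonzero {x} {y} x≢0 φx≡0 φy≡0 with a₁ ≟ 0#
  ... | yes a₁≡0 = contradiction (a₀≡0 , a₁≡0) nonzero
    where
    a₀≡0 : a₀ ≡ 0#
    a₀≡0 = x·y≡0⇒x≡0 x≢0 (trans (sym (+-identityˡ (a₀ · x)))
      (trans (cong (_⊞ a₀ · x) (sym (trans (cong (_· f x) a₁≡0) (zeroˡ (f x))))) φx≡0))
  ... | no a₁≢0 with scattered (1# , slope) (λ eq → 0≢1 (sym (cong proj₁ eq)))
    where slope = proj₁ (inverse a₁ a₁≢0) · ⊟ a₀
  ... | d , d≤1 , w , _ , (⊆span , _) = compare d≤1 w (⊆span (onLine φx≡0 , x , refl)) (⊆span (onLine φy≡0 , y , refl))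
    where
    open ≡-Reasoning
    a₁⁻¹ = proj₁ (inverse a₁ a₁≢0)
    slope = a₁⁻¹ · ⊟ a₀
    onLine : ∀ {z} → word a₀ a₁ z ≡ 0# → Line (1# , slope) (z , f z)
    onLine {z} φz≡0 = z , cong₂ _,_ (sym (*-identityʳ z)) (begin
      f z                                 ≡⟨ *-identityˡ (f z) ⟨
      1# · f z                            ≡⟨ cong (_· f z) (proj₂ (inverse a₁ a₁≢0)) ⟨
      a₁ · a₁⁻¹ · f z                     ≡⟨ cong (_· f z) (*-comm a₁ a₁⁻¹) ⟩
      a₁⁻¹ · a₁ · f z                     ≡⟨ *-assoc a₁⁻¹ a₁ (f z) ⟩
      a₁⁻¹ · (a₁ · f z)                   ≡⟨ cong (a₁⁻¹ ·_) a₁fz ⟩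
      a₁⁻¹ · (⊟ a₀ · z)                   ≡⟨ *-assoc a₁⁻¹ (⊟ a₀) z ⟨
      slope · z                           ≡⟨ *-comm slope z ⟩
      z · slope                           ∎)
      where
      a₁fz : a₁ · f z ≡ ⊟ a₀ · z
      a₁fz = +-cancelʳ (a₀ · z) _ _ (begin
        a₁ · f z ⊞ a₀ · z                 ≡⟨ φz≡0 ⟩
        0#                                ≡⟨ zeroˡ z ⟨
        0# · z                            ≡⟨ cong (_· z) (-‿inverseˡ a₀) ⟨
        (⊟ a₀ ⊞ a₀) · z                   ≡⟨ distribʳ z (⊟ a₀) a₀ ⟩
        ⊟ a₀ · z ⊞ a₀ · z                 ∎)
    compare : ∀ {d} → d ≤ 1 → (w : Vector (Carrier × Carrier) d) →
      Span plane w (x , f x) → Span plane w (y , f y) → ∃[ c ] y ≡ ι c · x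
    compare {zero}  d≤1       w (c , x≡ , _) _             = contradiction x≡ x≢0
    compare {suc _} (s≤s z≤n) w (c , x≡ , _) (c′ , y≡ , _) = c′ zero K.* c⁻¹ , (begin
      y                                     ≡⟨ y≡ ⟩
      ι (c′ zero) · w₀ ⊞ 0#                 ≡⟨ +-identityʳ _ ⟩
      ι (c′ zero) · w₀                      ≡⟨ cong (ι (c′ zero) ·_) w₀≡ ⟩
      ι (c′ zero) · (ι c⁻¹ · x)             ≡⟨ *-assoc _ _ _ ⟨
      ι (c′ zero) · ι c⁻¹ · x               ≡⟨ cong (_· x) (ι-· (c′ zero) c⁻¹) ⟨
      ι (c′ zero K.* c⁻¹) · x               ∎)
      where
      w₀ = proj₁ (w zero)
      c≢0 : c zero ≢ K.0#
      c≢0 c≡0 = x≢0 (begin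
        x                                   ≡⟨ x≡ ⟩
        ι (c zero) · w₀ ⊞ 0#                ≡⟨ +-identityʳ _ ⟩
        ι (c zero) · w₀                     ≡⟨ cong (_· w₀) (trans (cong ι c≡0) ι-0) ⟩
        0# · w₀                             ≡⟨ zeroˡ w₀ ⟩
        0#                                  ∎)
      c⁻¹ = proj₁ (K.inverse (c zero) c≢0)
      w₀≡ : w₀ ≡ ι c⁻¹ · x
      w₀≡ = begin
        w₀                                  ≡⟨ *-identityˡ w₀ ⟨
        1# · w₀                             ≡⟨ cong (_· w₀) (trans (cong ι (trans (K.*-comm c⁻¹ (c zero))
                                                 (proj₂ (K.inverse (c zero) c≢0)))) ι-1) ⟨
        ι (c⁻¹ K.* c zero) · w₀             ≡⟨ cong (_· w₀) (ι-· c⁻¹ (c zero)) ⟩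
        ι c⁻¹ · ι (c zero) · w₀             ≡⟨ *-assoc _ _ _ ⟩
        ι c⁻¹ · (ι (c zero) · w₀)           ≡⟨ cong (ι c⁻¹ ·_) (trans x≡ (+-identityʳ _)) ⟨
        ι c⁻¹ · x                           ∎

  e₀≢0 : e zero ≢ 0#
  e₀≢0 e₀≡0 = K.0≢1 (comb-injective {λ _ → K.0#} {δ zero} (trans (comb-0 e) (trans (sym e₀≡0) (sym (comb-δ zero e)))) zero)

  -- A word that vanishes everywhere kills two different basis vectors, which are not proportional
  -- over K. The index `i₁` supplies the second one.
  word-injective : ∀ {a₀ a₁} → word a₀ a₁ ≗ (λ _ → 0#) → a₀ ≡ 0# × a₁ ≡ 0#
  word-injective {a₀} {a₁} vanish = decidable-stable ((a₀ ≟ 0#) ×-dec (a₁ ≟ 0#)) λ nonzero →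
    let c , e₁≡ce₀ = kernel-line nonzero e₀≢0 (vanish (e zero)) (vanish (e (suc i₁))) in
    K.0≢1 (trans (sym (K.zeroʳ c)) (trans (comb-injective {λ i → c K.* δ zero i} {δ (suc i₁)}
      (trans (comb-· c (δ zero) e) (trans (cong (ι c ·_) (comb-δ zero e))
        (trans (sym e₁≡ce₀) (sym (comb-δ (suc i₁) e))))) (suc i₁)) (δ-refl (suc i₁))))

  dimension : HasDimension matrices (toCode e Words) (m + m)
  dimension = code-dimension word-injective

  kernel-of : ∀ {M a₀ a₁} → op M ≗ word a₀ a₁ → ¬ (a₀ ≡ 0# × a₁ ≡ 0#) →
    ∀ {x y} → x ≢ 0# → op M x ≡ 0# → op M y ≡ 0# → ∃[ c ] y ≡ ι c · x
  kernel-of M≗ nonzero {x} {y} x≢0 Mx≡0 My≡0 =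
    kernel-line nonzero x≢0 (trans (sym (M≗ x)) Mx≡0) (trans (sym (M≗ y)) My≡0)

  minimum-distance : HasMinimumDistance (toCode e Words) m′
  minimum-distance = attained , λ r (A , B , A∈ , B∈ , A≉B , rank) →
    let a₀ , a₁ , difference , nonzero = difference∈code {A} {B} A∈ B∈ A≉B in
    ℕₚ.≤-pred (rank-bound {A ⊕ (⊝ B)} (kernel-of {A ⊕ (⊝ B)} difference nonzero) rank)
    where
    open ≡-Reasoning
    e₀⁻¹ = proj₁ (inverse (e zero) e₀≢0)
    -- Chosen so that the word with `a₁ = 1#` kills the first basis vector, as `rank-attained`
    -- requires.
    slope = ⊟ (f (e zero) · e₀⁻¹)
    A B : Matrix
    A = matrix (word slope 1#)
    B _ _ = K.0#
    A≗ : op A ≗ word slope 1#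
    A≗ = op-matrix (word-linear slope 1#)
    D≗ : op (A ⊕ (⊝ B)) ≗ word slope 1#
    D≗ x = begin
      op (A ⊕ (⊝ B)) x            ≡⟨ op-⊖ A B x ⟩
      op A x ⊞ ⊟ op B x           ≡⟨ cong₂ (λ a b → a ⊞ ⊟ b) (A≗ x) (op-0 x) ⟩
      word slope 1# x ⊞ ⊟ 0#      ≡⟨ cong (word slope 1# x ⊞_) -0#≈0# ⟩
      word slope 1# x ⊞ 0#        ≡⟨ +-identityʳ _ ⟩
      word slope 1# x             ∎
    1≢0 : ¬ (slope ≡ 0# × 1# ≡ 0#)
    1≢0 (_ , eq) = 0≢1 (sym eq)
    vanish : word slope 1# (e zero) ≡ 0#
    vanish = begin
      1# · f (e zero) ⊞ slope · e zero            ≡⟨ cong₂ _⊞_ (*-identityˡ _) (sym (-‿distribˡ-* _ _)) ⟩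
      f (e zero) ⊞ ⊟ (f (e zero) · e₀⁻¹ · e zero) ≡⟨ cong (λ z → f (e zero) ⊞ ⊟ z) (trans (*-assoc _ _ _)
                                                      (trans (cong (f (e zero) ·_) (trans (*-comm _ _) (proj₂ (inverse (e zero) e₀≢0)))) (*-identityʳ _))) ⟩
      f (e zero) ⊞ ⊟ f (e zero)                   ≡⟨ -‿inverseʳ _ ⟩
      0#                                          ∎
    attained : ∃[ A ] ∃[ B ] A ∈ toCode e Words × B ∈ toCode e Words × ¬ A ≈ B × HasDistance A B m′
    attained = A , B , ⇒∈code {A} A≗ , ⇒∈code {B} {0#} {0#} (λ x → trans (op-0 x)
        (sym (trans (cong₂ _⊞_ (zeroˡ (f x)) (zeroˡ x)) (+-identityʳ 0#)))) ,
      (λ A≈B → 1≢0 (word-injective (λ x → trans (sym (A≗ x)) (trans (op-cong {A} {B} A≈B x) (op-0 x))))) ,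
      rank-attained {A ⊕ (⊝ B)} (trans (D≗ (e zero)) vanish) (λ y Dy≡0 →
        kernel-of {A ⊕ (⊝ B)} D≗ 1≢0 e₀≢0 (trans (D≗ (e zero)) vanish) Dy≡0)

  mrd : IsMRD q (toCode e Words) m′
  mrd = minimum-distance , code-size-2m word-injective (trans (cong (_+ 1) (ℕₚ.m+n∸n≡m 1 m′)) refl)

-- The maps in ℋ₂ and the idealisers of the code

module GabidulinFunctions (L : Field) {q n : ℕ} (2<n : 2 < n) {{2n≢0 : NonZero (2 * n)}}
  (L-order : HasOrder L (q ^ (2 * n))) (prime-power : IsPrimePower q)
  (t : ℕ) (t-coprime : gcd t (2 * n) ≡ 1) where

  open Field L renaming (_+_ to _⊞_; _*_ to _·_; _^_ to _↑_; -_ to ⊟_)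
  open FieldProperties L
  open LinearizedPolynomials L {q} {2 * n} L-order prime-power
  open Congruence (2 * n) using (*t-≢)
  open HalfTurn {n} 2<n {t} t-coprime
  open Families L q n

  ⟦⟧-++ : ∀ ts us x → ⟦ ts ++ us ⟧ x ≡ ⟦ ts ⟧ x ⊞ ⟦ us ⟧ x
  ⟦⟧-++ []       us x = sym (+-identityˡ _)
  ⟦⟧-++ ((c , i) ∷ ts) us x = trans (cong (c · x ^[ i ] ⊞_) (⟦⟧-++ ts us x)) (sym (+-assoc _ _ _))

  ⟦⟧-+ : ∀ ts x y → ⟦ ts ⟧ (x ⊞ y) ≡ ⟦ ts ⟧ x ⊞ ⟦ ts ⟧ y
  ⟦⟧-+ []             x y = sym (+-identityʳ 0#)
  ⟦⟧-+ ((c , i) ∷ ts) x y = trans (cong₂ _⊞_ (trans (cong (c ·_) (^[]-+ i x y)) (distribˡ c (x ^[ i ]) (y ^[ i ]))) (⟦⟧-+ ts x y))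
    (interchange _ _ _ _)

  -- Composition on the left with the monomial c x ^ (q ^ v); `inner` is composition on the right.
  -- The two differ in which coefficient receives the Frobenius.
  outer : Carrier → ℕ → Term → Term
  outer c v (a , i) = c · a ^[ v ] , v + i

  ⟦⟧-outer : ∀ c v ts x → c · (⟦ ts ⟧ x) ^[ v ] ≡ ⟦ map (outer c v) ts ⟧ x
  ⟦⟧-outer c v []             x = trans (cong (c ·_) (0^[] v)) (zeroʳ c)
  ⟦⟧-outer c v ((a , i) ∷ ts) x = trans (cong (c ·_) (^[]-+ v _ _)) (trans (distribˡ c _ _) (cong₂ _⊞_ (begin
    c · (a · x ^[ i ]) ^[ v ]            ≡⟨ cong (c ·_) (^[]-· v a (x ^[ i ])) ⟩
    c · (a ^[ v ] · x ^[ i ] ^[ v ])     ≡⟨ *-assoc c _ _ ⟨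
    c · a ^[ v ] · x ^[ i ] ^[ v ]       ≡⟨ cong (c · a ^[ v ] ·_) (trans (^[]-^[] i v x) (cong (x ^[_]) (ℕₚ.+-comm i v))) ⟩
    c · a ^[ v ] · x ^[ v + i ]          ∎) (⟦⟧-outer c v ts x)))
    where open ≡-Reasoning

  inner : Carrier → ℕ → Term → Term
  inner c v (a , i) = a · c ^[ i ] , v + i

  ⟦⟧-inner : ∀ c v ts x → ⟦ ts ⟧ (c · x ^[ v ]) ≡ ⟦ map (inner c v) ts ⟧ x
  ⟦⟧-inner c v []             x = refl
  ⟦⟧-inner c v ((a , i) ∷ ts) x = cong₂ _⊞_ (begin
    a · (c · x ^[ v ]) ^[ i ]            ≡⟨ cong (a ·_) (^[]-· i c (x ^[ v ])) ⟩
    a · (c ^[ i ] · x ^[ v ] ^[ i ])     ≡⟨ *-assoc a _ _ ⟨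
    a · c ^[ i ] · x ^[ v ] ^[ i ]       ≡⟨ cong (a · c ^[ i ] ·_) (^[]-^[] v i x) ⟩
    a · c ^[ i ] · x ^[ v + i ]          ∎) (⟦⟧-inner c v ts x)
    where open ≡-Reasoning

  -- A polynomial of degree at most 2 in θ, shifted by the Frobenius exponent `u`. The summand
  -- `0 * t` is kept so that all exponents have the shape `u + k * t` and can be treated uniformly
  -- in `k`.
  block : (ℕ → Carrier) → ℕ → List Term
  block a u = (a 0 , u + 0 * t) ∷ (a 1 , u + 1 * t) ∷ (a 2 , u + 2 * t) ∷ []

  block-outer : ∀ c v a x → c · (⟦ block a 0 ⟧ x) ^[ v ] ≡ ⟦ block (λ k → c · a k ^[ v ]) v ⟧ x
  block-outer c v a = ⟦⟧-outer c v (block a 0)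

  block-inner : ∀ c v a x → ⟦ block a 0 ⟧ (c · x ^[ v ]) ≡ ⟦ block (λ k → a k · c ^[ k * t ]) v ⟧ x
  block-inner c v a = ⟦⟧-inner c v (block a 0)

  block-miss : ∀ a {u r ts d} → (∀ {l} → l ≤ 2 → ¬ u + l * t ≋ r) → Coeff r ts d → Coeff r (block a u ++ ts) d
  block-miss a ≢r = miss (≢r z≤n) ∘ miss (≢r (s≤s z≤n)) ∘ miss (≢r (s≤s (s≤s z≤n)))

  block-hit : ∀ a u {k ts d} → k ≤ 2 → Coeff (u + k * t) ts d → Coeff (u + k * t) (block a u ++ ts) (a k ⊞ d)
  block-hit a u {0} k≤2 = hit refl ∘ miss (¬u+kt≋u+lt u {1} {0} (s≤s z≤n) z≤n λ ()) ∘ miss (¬u+kt≋u+lt u {2} {0} ℕₚ.≤-refl z≤n λ ())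
  block-hit a u {1} k≤2 = miss (¬u+kt≋u+lt u {0} {1} z≤n k≤2 λ ()) ∘ hit refl ∘ miss (¬u+kt≋u+lt u {2} {1} ℕₚ.≤-refl k≤2 λ ())
  block-hit a u {2} k≤2 = miss (¬u+kt≋u+lt u {0} {2} z≤n k≤2 λ ()) ∘ miss (¬u+kt≋u+lt u {1} {2} (s≤s z≤n) k≤2 λ ()) ∘ hit refl
  block-hit a u {suc (suc (suc _))} (s≤s (s≤s ()))

  -- Here u and u + n play the roles of the two Frobenius exponents of the scattered polynomial.
  blocks-vanish : ∀ a b d u → ⟦ block a u ++ block b (u + n) ⟧ ≗ ⟦ block d 0 ⟧ → ∀ {k} → k ≤ 2 → a k ≡ 0# ⊎ b k ≡ 0#
  blocks-vanish a b d u eq {k} k≤2 with misses u k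
  ... | inj₁ ≢r = inj₁ (trans (sym (+-identityʳ (a k))) (Coeff-unique eq
      (block-hit a u k≤2 (block-miss b (λ l≤2 → ¬u+kt≋u+n+lt u k≤2 l≤2 ∘ sym) []))
      (block-miss d ≢r [])))
  ... | inj₂ ≢r = inj₂ (trans (sym (+-identityʳ (b k))) (Coeff-unique eq
      (block-miss a (λ l≤2 → ¬u+kt≋u+n+lt u l≤2 k≤2) (block-hit b (u + n) k≤2 []))
      (block-miss d ≢r [])))

  module _ (μ : Carrier) (h : ℕ) where

    ℋ-coefficients : Carrier → Carrier → ℕ → Carrier
    ℋ-coefficients a₀ a₁ 0             = a₀
    ℋ-coefficients a₀ a₁ 1             = a₁
    ℋ-coefficients a₀ a₁ (suc (suc _)) = μ · a₀ ^[ h ]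

    ⟦ℋ⟧ : ∀ a₀ a₁ x → a₀ · x ⊞ a₁ · x ^[ t ] ⊞ μ · a₀ ^[ h ] · x ^[ 2 * t ] ≡ ⟦ block (ℋ-coefficients a₀ a₁) 0 ⟧ x
    ⟦ℋ⟧ a₀ a₁ x = trans (+-assoc _ _ _) (cong₂ _⊞_ (cong (a₀ ·_) (sym (^[0] x)))
      (cong₂ _⊞_ (cong (λ i → a₁ · x ^[ i ]) (sym (ℕₚ.+-identityʳ t))) (sym (+-identityʳ _))))

    ℋ⇒block : ∀ {φ} → φ ∈ ℋ₂ t μ h → ∃[ a₀ ] ∃[ a₁ ] φ ≗ ⟦ block (ℋ-coefficients a₀ a₁) 0 ⟧
    ℋ⇒block (a₀ , a₁ , eq) = a₀ , a₁ , λ x → trans (eq x) (⟦ℋ⟧ a₀ a₁ x)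

    θ θ-inverse : Carrier → Carrier
    θ x = x ^[ 1 * t ]
    θ-inverse x = x ^[ opposite (1 * t) ]

    θ∈ℋ : θ ∈ ℋ₂ t μ h
    θ∈ℋ = 0# , 1# , λ x → sym (begin
      0# · x ⊞ 1# · x ^[ t ] ⊞ μ · 0# ^[ h ] · x ^[ 2 * t ]
        ≡⟨ cong₂ _⊞_ (cong₂ _⊞_ (zeroˡ x) (*-identityˡ _)) (cong (_· x ^[ 2 * t ]) (trans (cong (μ ·_) (0^[] h)) (zeroʳ μ))) ⟩
      0# ⊞ x ^[ t ] ⊞ 0# · x ^[ 2 * t ]    ≡⟨ cong₂ _⊞_ (+-identityˡ _) (zeroˡ _) ⟩
      x ^[ t ] ⊞ 0#                        ≡⟨ +-identityʳ _ ⟩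
      x ^[ t ]                             ≡⟨ cong (x ^[_]) (ℕₚ.+-identityʳ t) ⟨
      x ^[ 1 * t ]                         ∎)
      where open ≡-Reasoning

    binomial∈ℋ : (λ x → x ⊞ μ · x ^[ 2 * t ]) ∈ ℋ₂ t μ h
    binomial∈ℋ = 1# , 0# , λ x → sym (begin
      1# · x ⊞ 0# · x ^[ t ] ⊞ μ · 1# ^[ h ] · x ^[ 2 * t ]
        ≡⟨ cong₂ _⊞_ (cong₂ _⊞_ (*-identityˡ x) (zeroˡ _)) (cong (_· x ^[ 2 * t ]) (trans (cong (μ ·_) (1^[] h)) (*-identityʳ μ))) ⟩
      x ⊞ 0# ⊞ μ · x ^[ 2 * t ]            ≡⟨ cong (_⊞ μ · x ^[ 2 * t ]) (+-identityʳ x) ⟩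
      x ⊞ μ · x ^[ 2 * t ]                 ∎)
      where open ≡-Reasoning

    private
      -- c₀ is the only coefficient at exponent 0.
      constant-vanishes : ∀ c b d → ⟦ block c 0 ++ block b (2 * t) ⟧ ≗ ⟦ block d (1 * t) ⟧ → c 0 ≡ 0#
      constant-vanishes c b d eq = trans (sym (+-identityʳ (c 0))) (Coeff-unique eq
          (block-hit c 0 z≤n (block-miss b (λ {l} → positive 2 {l} ℕₚ.≤-refl) []))
          (block-miss d (λ {l} → positive 1 {l} (s≤s z≤n)) []))
        where
        positive : ∀ j {l} {{_ : NonZero j}} → j ≤ 2 → l ≤ 2 → ¬ j * t + l * t ≋ 0 * t
        positive j {l} j≤2 l≤2 eq = *t-≢ {t} t-coprime {j + l} {0} j+l<2n (ℕₚ.≤-<-trans z≤n j+l<2n)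
          (λ j+l≡0 → ≢-nonZero⁻¹ j (ℕₚ.m+n≡0⇒m≡0 j j+l≡0))
          (trans (cong (_% (2 * n)) (ℕₚ.*-distribʳ-+ t j l)) eq)
          where
          j+l<2n : j + l < 2 * n
          j+l<2n = ℕₚ.≤-<-trans (ℕₚ.+-mono-≤ j≤2 l≤2) (ℕₚ.*-monoʳ-< 2 2<n)

      -- In ℋ the coefficient of θ² is tied to the constant one, so killing the latter kills both.
      linear-term : ∀ {c : ℕ → Carrier} → c 0 ≡ 0# → c 2 ≡ μ · c 0 ^[ h ] → ∀ x → ⟦ block c 0 ⟧ x ≡ c 1 · θ x
      linear-term {c} c₀≡0 c₂≡ x = begin
        c 0 · x ^[ 0 ] ⊞ (c 1 · θ x ⊞ (c 2 · x ^[ 2 * t ] ⊞ 0#))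
          ≡⟨ cong₂ (λ a b → a · x ^[ 0 ] ⊞ (c 1 · θ x ⊞ (b · x ^[ 2 * t ] ⊞ 0#))) c₀≡0
               (trans c₂≡ (trans (cong (μ ·_) (trans (cong (_^[ h ]) c₀≡0) (0^[] h))) (zeroʳ μ))) ⟩
        0# · x ^[ 0 ] ⊞ (c 1 · θ x ⊞ (0# · x ^[ 2 * t ] ⊞ 0#))
          ≡⟨ cong₂ (λ a b → a ⊞ (c 1 · θ x ⊞ b)) (zeroˡ _) (trans (+-identityʳ _) (zeroˡ _)) ⟩
        0# ⊞ (c 1 · θ x ⊞ 0#)
          ≡⟨ trans (+-identityˡ _) (+-identityʳ _) ⟩
        c 1 · θ x ∎
        where open ≡-Reasoning

    -- The composite g θ (1 + μ′ θ²) is computed in two ways. As (g θ)(1 + μ′ θ²) it has constant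
    -- coefficient `c₀`; as (g (1 + μ θ²)) θ its θ-exponents are 1, 2, 3. Hence `c₀` is 0, so g θ =
    -- c₁ θ, and θ is invertible.
    left-idealiser : ∀ {g} → (∀ {φ} → φ ∈ ℋ₂ t μ h → g ∘ φ ∈ ℋ₂ t μ h) → ∃[ c ] g ≗ (c ·_)
    left-idealiser {g} closed with ℋ⇒block (closed θ∈ℋ) | ℋ⇒block (closed binomial∈ℋ)
    ... | c₀ , c₁ , gθ≗ | d₀ , d₁ , gβ≗ = c₁ , λ x → begin
      g x                           ≡⟨ cong g (opposite-^[] (1 * t) x) ⟨
      g (θ (θ-inverse x))           ≡⟨ gθ≗ (θ-inverse x) ⟩
      ⟦ block c 0 ⟧ (θ-inverse x)   ≡⟨ linear-term {c} c₀≡0 refl (θ-inverse x) ⟩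
      c₁ · θ (θ-inverse x)          ≡⟨ cong (c₁ ·_) (opposite-^[] (1 * t) x) ⟩
      c₁ · x                        ∎
      where
      open ≡-Reasoning
      c d : ℕ → Carrier
      c = ℋ-coefficients c₀ c₁
      d = ℋ-coefficients d₀ d₁
      -- Makes θ (1 + μ′ θ²) equal to (1 + μ θ²) θ.
      μ′ = θ-inverse μ
      θ[y+μ′y] : ∀ x → θ (x ⊞ μ′ · x ^[ 2 * t ]) ≡ θ x ⊞ μ · θ x ^[ 2 * t ]
      θ[y+μ′y] x = trans (^[]-+ (1 * t) _ _) (cong (θ x ⊞_) (trans (^[]-· (1 * t) _ _)
        (cong₂ _·_ (opposite-^[] (1 * t) μ) (trans (^[]-^[] (2 * t) (1 * t) x)
          (trans (cong (x ^[_]) (ℕₚ.+-comm (2 * t) (1 * t))) (sym (^[]-^[] (1 * t) (2 * t) x)))))))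
      b′ d′ : ℕ → Carrier
      b′ k = c k · μ′ ^[ k * t ]
      d′ k = d k · 1# ^[ k * t ]
      c₀≡0 : c₀ ≡ 0#
      c₀≡0 = constant-vanishes c b′ d′ λ x → begin
        ⟦ block c 0 ++ block b′ (2 * t) ⟧ x             ≡⟨ ⟦⟧-++ (block c 0) (block b′ (2 * t)) x ⟩
        ⟦ block c 0 ⟧ x ⊞ ⟦ block b′ (2 * t) ⟧ x        ≡⟨ cong (⟦ block c 0 ⟧ x ⊞_) (block-inner μ′ (2 * t) c x) ⟨
        ⟦ block c 0 ⟧ x ⊞ ⟦ block c 0 ⟧ (μ′ · x ^[ 2 * t ])               ≡⟨ ⟦⟧-+ (block c 0) x _ ⟨
        ⟦ block c 0 ⟧ (x ⊞ μ′ · x ^[ 2 * t ])                             ≡⟨ gθ≗ _ ⟨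
        g (θ (x ⊞ μ′ · x ^[ 2 * t ]))                                     ≡⟨ cong g (θ[y+μ′y] x) ⟩
        g (θ x ⊞ μ · θ x ^[ 2 * t ])                                      ≡⟨ gβ≗ (θ x) ⟩
        ⟦ block d 0 ⟧ (θ x)                                               ≡⟨ cong ⟦ block d 0 ⟧ (*-identityˡ (θ x)) ⟨
        ⟦ block d 0 ⟧ (1# · x ^[ 1 * t ])                                 ≡⟨ block-inner 1# (1 * t) d x ⟩
        ⟦ block d′ (1 * t) ⟧ x                      ∎

    -- The mirror image: θ (1 + μ θ²) g equals (1 + θ(μ) θ²) θ g. Here θ stands to the left of `g`,
    -- so the scalar has to be pulled back through θ.
    right-idealiser : ∀ {g} → (∀ {φ} → φ ∈ ℋ₂ t μ h → φ ∘ g ∈ ℋ₂ t μ h) → ∃[ c ] g ≗ (c ·_)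
    right-idealiser {g} closed with ℋ⇒block (closed θ∈ℋ) | ℋ⇒block (closed binomial∈ℋ)
    ... | c₀ , c₁ , θg≗ | d₀ , d₁ , βg≗ = θ-inverse c₁ , λ x → ^[]-injective (1 * t) (begin
      θ (g x)                       ≡⟨ θg≗ x ⟩
      ⟦ block c 0 ⟧ x               ≡⟨ linear-term {c} c₀≡0 refl x ⟩
      c₁ · θ x                      ≡⟨ cong (_· θ x) (opposite-^[] (1 * t) c₁) ⟨
      θ (θ-inverse c₁) · θ x        ≡⟨ ^[]-· (1 * t) _ _ ⟨
      θ (θ-inverse c₁ · x)          ∎)
      where
      open ≡-Reasoning
      c d : ℕ → Carrier
      c = ℋ-coefficients c₀ c₁
      d = ℋ-coefficients d₀ d₁
      b′ d′ : ℕ → Carrier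
      b′ k = θ μ · c k ^[ 2 * t ]
      d′ k = 1# · d k ^[ 1 * t ]
      c₀≡0 : c₀ ≡ 0#
      c₀≡0 = constant-vanishes c b′ d′ λ x → begin
        ⟦ block c 0 ++ block b′ (2 * t) ⟧ x          ≡⟨ ⟦⟧-++ (block c 0) (block b′ (2 * t)) x ⟩
        ⟦ block c 0 ⟧ x ⊞ ⟦ block b′ (2 * t) ⟧ x     ≡⟨ cong (⟦ block c 0 ⟧ x ⊞_) (block-outer (θ μ) (2 * t) c x) ⟨
        ⟦ block c 0 ⟧ x ⊞ θ μ · (⟦ block c 0 ⟧ x) ^[ 2 * t ]              ≡⟨ cong (λ z → z ⊞ θ μ · z ^[ 2 * t ]) (θg≗ x) ⟨
        θ (g x) ⊞ θ μ · θ (g x) ^[ 2 * t ]                                ≡⟨ cong (λ z → θ (g x) ⊞ θ μ · z) (trans (^[]-^[] (1 * t) (2 * t) (g x))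
                                                                               (trans (cong (g x ^[_]) (ℕₚ.+-comm (1 * t) (2 * t))) (sym (^[]-^[] (2 * t) (1 * t) (g x))))) ⟩
        θ (g x) ⊞ θ μ · θ (g x ^[ 2 * t ])                                ≡⟨ trans (^[]-+ (1 * t) _ _) (cong (θ (g x) ⊞_) (^[]-· (1 * t) μ _)) ⟨
        θ (g x ⊞ μ · g x ^[ 2 * t ])                                      ≡⟨ cong θ (βg≗ x) ⟩
        θ (⟦ block d 0 ⟧ x)                                               ≡⟨ *-identityˡ _ ⟨
        1# · (⟦ block d 0 ⟧ x) ^[ 1 * t ]                                 ≡⟨ block-outer 1# (1 * t) d x ⟩
        ⟦ block d′ (1 * t) ⟧ x                      ∎

-- Multiplications and Frobenius powers as matrices

module FrobeniusMatrices (K L : Field) (ι : Field.Carrier K → Field.Carrier L) (ι-hom : IsFieldHomomorphism K L ι)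
  {q m : ℕ} {{m≢0 : NonZero m}} (prime-power : IsPrimePower q)
  (e : Vector (Field.Carrier L) m) (basis : Extension.IsBasisOfExtension K L ι e)
  (K-order : HasOrder K q) (L-order : HasOrder L (q ^ m)) where

  private
    module K where
      open Field K public
      open FieldProperties K public
      open FiniteField K K-order public
  open Field L renaming (_+_ to _⊞_; _*_ to _·_; _^_ to _↑_; -_ to ⊟_)
  open FieldProperties L
  open FiniteField L L-order
  open LinearizedPolynomials L {q} {m} L-order prime-power
  open RankMetric K m
  open Coordinates K L ι ι-hom e basis

  ι-^[] : ∀ i c → ι c ^[ i ] ≡ ι c
  ι-^[] zero    c = ^[0] (ι c)
  ι-^[] (suc i) c = begin
    ι c ↑ (q * q ^ i)          ≡⟨ ^-assocʳ (ι c) q (q ^ i) ⟨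
    (ι c ↑ q) ↑ (q ^ i)        ≡⟨ cong (_↑ (q ^ i)) (ι-↑ c q) ⟨
    ι (c K.^ q) ↑ (q ^ i)      ≡⟨ cong (λ z → ι z ↑ (q ^ i)) (K.fermat c) ⟩
    ι c ^[ i ]                 ≡⟨ ι-^[] i c ⟩
    ι c                        ∎
    where open ≡-Reasoning

  ^[]-linear : ∀ i → IsLinear (_^[ i ])
  ^[]-linear i = ^[]-+ i , λ c x → trans (^[]-· i (ι c) x) (cong (_· x ^[ i ]) (ι-^[] i c))

  ⟦⟧-linear : ∀ ts → IsLinear ⟦ ts ⟧
  ⟦⟧-linear []             = (λ _ _ → sym (+-identityʳ 0#)) , (λ c _ → sym (zeroʳ (ι c)))
  ⟦⟧-linear ((c , i) ∷ ts) = linear-+ (linear-scale c (^[]-linear i)) (⟦⟧-linear ts)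

  Ω : Carrier → Matrix
  Ω ω = matrix (ω ·_)

  Θ : ℕ → Matrix
  Θ u = matrix (_^[ u ])

  op-Ω : ∀ ω → op (Ω ω) ≗ (ω ·_)
  op-Ω ω = op-matrix (linear-scale ω linear-id)

  op-Θ : ∀ u → op (Θ u) ≗ (_^[ u ])
  op-Θ u = op-matrix (^[]-linear u)

  Ω-⊗ : ∀ ω ω′ → (Ω ω ⊗ Ω ω′) ≈ Ω (ω · ω′)
  Ω-⊗ ω ω′ = op-injective {Ω ω ⊗ Ω ω′} {Ω (ω · ω′)} λ x → trans (op-⊗ (Ω ω) (Ω ω′) x) (trans (op-Ω ω _)
    (trans (cong (ω ·_) (op-Ω ω′ x)) (trans (sym (*-assoc ω ω′ x)) (sym (op-Ω (ω · ω′) x)))))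

  -- Since multiplications commute, a `Ψ` that reverses products still satisfies the hypothesis
  -- `Ψ-ΩΩ` of `Scalars`.
  Ω-comm : ∀ ω ω′ → (Ω ω ⊗ Ω ω′) ≈ (Ω ω′ ⊗ Ω ω)
  Ω-comm ω ω′ = op-injective {Ω ω ⊗ Ω ω′} {Ω ω′ ⊗ Ω ω} λ x → begin
    op (Ω ω ⊗ Ω ω′) x    ≡⟨ op-cong {Ω ω ⊗ Ω ω′} {Ω (ω · ω′)} (Ω-⊗ ω ω′) x ⟩
    op (Ω (ω · ω′)) x    ≡⟨ cong (λ z → op (Ω z) x) (*-comm ω ω′) ⟩
    op (Ω (ω′ · ω)) x    ≡⟨ op-cong {Ω ω′ ⊗ Ω ω} {Ω (ω′ · ω)} (Ω-⊗ ω′ ω) x ⟨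
    op (Ω ω′ ⊗ Ω ω) x    ∎
    where open ≡-Reasoning

  Ω-1 : Ω 1# ≈ identity
  Ω-1 = op-injective {Ω 1#} {identity} λ x → trans (op-Ω 1# x) (trans (*-identityˡ x) (sym (op-identity x)))

  -- The relation that singles out a Frobenius power up to a scalar factor and that `Ψ` transports.
  Θ-Ω : ∀ u ω → (Θ u ⊗ Ω ω) ≈ (Ω (ω ^[ u ]) ⊗ Θ u)
  Θ-Ω u ω = op-injective {Θ u ⊗ Ω ω} {Ω (ω ^[ u ]) ⊗ Θ u} λ x → begin
    op (Θ u ⊗ Ω ω) x                ≡⟨ op-⊗ (Θ u) (Ω ω) x ⟩
    op (Θ u) (op (Ω ω) x)           ≡⟨ op-Θ u _ ⟩
    op (Ω ω) x ^[ u ]               ≡⟨ cong (_^[ u ]) (op-Ω ω x) ⟩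
    (ω · x) ^[ u ]                  ≡⟨ ^[]-· u ω x ⟩
    ω ^[ u ] · x ^[ u ]             ≡⟨ cong (ω ^[ u ] ·_) (op-Θ u x) ⟨
    ω ^[ u ] · op (Θ u) x           ≡⟨ op-Ω (ω ^[ u ]) _ ⟨
    op (Ω (ω ^[ u ])) (op (Θ u) x)  ≡⟨ op-⊗ (Ω (ω ^[ u ])) (Θ u) x ⟨
    op (Ω (ω ^[ u ]) ⊗ Θ u) x       ∎
    where open ≡-Reasoning

  Θ-Θ : ∀ u v → (∀ x → x ^[ v ] ^[ u ] ≡ x) → (Θ u ⊗ Θ v) ≈ identity
  Θ-Θ u v inverse = op-injective {Θ u ⊗ Θ v} {identity} λ x → trans (op-⊗ (Θ u) (Θ v) x) (trans (op-Θ u _)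
    (trans (cong (_^[ u ]) (op-Θ v x)) (trans (inverse x) (sym (op-identity x)))))

  -- ν is shown to be a multiplicative bijection only; additivity is never needed, because
  -- multiplicativity already makes ν commute with the Frobenius powers.
  module Scalars (Ψ : Matrix → Carrier → Carrier)
    (Ψ-cong : ∀ {M N} → M ≈ N → Ψ M ≗ Ψ N)
    (Ψ-injective : ∀ {M N} → Ψ M ≗ Ψ N → M ≈ N)
    (Ψ-1 : Ψ identity ≗ id)
    (Ψ-ΩΩ : ∀ ω ω′ → Ψ (Ω ω ⊗ Ω ω′) ≗ Ψ (Ω ω) ∘ Ψ (Ω ω′))
    (scalar : ∀ ω → ∃[ c ] Ψ (Ω ω) ≗ (c ·_)) where

    ν : Carrier → Carrier
    ν ω = proj₁ (scalar ω)

    Ψ-Ω : ∀ ω → Ψ (Ω ω) ≗ (ν ω ·_)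
    Ψ-Ω ω = proj₂ (scalar ω)

    ν-1 : ν 1# ≡ 1#
    ν-1 = trans (sym (*-identityʳ _)) (trans (sym (Ψ-Ω 1# 1#)) (trans (Ψ-cong {Ω 1#} {identity} Ω-1 1#) (Ψ-1 1#)))

    ν-· : ∀ ω ω′ → ν (ω · ω′) ≡ ν ω · ν ω′
    ν-· ω ω′ = begin
      ν (ω · ω′)                   ≡⟨ *-identityʳ _ ⟨
      ν (ω · ω′) · 1#              ≡⟨ Ψ-Ω (ω · ω′) 1# ⟨
      Ψ (Ω (ω · ω′)) 1#            ≡⟨ Ψ-cong {Ω ω ⊗ Ω ω′} {Ω (ω · ω′)} (Ω-⊗ ω ω′) 1# ⟨
      Ψ (Ω ω ⊗ Ω ω′) 1#            ≡⟨ Ψ-ΩΩ ω ω′ 1# ⟩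
      Ψ (Ω ω) (Ψ (Ω ω′) 1#)        ≡⟨ Ψ-Ω ω _ ⟩
      ν ω · Ψ (Ω ω′) 1#            ≡⟨ cong (ν ω ·_) (trans (Ψ-Ω ω′ 1#) (*-identityʳ _)) ⟩
      ν ω · ν ω′                   ∎
      where open ≡-Reasoning

    ν-↑ : ∀ ω k → ν (ω ↑ k) ≡ ν ω ↑ k
    ν-↑ ω zero    = ν-1
    ν-↑ ω (suc k) = trans (ν-· ω (ω ↑ k)) (cong (ν ω ·_) (ν-↑ ω k))

    ν-injective : Injective _≡_ _≡_ ν
    ν-injective {ω} {ω′} eq = begin
      ω                ≡⟨ *-identityʳ ω ⟨
      ω · 1#           ≡⟨ op-Ω ω 1# ⟨
      op (Ω ω) 1#      ≡⟨ op-cong {Ω ω} {Ω ω′} (Ψ-injective {Ω ω} {Ω ω′}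
                            (λ x → trans (Ψ-Ω ω x) (trans (cong (_· x) eq) (sym (Ψ-Ω ω′ x))))) 1# ⟩
      op (Ω ω′) 1#     ≡⟨ op-Ω ω′ 1# ⟩
      ω′ · 1#          ≡⟨ *-identityʳ ω′ ⟩
      ω′               ∎
      where open ≡-Reasoning

    ν-surjective : ∀ y → ∃[ ω ] ν ω ≡ y
    ν-surjective = injective⇒surjective ν-injective

    ν-≢0 : ∀ {ω} → ω ≢ 0# → ν ω ≢ 0#
    ν-≢0 {ω} ω≢0 νω≡0 = 0≢1 (begin
      0#                   ≡⟨ zeroˡ _ ⟨
      0# · ν ω⁻¹           ≡⟨ cong (_· ν ω⁻¹) νω≡0 ⟨
      ν ω · ν ω⁻¹          ≡⟨ ν-· ω ω⁻¹ ⟨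
      ν (ω · ω⁻¹)          ≡⟨ cong ν (proj₂ (inverse ω ω≢0)) ⟩
      ν 1#                 ≡⟨ ν-1 ⟩
      1#                   ∎)
      where
      open ≡-Reasoning
      ω⁻¹ = proj₁ (inverse ω ω≢0)

    -- Surjectivity of `ν` lets every argument be written as `ν ω`, so the value at 1 determines
    -- `X`.
    semilinear⇒monomial : ∀ {X : Carrier → Carrier} v → (∀ ω → X (ν ω) ≡ ν ω ^[ v ] · X 1#) → ∀ x → X x ≡ x ^[ v ] · X 1#
    semilinear⇒monomial {X} v semilinear x = let ω , νω≡x = ν-surjective x in
      subst (λ z → X z ≡ z ^[ v ] · X 1#) νω≡x (semilinear ω)

    monomial-≢0 : ∀ {X Y : Carrier → Carrier} {v} → (∀ x → X x ≡ x ^[ v ] · X 1#) → (∀ x → X (Y x) ≡ x) → X 1# ≢ 0#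
    monomial-≢0 {X} {Y} {v} monomial inverse X1≡0 = 0≢1 (begin
      0#                        ≡⟨ zeroʳ _ ⟨
      Y 1# ^[ v ] · 0#          ≡⟨ cong (Y 1# ^[ v ] ·_) X1≡0 ⟨
      Y 1# ^[ v ] · X 1#        ≡⟨ monomial (Y 1#) ⟨
      X (Y 1#)                  ≡⟨ inverse 1# ⟩
      1#                        ∎)
      where open ≡-Reasoning

    module Covariant (Ψ-⊗ : ∀ M N → Ψ (M ⊗ N) ≗ Ψ M ∘ Ψ N) where

      Ψ-Θ : ∀ u x → Ψ (Θ u) x ≡ x ^[ u ] · Ψ (Θ u) 1#
      Ψ-Θ u = semilinear⇒monomial u λ ω → begin
        Ψ (Θ u) (ν ω)                       ≡⟨ cong (Ψ (Θ u)) (trans (Ψ-Ω ω 1#) (*-identityʳ _)) ⟨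
        Ψ (Θ u) (Ψ (Ω ω) 1#)                ≡⟨ Ψ-⊗ (Θ u) (Ω ω) 1# ⟨
        Ψ (Θ u ⊗ Ω ω) 1#                    ≡⟨ Ψ-cong {Θ u ⊗ Ω ω} {Ω (ω ^[ u ]) ⊗ Θ u} (Θ-Ω u ω) 1# ⟩
        Ψ (Ω (ω ^[ u ]) ⊗ Θ u) 1#           ≡⟨ Ψ-⊗ (Ω (ω ^[ u ])) (Θ u) 1# ⟩
        Ψ (Ω (ω ^[ u ])) (Ψ (Θ u) 1#)       ≡⟨ Ψ-Ω (ω ^[ u ]) _ ⟩
        ν (ω ^[ u ]) · Ψ (Θ u) 1#           ≡⟨ cong (_· Ψ (Θ u) 1#) (ν-↑ ω (q ^ u)) ⟩
        ν ω ^[ u ] · Ψ (Θ u) 1#             ∎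
        where open ≡-Reasoning

      Ψ-Θ-≢0 : ∀ u → Ψ (Θ u) 1# ≢ 0#
      Ψ-Θ-≢0 u = monomial-≢0 {Ψ (Θ u)} {Ψ (Θ (opposite u))} {u} (Ψ-Θ u) λ x → trans (sym (Ψ-⊗ (Θ u) (Θ (opposite u)) x))
        (trans (Ψ-cong {Θ u ⊗ Θ (opposite u)} {identity} (Θ-Θ u (opposite u) (opposite-^[] u)) x) (Ψ-1 x))

    module Contravariant (Ψ-⊗ : ∀ M N → Ψ (M ⊗ N) ≗ Ψ N ∘ Ψ M) where

      -- Under reversal `Θ-Ω` becomes: `Ψ (Θ u)` sends ν(ω) ^ (q ^ u) to ν(ω) times its value at 1.
      -- Hence the inverse power `v` appears, and `ω` is taken with ν(ω) = x ^ (q ^ v).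
      Ψ-Θ : ∀ u v → (∀ x → x ^[ v ] ^[ u ] ≡ x) → ∀ x → Ψ (Θ u) x ≡ x ^[ v ] · Ψ (Θ u) 1#
      Ψ-Θ u v inverse x = begin
        Ψ (Θ u) x                           ≡⟨ cong (Ψ (Θ u)) (trans (ν-↑ ω (q ^ u)) (trans (cong (_^[ u ]) νω≡) (inverse x))) ⟨
        Ψ (Θ u) (ν (ω ^[ u ]))              ≡⟨ cong (Ψ (Θ u)) (trans (Ψ-Ω (ω ^[ u ]) 1#) (*-identityʳ _)) ⟨
        Ψ (Θ u) (Ψ (Ω (ω ^[ u ])) 1#)       ≡⟨ Ψ-⊗ (Ω (ω ^[ u ])) (Θ u) 1# ⟨
        Ψ (Ω (ω ^[ u ]) ⊗ Θ u) 1#           ≡⟨ Ψ-cong {Θ u ⊗ Ω ω} {Ω (ω ^[ u ]) ⊗ Θ u} (Θ-Ω u ω) 1# ⟨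
        Ψ (Θ u ⊗ Ω ω) 1#                    ≡⟨ Ψ-⊗ (Θ u) (Ω ω) 1# ⟩
        Ψ (Ω ω) (Ψ (Θ u) 1#)                ≡⟨ Ψ-Ω ω _ ⟩
        ν ω · Ψ (Θ u) 1#                    ≡⟨ cong (_· Ψ (Θ u) 1#) νω≡ ⟩
        x ^[ v ] · Ψ (Θ u) 1#               ∎
        where
        open ≡-Reasoning
        ω = proj₁ (ν-surjective (x ^[ v ]))
        νω≡ : ν ω ≡ x ^[ v ]
        νω≡ = proj₂ (ν-surjective (x ^[ v ]))

      Ψ-Θ-≢0 : ∀ u v → (∀ x → x ^[ v ] ^[ u ] ≡ x) → (∀ x → x ^[ u ] ^[ v ] ≡ x) → Ψ (Θ u) 1# ≢ 0#
      Ψ-Θ-≢0 u v inverse inverse′ = monomial-≢0 {Ψ (Θ u)} {Ψ (Θ v)} {v} (Ψ-Θ u v inverse) λ x → trans (sym (Ψ-⊗ (Θ v) (Θ u) x))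
        (trans (Ψ-cong {Θ v ⊗ Θ u} {identity} (Θ-Θ v u inverse′) x) (Ψ-1 x))

-- Inequivalence of the two families of codes

module Inequivalence (K L : Field) (ι : Field.Carrier K → Field.Carrier L) (ι-hom : IsFieldHomomorphism K L ι)
  {q n : ℕ} (2<n : 2 < n) {{2n≢0 : NonZero (2 * n)}} (prime-power : IsPrimePower q)
  (e : Vector (Field.Carrier L) (2 * n)) (basis : Extension.IsBasisOfExtension K L ι e)
  (K-order : HasOrder K q) (L-order : HasOrder L (q ^ (2 * n)))
  (b : Field.Carrier L) (s : ℕ) (b≢0 : b ≢ Field.0# L)
  (t h : ℕ) (μ : Field.Carrier L) (t-coprime : gcd t (2 * n) ≡ 1) where

  private
    m = 2 * n
  open Field L renaming (_+_ to _⊞_; _*_ to _·_; _^_ to _↑_; -_ to ⊟_)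
  open FieldProperties L
  open Extension K L ι
  open RankMetric K m
  open Families L q n
  open Coordinates K L ι ι-hom e basis
  open LinearizedPolynomials L {q} {m} L-order prime-power
  open FrobeniusMatrices K L ι ι-hom prime-power e basis K-order L-order
  open GabidulinFunctions L 2<n L-order prime-power t t-coprime

  f : Carrier → Carrier
  f x = b · x ^[ s ] ⊞ x ^[ s + n ]

  f-linear : IsLinear f
  f-linear = linear-+ (linear-scale b (^[]-linear s)) (^[]-linear (s + n))

  open TwoDimensionalCode K L ι ι-hom e basis K-order f f-linear

  ℋ : Pred (Carrier → Carrier) 0ℓ
  ℋ = ℋ₂ t μ h

  𝐂 𝐇 : Code
  𝐂 = toCode e Words
  𝐇 = toCode e ℋ

  ℋ-resp : ∀ {φ ψ} → φ ≗ ψ → ψ ∈ ℋ → φ ∈ ℋ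
  ℋ-resp φ≗ψ (a₀ , a₁ , eq) = a₀ , a₁ , λ x → trans (φ≗ψ x) (eq x)

  ℋ-linear : ∀ {φ} → φ ∈ ℋ → IsLinear φ
  ℋ-linear φ∈ with ℋ⇒block μ h φ∈
  ... | a₀ , a₁ , φ≗ = linear-cong φ≗ (⟦⟧-linear (block (ℋ-coefficients μ h a₀ a₁) 0))

  ∈H⇒ : ∀ {M} → M ∈ 𝐇 → op M ∈ ℋ
  ∈H⇒ {M} (φ , φ∈ , rep) = ℋ-resp (λ x → sym (represents⇒op {M} (ℋ-linear φ∈) rep x)) φ∈

  ⇒∈H : ∀ {M} → op M ∈ ℋ → M ∈ 𝐇
  ⇒∈H {M} M∈ = op M , M∈ , op-e M

  identity∈C : identity ∈ 𝐂
  identity∈C = ⇒∈code {identity} {1#} {0#} λ x → trans (op-identity x)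
    (sym (trans (cong₂ _⊞_ (zeroˡ (f x)) (*-identityˡ x)) (+-identityˡ x)))

  Ω⊗∈C : ∀ ω {M} → M ∈ 𝐂 → (Ω ω ⊗ M) ∈ 𝐂
  Ω⊗∈C ω {M} M∈ with ∈code⇒ {M} M∈
  ... | a₀ , a₁ , M≗ = ⇒∈code {Ω ω ⊗ M} {ω · a₀} {ω · a₁} λ x → trans (op-⊗ (Ω ω) M x) (trans (op-Ω ω _)
    (trans (cong (ω ·_) (M≗ x)) (trans (distribˡ ω _ _) (cong₂ _⊞_ (sym (*-assoc ω a₁ (f x))) (sym (*-assoc ω a₀ x))))))

  -- The matrix of `f`, assembled from `Ω` and `Θ` so that `Ψ` can be evaluated factor by factor.
  F : Matrix
  F = (Ω b ⊗ Θ s) ⊕ Θ (s + n)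

  F∈C : F ∈ 𝐂
  F∈C = ⇒∈code {F} {0#} {1#} λ x → begin
    op F x                                      ≡⟨ op-⊕ (Ω b ⊗ Θ s) (Θ (s + n)) x ⟩
    op (Ω b ⊗ Θ s) x ⊞ op (Θ (s + n)) x         ≡⟨ cong₂ _⊞_ (trans (op-⊗ (Ω b) (Θ s) x) (trans (op-Ω b _) (cong (b ·_) (op-Θ s x)))) (op-Θ (s + n) x) ⟩
    f x                                         ≡⟨ *-identityˡ (f x) ⟨
    1# · f x                                    ≡⟨ +-identityʳ _ ⟨
    1# · f x ⊞ 0#                               ≡⟨ cong (1# · f x ⊞_) (zeroˡ x) ⟨
    word 0# 1# x                                ∎
    where open ≡-Reasoning

  -- `T` will be `mapEntries σ`, alone or after `transpose`. The hypotheses hold for both; the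
  -- behaviour on products, where they differ, is left to the two final lemmas.
  module Twist (T : Matrix → Matrix)
    (T-cong : ∀ {M N} → M ≈ N → T M ≈ T N) (T-injective : ∀ {M N} → T M ≈ T N → M ≈ N)
    (T-1 : T identity ≈ identity) (T-⊕ : ∀ M N → T (M ⊕ N) ≈ (T M ⊕ T N))
    {A A′ B B′ : Matrix} (AA′≈1 : (A ⊗ A′) ≈ identity) (A′A≈1 : (A′ ⊗ A) ≈ identity)
    (BB′≈1 : (B ⊗ B′) ≈ identity) (B′B≈1 : (B′ ⊗ B) ≈ identity)
    (equivalent : image (λ M → (A ⊗ T M) ⊗ B) 𝐂 ≐ 𝐇) where

    private
      AA′ : ∀ x → op A (op A′ x) ≡ x
      AA′ = op-inverse {A} {A′} AA′≈1
      A′A : ∀ x → op A′ (op A x) ≡ x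
      A′A = op-inverse {A′} {A} A′A≈1
      BB′ : ∀ x → op B (op B′ x) ≡ x
      BB′ = op-inverse {B} {B′} BB′≈1
      B′B : ∀ x → op B′ (op B x) ≡ x
      B′B = op-inverse {B′} {B} B′B≈1

    τ : Matrix → Carrier → Carrier
    τ M = op (T M)

    τ-⊕ : ∀ M N x → τ (M ⊕ N) x ≡ τ M x ⊞ τ N x
    τ-⊕ M N x = trans (op-cong {T (M ⊕ N)} {T M ⊕ T N} (T-⊕ M N) x) (op-⊕ (T M) (T N) x)

    τ-1 : ∀ x → τ identity x ≡ x
    τ-1 x = trans (op-cong {T identity} {identity} T-1 x) (op-identity x)

    transported : ∀ M x → op ((A ⊗ T M) ⊗ B) x ≡ op A (τ M (op B x))
    transported M x = trans (op-⊗ (A ⊗ T M) B x) (op-⊗ A (T M) (op B x))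

    C⇒ℋ : ∀ {M} → M ∈ 𝐂 → op A ∘ τ M ∘ op B ∈ ℋ
    C⇒ℋ {M} M∈ = ℋ-resp (λ x → sym (transported M x))
      (∈H⇒ {(A ⊗ T M) ⊗ B} (proj₁ equivalent {(A ⊗ T M) ⊗ B} (M , M∈ , λ _ _ → refl)))

    ℋ⇒C : ∀ {φ} → φ ∈ ℋ → ∃[ M ] M ∈ 𝐂 × φ ≗ op A ∘ τ M ∘ op B
    ℋ⇒C {φ} φ∈ with proj₂ equivalent {matrix φ} (⇒∈H {matrix φ} (ℋ-resp (op-matrix (ℋ-linear φ∈)) φ∈))
    ... | M , M∈ , φ≈ = M , M∈ , λ x → trans (sym (op-matrix (ℋ-linear φ∈) x))
      (trans (op-cong {matrix φ} {(A ⊗ T M) ⊗ B} φ≈ x) (transported M x))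

    g : Carrier → Carrier
    g = op A ∘ op B

    g∈ℋ : g ∈ ℋ
    g∈ℋ = ℋ-resp (λ x → cong (op A) (sym (τ-1 (op B x)))) (C⇒ℋ {identity} identity∈C)

    g₀ g₁ : Carrier
    g₀ = proj₁ (ℋ⇒block μ h g∈ℋ)
    g₁ = proj₁ (proj₂ (ℋ⇒block μ h g∈ℋ))

    γ : ℕ → Carrier
    γ = ℋ-coefficients μ h g₀ g₁

    g≗ : g ≗ ⟦ block γ 0 ⟧
    g≗ = proj₂ (proj₂ (ℋ⇒block μ h g∈ℋ))

    γ-not-vanishing : ¬ (∀ {k} → k ≤ 2 → γ k ≡ 0#)
    γ-not-vanishing γ≡0 = 0≢1 (begin
      0#                        ≡⟨ trans (cong₂ _⊞_ refl (trans (cong₂ _⊞_ refl (+-identityʳ 0#)) (+-identityʳ 0#))) (+-identityʳ 0#) ⟨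
      0# ⊞ (0# ⊞ (0# ⊞ 0#))     ≡⟨ cong₂ _⊞_ (term 0 z≤n) (cong₂ _⊞_ (term 1 (s≤s z≤n)) (cong (_⊞ 0#) (term 2 ℕₚ.≤-refl))) ⟨
      ⟦ block γ 0 ⟧ x           ≡⟨ g≗ x ⟨
      op A (op B x)             ≡⟨ cong (op A) (BB′ (op A′ 1#)) ⟩
      op A (op A′ 1#)           ≡⟨ AA′ 1# ⟩
      1#                        ∎)
      where
      open ≡-Reasoning
      -- The preimage of 1 under the invertible map `g`.
      x = op B′ (op A′ 1#)
      term : ∀ k → k ≤ 2 → γ k · x ^[ k * t ] ≡ 0#
      term k k≤2 = trans (cong (_· x ^[ k * t ]) (γ≡0 k≤2)) (zeroˡ _)

    -- At each index `blocks-vanish` makes `a k` or `c k` zero, and either of them passes this on to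
    -- `γ k`. Thus all of `g` would vanish, although it is invertible.
    conclude : ∀ a c u → (∀ {k} → a k ≡ 0# → γ k ≡ 0#) → (∀ {k} → c k ≡ 0# → γ k ≡ 0#) →
      ∀ {ψ} → ψ ∈ ℋ → ψ ≗ ⟦ block a u ++ block c (u + n) ⟧ → ⊥
    conclude a c u a⇒γ c⇒γ ψ∈ ψ≗ with ℋ⇒block μ h ψ∈
    ... | d₀ , d₁ , ψ≗H = γ-not-vanishing λ k≤2 → [ a⇒γ , c⇒γ ]′
      (blocks-vanish a c (ℋ-coefficients μ h d₀ d₁) u (λ x → trans (sym (ψ≗ x)) (ψ≗H x)) k≤2)

    contradiction-covariant : (∀ M N → T (M ⊗ N) ≈ (T M ⊗ T N)) → ⊥
    contradiction-covariant T-⊗ = conclude (λ k → β · γ k ^[ s ]) (λ k → β′ · γ k ^[ s + n ]) s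
      (λ eq → ^[]-≡0⇒≡0 s (x·y≡0⇒y≡0 β≢0 eq)) (λ eq → ^[]-≡0⇒≡0 (s + n) (x·y≡0⇒y≡0 (Ψ-Θ-≢0 (s + n)) eq))
      (C⇒ℋ {F} F∈C) λ x → begin
        op A (τ F (op B x))
          -- Inserting A′ A rewrites the image of `F` as `Ψ F` applied after `g`; the Frobenius
          -- powers then act on the coefficients of `g`.
          ≡⟨ cong (λ z → op A (τ F z)) (A′A (op B x)) ⟨
        Ψ F (g x)
          ≡⟨ Ψ-F (g x) ⟩
        β · g x ^[ s ] ⊞ β′ · g x ^[ s + n ]
          ≡⟨ cong (λ z → β · z ^[ s ] ⊞ β′ · z ^[ s + n ]) (g≗ x) ⟩
        β · (⟦ block γ 0 ⟧ x) ^[ s ] ⊞ β′ · (⟦ block γ 0 ⟧ x) ^[ s + n ]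
          ≡⟨ cong₂ _⊞_ (block-outer β s γ x) (block-outer β′ (s + n) γ x) ⟩
        ⟦ block (λ k → β · γ k ^[ s ]) s ⟧ x ⊞ ⟦ block (λ k → β′ · γ k ^[ s + n ]) (s + n) ⟧ x
          ≡⟨ ⟦⟧-++ (block (λ k → β · γ k ^[ s ]) s) (block (λ k → β′ · γ k ^[ s + n ]) (s + n)) x ⟨
        ⟦ block (λ k → β · γ k ^[ s ]) s ++ block (λ k → β′ · γ k ^[ s + n ]) (s + n) ⟧ x ∎
      where
      open ≡-Reasoning
      τ-⊗ : ∀ M N x → τ (M ⊗ N) x ≡ τ M (τ N x)
      τ-⊗ M N x = trans (op-cong {T (M ⊗ N)} {T M ⊗ T N} (T-⊗ M N) x) (op-⊗ (T M) (T N) x)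
      Ψ : Matrix → Carrier → Carrier
      Ψ M = op A ∘ τ M ∘ op A′
      Ψ-⊗ : ∀ M N → Ψ (M ⊗ N) ≗ Ψ M ∘ Ψ N
      Ψ-⊗ M N x = cong (op A) (trans (τ-⊗ M N _) (cong (τ M) (sym (A′A _))))
      Ψ-injective : ∀ {M N} → Ψ M ≗ Ψ N → M ≈ N
      Ψ-injective {M} {N} eq = T-injective {M} {N} (op-injective {T M} {T N} λ x → begin
        τ M x                          ≡⟨ trans (A′A _) (cong (τ M) (A′A x)) ⟨
        op A′ (Ψ M (op A x))           ≡⟨ cong (op A′) (eq (op A x)) ⟩
        op A′ (Ψ N (op A x))           ≡⟨ trans (A′A _) (cong (τ N) (A′A x)) ⟩
        τ N x                          ∎)
      scalar : ∀ ω → ∃[ c ] Ψ (Ω ω) ≗ (c ·_)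
      scalar ω = left-idealiser μ h λ φ∈ → let M , M∈ , φ≗ = ℋ⇒C φ∈ in
        ℋ-resp (λ x → trans (cong (Ψ (Ω ω)) (φ≗ x)) (cong (op A) (trans (cong (τ (Ω ω)) (A′A _)) (sym (τ-⊗ (Ω ω) M (op B x))))))
          (C⇒ℋ {Ω ω ⊗ M} (Ω⊗∈C ω {M} M∈))
      open Scalars Ψ (λ {M} {N} M≈N x → cong (op A) (op-cong {T M} {T N} (T-cong {M} {N} M≈N) (op A′ x)))
        (λ {M} {N} → Ψ-injective {M} {N}) (λ x → trans (cong (op A) (τ-1 _)) (AA′ x)) (λ ω ω′ → Ψ-⊗ (Ω ω) (Ω ω′)) scalar
      open Covariant Ψ-⊗
      β β′ : Carrier
      β = ν b · Ψ (Θ s) 1#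
      β′ = Ψ (Θ (s + n)) 1#
      β≢0 : β ≢ 0#
      β≢0 = ·-≢0 (ν-≢0 b≢0) (Ψ-Θ-≢0 s)
      Ψ-F : ∀ y → Ψ F y ≡ β · y ^[ s ] ⊞ β′ · y ^[ s + n ]
      Ψ-F y = trans (cong (op A) (τ-⊕ (Ω b ⊗ Θ s) (Θ (s + n)) _)) (trans (op-+ A _ _) (cong₂ _⊞_
        (trans (Ψ-⊗ (Ω b) (Θ s) y) (trans (Ψ-Ω b _) (trans (cong (ν b ·_) (trans (Ψ-Θ s y) (*-comm _ _))) (sym (*-assoc (ν b) _ _)))))
        (trans (Ψ-Θ (s + n) y) (*-comm _ _))))

    contradiction-contravariant : (∀ M N → T (M ⊗ N) ≈ (T N ⊗ T M)) → ⊥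
    contradiction-contravariant T-⊗ = conclude (λ k → γ k · β ^[ k * t ]) (λ k → γ k · β′ ^[ k * t ]) s′
      (λ {k} eq → x·y≡0⇒x≡0 (^[]-≢0 (k * t) β≢0) eq) (λ {k} eq → x·y≡0⇒x≡0 (^[]-≢0 (k * t) β′≢0) eq)
      (C⇒ℋ {F} F∈C) λ x → begin
        op A (τ F (op B x))
          -- Inserting B B′ puts `g` outside, so its coefficients stay intact and are only
          -- multiplied by powers of `β` and `β′`.
          ≡⟨ cong (op A) (BB′ _) ⟨
        g (Ψ F x)
          ≡⟨ g≗ (Ψ F x) ⟩
        ⟦ block γ 0 ⟧ (Ψ F x)
          ≡⟨ cong ⟦ block γ 0 ⟧ (Ψ-F x) ⟩
        ⟦ block γ 0 ⟧ (β · x ^[ s′ ] ⊞ β′ · x ^[ s′ + n ])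
          ≡⟨ ⟦⟧-+ (block γ 0) _ _ ⟩
        ⟦ block γ 0 ⟧ (β · x ^[ s′ ]) ⊞ ⟦ block γ 0 ⟧ (β′ · x ^[ s′ + n ])
          ≡⟨ cong₂ _⊞_ (block-inner β s′ γ x) (block-inner β′ (s′ + n) γ x) ⟩
        ⟦ block (λ k → γ k · β ^[ k * t ]) s′ ⟧ x ⊞ ⟦ block (λ k → γ k · β′ ^[ k * t ]) (s′ + n) ⟧ x
          ≡⟨ ⟦⟧-++ (block (λ k → γ k · β ^[ k * t ]) s′) (block (λ k → γ k · β′ ^[ k * t ]) (s′ + n)) x ⟨
        ⟦ block (λ k → γ k · β ^[ k * t ]) s′ ++ block (λ k → γ k · β′ ^[ k * t ]) (s′ + n) ⟧ x ∎
      where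
      open ≡-Reasoning
      -- The inverses of the powers with exponents `s` and `s + n` have exponents `s′` and `s′ + n`,
      -- since n ≡ - n modulo 2 n; `cycle` checks the second.
      s′ = opposite s
      τ-⊗ : ∀ M N x → τ (M ⊗ N) x ≡ τ N (τ M x)
      τ-⊗ M N x = trans (op-cong {T (M ⊗ N)} {T N ⊗ T M} (T-⊗ M N) x) (op-⊗ (T N) (T M) x)
      Ψ : Matrix → Carrier → Carrier
      Ψ M = op B′ ∘ τ M ∘ op B
      Ψ-cong : ∀ {M N} → M ≈ N → Ψ M ≗ Ψ N
      Ψ-cong {M} {N} M≈N x = cong (op B′) (op-cong {T M} {T N} (T-cong {M} {N} M≈N) (op B x))
      Ψ-⊗ : ∀ M N → Ψ (M ⊗ N) ≗ Ψ N ∘ Ψ M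
      Ψ-⊗ M N x = cong (op B′) (trans (τ-⊗ M N _) (cong (τ N) (sym (BB′ _))))
      Ψ-injective : ∀ {M N} → Ψ M ≗ Ψ N → M ≈ N
      Ψ-injective {M} {N} eq = T-injective {M} {N} (op-injective {T M} {T N} λ x → begin
        τ M x                          ≡⟨ trans (BB′ _) (cong (τ M) (BB′ x)) ⟨
        op B (Ψ M (op B′ x))           ≡⟨ cong (op B) (eq (op B′ x)) ⟩
        op B (Ψ N (op B′ x))           ≡⟨ trans (BB′ _) (cong (τ N) (BB′ x)) ⟩
        τ N x                          ∎)
      scalar : ∀ ω → ∃[ c ] Ψ (Ω ω) ≗ (c ·_)
      scalar ω = right-idealiser μ h λ φ∈ → let M , M∈ , φ≗ = ℋ⇒C φ∈ in
        ℋ-resp (λ x → trans (φ≗ _) (cong (op A) (trans (cong (τ M) (BB′ _)) (sym (τ-⊗ (Ω ω) M (op B x))))))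
          (C⇒ℋ {Ω ω ⊗ M} (Ω⊗∈C ω {M} M∈))
      open Scalars Ψ (λ {M} {N} → Ψ-cong {M} {N}) (λ {M} {N} → Ψ-injective {M} {N}) (λ x → trans (cong (op B′) (τ-1 _)) (B′B x))
        (λ ω ω′ x → trans (Ψ-cong {Ω ω ⊗ Ω ω′} {Ω ω′ ⊗ Ω ω} (Ω-comm ω ω′) x) (Ψ-⊗ (Ω ω′) (Ω ω) x)) scalar
      open Contravariant Ψ-⊗
      cycle : s′ + n + (s + n) ≡ (s + 1) * m
      cycle = begin
        s′ + n + (s + n)           ≡⟨ ℕₚ.+-assoc s′ n (s + n) ⟩
        s′ + (n + (s + n))         ≡⟨ cong (s′ +_) (trans (ℕₚ.+-comm n (s + n)) (ℕₚ.+-assoc s n n)) ⟩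
        s′ + (s + (n + n))         ≡⟨ ℕₚ.+-assoc s′ s (n + n) ⟨
        s′ + s + (n + n)           ≡⟨ cong₂ _+_ (trans (ℕₚ.+-comm s′ s) (i+opposite s)) (cong (n +_) (sym (ℕₚ.+-identityʳ n))) ⟩
        s * m + m                  ≡⟨ cong (s * m +_) (sym (ℕₚ.+-identityʳ m)) ⟩
        s * m + 1 * m              ≡⟨ ℕₚ.*-distribʳ-+ m s 1 ⟨
        (s + 1) * m                ∎
      inverse-s+n : ∀ x → x ^[ s′ + n ] ^[ s + n ] ≡ x
      inverse-s+n x = trans (^[]-^[] (s′ + n) (s + n) x) (trans (cong (x ^[_]) cycle) (^[*m] (s + 1) x))
      inverse-s′+n : ∀ x → x ^[ s + n ] ^[ s′ + n ] ≡ x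
      inverse-s′+n x = trans (^[]-^[] (s + n) (s′ + n) x) (trans (cong (x ^[_]) (trans (ℕₚ.+-comm (s + n) (s′ + n)) cycle)) (^[*m] (s + 1) x))
      β β′ : Carrier
      β = ν b ^[ s′ ] · Ψ (Θ s) 1#
      β′ = Ψ (Θ (s + n)) 1#
      β≢0 : β ≢ 0#
      β≢0 = ·-≢0 (^[]-≢0 s′ (ν-≢0 b≢0)) (Ψ-Θ-≢0 s s′ (opposite-^[] s) (^[]-opposite s))
      β′≢0 : β′ ≢ 0#
      β′≢0 = Ψ-Θ-≢0 (s + n) (s′ + n) inverse-s+n inverse-s′+n
      Ψ-F : ∀ y → Ψ F y ≡ β · y ^[ s′ ] ⊞ β′ · y ^[ s′ + n ]
      Ψ-F y = trans (cong (op B′) (τ-⊕ (Ω b ⊗ Θ s) (Θ (s + n)) _)) (trans (op-+ B′ _ _) (cong₂ _⊞_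
        (begin
          Ψ (Ω b ⊗ Θ s) y                            ≡⟨ Ψ-⊗ (Ω b) (Θ s) y ⟩
          Ψ (Θ s) (Ψ (Ω b) y)                        ≡⟨ Ψ-Θ s s′ (opposite-^[] s) _ ⟩
          (Ψ (Ω b) y) ^[ s′ ] · Ψ (Θ s) 1#           ≡⟨ cong (λ z → z ^[ s′ ] · Ψ (Θ s) 1#) (Ψ-Ω b y) ⟩
          (ν b · y) ^[ s′ ] · Ψ (Θ s) 1#             ≡⟨ cong (_· Ψ (Θ s) 1#) (trans (^[]-· s′ (ν b) y) (*-comm _ _)) ⟩
          y ^[ s′ ] · ν b ^[ s′ ] · Ψ (Θ s) 1#       ≡⟨ *-assoc _ _ _ ⟩
          y ^[ s′ ] · β                              ≡⟨ *-comm _ _ ⟩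
          β · y ^[ s′ ]                              ∎)
        (trans (Ψ-Θ (s + n) (s′ + n) inverse-s+n y) (*-comm _ _))))

  inequivalent : ¬ Equivalent 𝐂 𝐇
  inequivalent (A , B , σ , (A′ , AA′ , A′A) , (B′ , BB′ , B′B) , σ-auto , inj₁ equivalent) =
    Twist.contradiction-covariant (mapEntries σ) (λ M≈N i j → cong σ (M≈N i j)) (mapEntries-injective σ-auto)
      (mapEntries-identity σ-auto) (mapEntries-⊕ σ-auto) {A} {A′} {B} {B′} AA′ A′A BB′ B′B equivalent (mapEntries-⊗ σ-auto)
  inequivalent (A , B , σ , (A′ , AA′ , A′A) , (B′ , BB′ , B′B) , σ-auto , inj₂ equivalent) =
    Twist.contradiction-contravariant (mapEntries σ ∘ transpose) (λ M≈N i j → cong σ (M≈N j i))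
      (λ eq i j → mapEntries-injective σ-auto eq j i)
      (λ i j → trans (cong σ (transpose-identity i j)) (mapEntries-identity σ-auto i j))
      (λ M N → mapEntries-⊕ σ-auto (transpose M) (transpose N)) {A} {A′} {B} {B′} AA′ A′A BB′ B′B equivalent
      (λ M N i j → trans (cong σ (transpose-⊗ M N i j)) (mapEntries-⊗ σ-auto (transpose N) (transpose M) i j))

-- Assembly

-- The length is a variable `m` so that `m ≡ suc m′` can be matched with `refl`; `2 * n` does not
-- reduce to a successor.
scatteredCode : (K L : Field) (ι : Field.Carrier K → Field.Carrier L) (ι-hom : IsFieldHomomorphism K L ι)
  {m m′ : ℕ} → m ≡ suc m′ → Fin m′ →
  (e : Vector (Field.Carrier L) m) (basis : Extension.IsBasisOfExtension K L ι e)
  {q N : ℕ} (K-order : HasOrder K q) → 1 < q → HasOrder L N →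
  (f : Field.Carrier L → Field.Carrier L)
  (f-linear : Coordinates.IsLinear K L ι ι-hom e basis f) →
  Extension.IsScattered K L ι (λ w → ∃[ x ] w ≡ (x , f x)) →
  let open Extension K L ι
      open LinearAlgebra K
      open RankMetric K m
      open TwoDimensionalCode K L ι ι-hom e basis K-order f f-linear
  in HasDimension matrices (toCode e Words) (m + m) × IsMRD q (toCode e Words) m′
scatteredCode K L ι ι-hom refl i₁ e basis K-order 1<q L-order f f-linear scattered = dimension , mrd
  where open ScatteredCode K L ι ι-hom i₁ e basis K-order 1<q L-order f f-linear scattered

theorem6p4 :
  (q n : ℕ) → IsPrimePower q → 2 < n →
  (K L : Field) → HasOrder K q → HasOrder L (q ^ (2 * n)) →
  (ι : Field.Carrier K → Field.Carrier L) → IsFieldHomomorphism K L ι →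
  (e : Vector (Field.Carrier L) (2 * n)) →
  Extension.IsBasisOfExtension K L ι e →
  let open Extension K L ι
      open LinearAlgebra K
      open RankMetric K (2 * n)
      open Families L q n
  in
  (b : Field.Carrier L) (s : ℕ) → b ≢ Field.0# L →
  1 ≤ s → s ≤ 2 * n ∸ 1 → gcd s n ≡ 1 →
  norm L (q ^ n) 2 b ≢ Field.1# L →
  IsScattered U⟨ b , s ⟩ →
  HasDimension matrices (toCode e 𝒞⟨ b , s ⟩) (4 * n)
  × IsMRD q (toCode e 𝒞⟨ b , s ⟩) (2 * n ∸ 1)
  × ((t h : ℕ) (μ : Field.Carrier L) → gcd t (2 * n) ≡ 1 →
     norm L (q ^ t) (2 * n) μ ≢ Field.1# L →
     ¬ Equivalent (toCode e 𝒞⟨ b , s ⟩) (toCode e (ℋ₂ t μ h)))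
theorem6p4 q n prime-power 2<n K L K-order L-order ι ι-hom e basis b s b≢0 1≤s s≤ s-coprime b-norm scattered =
  subst (HasDimension matrices (toCode e Words)) (sym (ℕₚ.*-distribʳ-+ n 2 2)) (proj₁ code) ,
  proj₂ code ,
  λ t h μ t-coprime μ-norm → inequivalent t h μ t-coprime
  where
  open Extension K L ι
  open LinearAlgebra K
  open RankMetric K (2 * n)
  instance
    2n≢0 : NonZero (2 * n)
    2n≢0 = >-nonZero (ℕₚ.≤-trans (ℕₚ.≤-<-trans z≤n 2<n) (ℕₚ.m≤m+n n (n + 0)))
  module _ (t h : ℕ) (μ : Field.Carrier L) (t-coprime : gcd t (2 * n) ≡ 1) where
    open Inequivalence K L ι ι-hom 2<n prime-power e basis K-order L-order b s b≢0 t h μ t-coprime public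
      using (inequivalent)
  open LinearizedPolynomials L L-order prime-power using (_^[_]; 1<q)
  open FrobeniusMatrices K L ι ι-hom prime-power e basis K-order L-order using (^[]-linear)
  open Coordinates K L ι ι-hom e basis using (IsLinear; linear-+; linear-scale)
  -- With this `f`, `𝒞⟨ b , s ⟩` unfolds to `Words` and `U⟨ b , s ⟩` to the graph of `f`, so no
  -- conversion between them is needed.
  f : Field.Carrier L → Field.Carrier L
  f x = Field._+_ L (Field._*_ L b (x ^[ s ])) (x ^[ s + n ])
  f-linear : IsLinear f
  f-linear = linear-+ (linear-scale b (^[]-linear s)) (^[]-linear (s + n))
  open TwoDimensionalCode K L ι ι-hom e basis K-order f f-linear using (Words)
  1<2n : 1 < 2 * n
  1<2n = ℕₚ.<-≤-trans (ℕₚ.<-trans (s≤s (s≤s z≤n)) 2<n) (ℕₚ.m≤m+n n (n + 0))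
  code : HasDimension matrices (toCode e Words) (2 * n + 2 * n) × IsMRD q (toCode e Words) (2 * n ∸ 1)
  -- The index is 0 in `Fin (2 * n ∸ 1)`: it designates the second basis vector, which exists
  -- because 1 < 2 n.
  code = scatteredCode K L ι ι-hom (sym (ℕₚ.suc-pred (2 * n))) (fromℕ< (ℕₚ.∸-monoˡ-< 1<2n ℕₚ.≤-refl))
    e basis K-order 1<q L-order f f-linear scattered
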